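{- (i) A non-trapezoidal convex quadrangle admits a $3$-self-affinity based on a glass-cut dissection of combinatorial type $\mathcal A$ if and only if it is of an affine type $Q[x,y]$ with $(x,y)$ in $\mathbf A=\{(x,y): x+y>1,\ y<1,\ x<y,\ y^3+xy^2-x^2-y^2=0\}$. (ii) A non-trapezoidal convex quadrangle admits a $3$-self-affinity based on a glass-cut dissection of combinatorial type $\mathcal B$ if and only if it is of an affine type $Q[x,y]$ with $(x,y)$ in one of the two families $\mathbf B_1=\{(x,y): x+y>1,\ y<1,\ x<y,\ (x+1)y^2-(x+1)y+x(1-x)=0\}$ or $\mathbf B_2=\{(x,y): x+y>1,\ y<1,\ x<y,\ x^3+(-y^2+y-2)x^2+(-y^3+2y^2-y+1)x+y^2-y=0\}$.
   Context: A convex quadrangle is of affine type $Q[x,y]$ if an affine map sending three consecutive vertices to $\binom01,\binom00,\binom10$ sends the fourth to $\binom xy$ (then $x,y>0$, $x+y>1$). A trapezoid is a convex quadrangle with a pair of parallel sides. A $3$-self-affinity of $Q$ is a dissection of $Q$ into three affine images of $Q$ (union is $Q$, interiors pairwise disjoint). A glass-cut dissection is obtained by successively cutting a piece into two along a straight segment joining two of its boundary points. Type $\mathcal A$: $Q$ is cut by two disjoint segments, each joining a relative interior point of a side $a$ to a relative interior point of the opposite side $c$ (same pair $a,c$ for both). Type $\mathcal B$: $Q$ is cut by a segment $s$ joining relative interior points of two opposite sides into two quadrangles, and one of these is further cut by a segment joining a relative interior point of $s$ to a relative interior point of the side of that quadrangle opposite to $s$. -}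

module Defs where

open import Data.Nat using (ℕ; zero; suc)
open import Data.Fin using (Fin; toℕ)
import Data.Fin as F
open import Data.Bool using (Bool; true; false)
open import Data.Product using (Σ; ∃; ∃-syntax; _×_; _,_; proj₁; proj₂)
open import Data.Sum using (_⊎_)
open import Relation.Binary.PropositionalEquality using (_≡_; _≢_)
open import Relation.Binary.Structures using (IsStrictTotalOrder)
open import Algebra.Structures using (IsCommutativeRing)
open import Function.Bundles using (_⇔_)

-- The real numbers, axiomatised as a Dedekind-complete ordered field
-- (unique up to isomorphism, so quantifying over all models = ℝ).

record RealField : Set₁ where
  infixl 6 _+_
  infixl 7 _*_
  infix 4 _<_
  field
    Carrier : Set
    _+_ _*_ : Carrier → Carrier → Carrier
    -_ : Carrier → Carrier
    0# 1# : Carrier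
    _<_ : Carrier → Carrier → Set
    isCommutativeRing : IsCommutativeRing _≡_ _+_ _*_ -_ 0# 1#
    0≢1 : 0# ≢ 1#
    inverse : ∀ x → x ≢ 0# → ∃[ y ] (x * y ≡ 1#)
    isStrictTotalOrder : IsStrictTotalOrder _≡_ _<_
    +-mono-< : ∀ {x y} z → x < y → x + z < y + z
    *-pos : ∀ {x y} → 0# < x → 0# < y → 0# < x * y

  _≤_ : Carrier → Carrier → Set
  x ≤ y = (x < y) ⊎ (x ≡ y)

  field
    sup : (S : Carrier → Set) → Σ Carrier S →
          Σ Carrier (λ b → ∀ x → S x → x ≤ b) →
          Σ Carrier (λ m → (∀ x → S x → x ≤ m) ×
                           (∀ b → (∀ x → S x → x ≤ b) → m ≤ b))

mod4 : ℕ → Fin 4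
mod4 0 = F.zero
mod4 1 = F.suc F.zero
mod4 2 = F.suc (F.suc F.zero)
mod4 3 = F.suc (F.suc (F.suc F.zero))
mod4 (suc (suc (suc (suc n)))) = mod4 n

-- i-th vertex after relabelling: start at k, go forward (true) or
-- backward (false) along the cyclic order.
relabel : Fin 4 → Bool → ℕ → Fin 4
relabel k true  i = mod4 (toℕ k Data.Nat.+ i)
relabel k false i = mod4 (toℕ k Data.Nat.+ 3 Data.Nat.* i)

module Geometry (ℝ : RealField) where
  open RealField ℝ public

  _-_ : Carrier → Carrier → Carrier
  x - y = x + (- y)
  infixl 6 _-_

  Point : Set
  Point = Carrier × Carrier

  pt : Carrier → Carrier → Point
  pt a b = a , b

  _−ᵖ_ : Point → Point → Point
  (a , b) −ᵖ (c , d) = (a - c) , (b - d)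

  cross : Point → Point → Carrier
  cross (a , b) (c , d) = a * d - b * c

  lerp : Point → Point → Carrier → Point
  lerp (a , b) (c , d) s = (a + s * (c - a)) , (b + s * (d - b))

  InOpenUnit : Carrier → Set
  InOpenUnit s = (0# < s) × (s < 1#)

  -- a quadrangle is given by its four vertices in cyclic order
  Quad : Set
  Quad = Fin 4 → Point

  quad : Point → Point → Point → Point → Quad
  quad a b c d F.zero = a
  quad a b c d (F.suc F.zero) = b
  quad a b c d (F.suc (F.suc F.zero)) = c
  quad a b c d (F.suc (F.suc (F.suc F.zero))) = d

  V : Quad → ℕ → Point
  V Q i = Q (mod4 i)

  turn : Quad → ℕ → Carrier
  turn Q i = cross (V Q (suc i) −ᵖ V Q i) (V Q (suc (suc i)) −ᵖ V Q (suc i))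

  ConvexQuad : Quad → Set
  ConvexQuad Q = (∀ i → 0# < turn Q i) ⊎ (∀ i → turn Q i < 0#)

  Parallel : Point → Point → Point → Point → Set
  Parallel a b c d = cross (b −ᵖ a) (d −ᵖ c) ≡ 0#

  NonTrapezoid : Quad → Set
  NonTrapezoid Q = (Parallel (V Q 0) (V Q 1) (V Q 2) (V Q 3) → ⊥')
                 × (Parallel (V Q 1) (V Q 2) (V Q 3) (V Q 0) → ⊥')
    where open import Data.Empty renaming (⊥ to ⊥')

  InQuad : Quad → Point → Set
  InQuad Q p = Σ (Fin 4 → Carrier) λ l →
      (∀ i → 0# ≤ l i)
    × (l F.zero + l (F.suc F.zero) + l (F.suc (F.suc F.zero))
         + l (F.suc (F.suc (F.suc F.zero))) ≡ 1#)
    × (comb l ≡ p)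
    where
    comb : (Fin 4 → Carrier) → Point
    comb l = (Σ4 λ i → l i * proj₁ (Q i)) , (Σ4 λ i → l i * proj₂ (Q i))
      where
      Σ4 : (Fin 4 → Carrier) → Carrier
      Σ4 f = f F.zero + f (F.suc F.zero) + f (F.suc (F.suc F.zero))
             + f (F.suc (F.suc (F.suc F.zero)))

  record AffineMap : Set where
    constructor affine
    field
      m₁₁ m₁₂ m₂₁ m₂₂ t₁ t₂ : Carrier
      nondeg : m₁₁ * m₂₂ - m₁₂ * m₂₁ ≢ 0#

  apply : AffineMap → Point → Point
  apply f (p₁ , p₂) = (m₁₁ * p₁ + m₁₂ * p₂ + t₁) , (m₂₁ * p₁ + m₂₂ * p₂ + t₂)
    where open AffineMap f

  ImageUnder : AffineMap → Quad → Quad → Set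
  ImageUnder f Q P = ∀ p → InQuad P p ⇔ (∃[ q ] (InQuad Q q × apply f q ≡ p))

  IsAffineImageOf : Quad → Quad → Set
  IsAffineImageOf P Q = ∃[ f ] ImageUnder f Q P

  AffineType : Quad → Carrier → Carrier → Set
  AffineType Q x y = Σ (Fin 4) λ k → Σ Bool λ b → ∃[ f ]
      (apply f (Q (relabel k b 0)) ≡ pt 0# 1#)
    × (apply f (Q (relabel k b 1)) ≡ pt 0# 0#)
    × (apply f (Q (relabel k b 2)) ≡ pt 1# 0#)
    × (apply f (Q (relabel k b 3)) ≡ pt x y)

  -- type 𝒜: two disjoint segments P₁Q₁, P₂Q₂ with Pⱼ ∈ relint AB,
  -- Qⱼ ∈ relint DC; disjointness means (after naming) s₁<s₂ and t₁<t₂.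
  SelfAffinityA : Quad → Set
  SelfAffinityA Q = Σ ℕ λ k →
    let A = V Q k ; B = V Q (suc k) ; C = V Q (suc (suc k))
        D = V Q (suc (suc (suc k))) in
    Σ Carrier λ s₁ → Σ Carrier λ s₂ → Σ Carrier λ t₁ → Σ Carrier λ t₂ →
    let P₁ = lerp A B s₁ ; P₂ = lerp A B s₂
        Q₁ = lerp D C t₁ ; Q₂ = lerp D C t₂ in
      InOpenUnit s₁ × InOpenUnit s₂ × InOpenUnit t₁ × InOpenUnit t₂
    × s₁ < s₂ × t₁ < t₂
    × IsAffineImageOf (quad A P₁ Q₁ D) Q
    × IsAffineImageOf (quad P₁ P₂ Q₂ Q₁) Q
    × IsAffineImageOf (quad P₂ B C Q₂) Q

  -- type ℬ: segment PQ' with P ∈ relint AB, Q' ∈ relint DC; one of the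
  -- two quadrangles APQ'D, PBCQ' is further cut by a segment RS with
  -- R ∈ relint PQ' and S in the relative interior of the opposite side
  -- (DA resp. BC).
  SelfAffinityB : Quad → Set
  SelfAffinityB Q = Σ ℕ λ k →
    let A = V Q k ; B = V Q (suc k) ; C = V Q (suc (suc k))
        D = V Q (suc (suc (suc k))) in
    Σ Carrier λ s → Σ Carrier λ t → Σ Carrier λ r → Σ Carrier λ u →
    let P = lerp A B s ; Q' = lerp D C t ; R = lerp P Q' r in
      InOpenUnit s × InOpenUnit t × InOpenUnit r × InOpenUnit u
    × ( ( IsAffineImageOf (quad P B C Q') Q
        × IsAffineImageOf (quad A P R (lerp A D u)) Q
        × IsAffineImageOf (quad (lerp A D u) R Q' D) Q )
      ⊎ ( IsAffineImageOf (quad A P Q' D) Q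
        × IsAffineImageOf (quad P B (lerp B C u) R) Q
        × IsAffineImageOf (quad R (lerp B C u) C Q') Q ) )

  Base : Carrier → Carrier → Set
  Base x y = (1# < x + y) × (y < 1#) × (x < y)

  2# : Carrier
  2# = 1# + 1#

  FamA : Carrier → Carrier → Set
  FamA x y = Base x y × (y * y * y + x * y * y - x * x - y * y ≡ 0#)

  FamB₁ : Carrier → Carrier → Set
  FamB₁ x y = Base x y ×
    ((x + 1#) * (y * y) - (x + 1#) * y + x * (1# - x) ≡ 0#)

  FamB₂ : Carrier → Carrier → Set
  FamB₂ x y = Base x y ×
    (x * x * x + (- (y * y) + y - 2#) * (x * x)
       + (- (y * y * y) + 2# * (y * y) - y + 1#) * x + y * y - y ≡ 0#)

{-# OPTIONS --safe #-}
-- The turns of a quadrangle (twice the areas of its corner triangles) determine its affine type up to scaling and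
-- relabelling, because an affine image has its vertices and edges in correspondence with those of the original.
-- If the sides V₀V₁ and V₃V₂ meet in O, the turns are in turn determined up to scaling by a = OV₀/OV₁ and b = OV₃/OV₂.
-- For Q[x,y] with x, y < 1 and z = x + y − 1 the pairs (a , b) below 1 are (z/y , x), (z/x , y) and their reversals.
-- Cutting a quadrangle by segments between V₀V₁ and V₃V₂ factors its pair (a , b) into the pairs of the pieces.
-- Type A: the pair (z/y , x) is a product of three pairs, all different from it. Comparing a / b, which is the same for
-- both unreversed pairs, they are twice (z/x , y) and once (y , z/x), so x = y² z/x.
-- Type B: the piece cut off first has the pair (y , z/x), since (z/x , y) would leave a trapezoid and then two more.
-- The remainder has the pair (z/y² , x²/z), and its pair on the other sides is the inverse of a product of two
-- unreversed pairs: b = x² yields B₁, b = xy yields B₂, and b = y² is impossible.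
module Submission where

open import Defs
open import Algebra.Bundles using (CommutativeRing)
open import Data.Bool as Bool using (Bool; true; false; not)
open import Data.Empty using (⊥; ⊥-elim)
open import Data.Fin using (Fin; toℕ; _≟_)
open import Data.Fin.Patterns using (0F; 1F; 2F; 3F)
open import Data.Fin.Properties using (all?)
open import Data.Integer using (ℤ; -[1+_])
import Data.Integer as ℤ
import Data.Integer.Properties as ℤₚ
open import Data.Maybe using (nothing)
open import Data.Nat using (ℕ; zero; suc)
import Data.Nat as ℕ
open import Data.Product as Product using (Σ; ∃; ∃-syntax; _×_; _,_; proj₁; proj₂)
open import Data.Sum as Sum using (_⊎_; inj₁; inj₂)
open import Data.Unit using (tt)
open import Data.Vec using (Vec; []; _∷_)
import Data.Vec as Vec
open import Data.Vec.N-ary using (N-ary; ∀ⁿ; curryⁿ; uncurry-∀ⁿ; left-inverse; _$ⁿ_)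
open import Function using (_∘_; id)
open import Function.Bundles using (_⇔_; mk⇔; Equivalence)
open import Relation.Binary.Definitions using (tri<; tri≈; tri>)
open import Relation.Binary.PropositionalEquality
open import Relation.Binary.Structures using (IsStrictTotalOrder)
open import Relation.Nullary using (¬_; Dec)
open import Relation.Nullary.Decidable using (from-yes)
open import Tactic.RingSolver.Core.AlmostCommutativeRing using (fromCommutativeRing)
open import Tactic.RingSolver.Core.Expression
open import Tactic.RingSolver.Core.Polynomial.Parameters using (RawCoeff; Homomorphism)

-- The obstacle is twofold: a piece may be an image of `Q` under any of the eight labellings, and
-- the cut points are free parameters. Measuring points of V₀V₁ and V₃V₂ from O, with V₁ and V₂ at
-- 1, removes the parameters: the ratio of a piece is the quotient of the coordinates of its ends,
-- and such quotients telescope. A dissection thus becomes an equation between products of members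
-- of a finite set of pairs; conversely, the partial products of such a factorization are the
-- coordinates of the cut points. The relabellings that keep a pair of sides only exchange or invert
-- the entries of a pair, so p < q < 1 may be assumed. Inequalities mostly serve to discard cases of
-- a finite enumeration; what remains are polynomial identities with explicit cofactors, left to a
-- ring solver. The condition x < y is not imposed on the quadrangle beforehand: it follows from the
-- existence of a factorization.

-- Ring identities by normalisation over the integers

isZeroℤ : ℤ → Bool
isZeroℤ (ℤ.+ 0) = true
isZeroℤ _     = false

-- The reals are abstract, so a real coefficient cannot be tested for zero by computation; integer
-- coefficients can, which makes cancelled terms vanish during normalisation.
ℤ-coeff : RawCoeff _ _
ℤ-coeff = record { rawRing = CommutativeRing.rawRing ℤₚ.+-*-commutativeRing ; isZero = isZeroℤ }

open import Tactic.RingSolver.Core.Polynomial.Base ℤ-coeff using (Poly; Zero; κ; ι; _⊞_; _⊠_; ⊟_; _⊡_)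

norm : ∀ {n} → Expr ℤ n → Poly n
norm (Κ x)   = κ x
norm (Ι x)   = ι x
norm (x ⊕ y) = norm x ⊞ norm y
norm (x ⊗ y) = norm x ⊠ norm y
norm (⊝ x)   = ⊟ norm x
norm (x ⊛ i) = norm x ⊡ i

infixl 6 _⊖_
infix 4 _⊜_

_⊖_ : ∀ {n} → Expr ℤ n → Expr ℤ n → Expr ℤ n
x ⊖ y = x ⊕ ⊝ y

:0 :1 : ∀ {n} → Expr ℤ n
:0 = Κ (ℤ.+ 0)
:1 = Κ (ℤ.+ 1)

_⊜_ : ∀ {n} → Expr ℤ n → Expr ℤ n → Expr ℤ n × Expr ℤ n
_⊜_ = _,_

toPairs : ∀ {A : Set} m {n} → Vec A (m ℕ.* 2 ℕ.+ n) → Vec (A × A) m × Vec A n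
toPairs zero    v           = [] , v
toPairs (suc m) (x ∷ y ∷ v) = let ps , w = toPairs m v in (x , y) ∷ ps , w

fromPairs : ∀ {A : Set} {m n} → Vec (A × A) m → Vec A n → Vec A (m ℕ.* 2 ℕ.+ n)
fromPairs []             v = v
fromPairs ((x , y) ∷ ps) v = x ∷ y ∷ fromPairs ps v

Exprᵖ : ℕ → Set
Exprᵖ n = Expr ℤ n × Expr ℤ n

-- Point variables take two consecutive scalar variables each and precede the proper scalars, so
-- that identities between turns can be written in terms of points.
closeᵖ : ∀ m n → N-ary m (Exprᵖ (m ℕ.* 2 ℕ.+ n)) (N-ary n (Expr ℤ (m ℕ.* 2 ℕ.+ n)) (Exprᵖ (m ℕ.* 2 ℕ.+ n))) →
         Exprᵖ (m ℕ.* 2 ℕ.+ n)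
closeᵖ m n f = let ps , xs = toPairs m (Vec.map Ι (Vec.allFin (m ℕ.* 2 ℕ.+ n))) in (f $ⁿ ps) $ⁿ xs

crossᴱ : ∀ {n} → Exprᵖ n → Exprᵖ n → Expr ℤ n
crossᴱ (a , b) (c , d) = a ⊗ d ⊖ b ⊗ c

cross³ᴱ : ∀ {n} → Exprᵖ n → Exprᵖ n → Exprᵖ n → Expr ℤ n
cross³ᴱ (a , b) (c , d) (e , f) = crossᴱ (c ⊖ a , d ⊖ b) (e ⊖ c , f ⊖ d)

lerpᴱ : ∀ {n} → Exprᵖ n → Exprᵖ n → Expr ℤ n → Exprᵖ n
lerpᴱ (a , b) (c , d) s = a ⊕ s ⊗ (c ⊖ a) , b ⊕ s ⊗ (d ⊖ b)

-- The bracketing copies that of the family definitions, so that evaluation gives back exactly their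
-- left-hand sides.
famA-poly : ∀ {n} → Expr ℤ n → Expr ℤ n → Expr ℤ n
famA-poly x y = y ⊗ y ⊗ y ⊕ x ⊗ y ⊗ y ⊖ x ⊗ x ⊖ y ⊗ y

famB₁-poly : ∀ {n} → Expr ℤ n → Expr ℤ n → Expr ℤ n
famB₁-poly x y = (x ⊕ :1) ⊗ (y ⊗ y) ⊖ (x ⊕ :1) ⊗ y ⊕ x ⊗ (:1 ⊖ x)

famB₂-poly : ∀ {n} → Expr ℤ n → Expr ℤ n → Expr ℤ n
famB₂-poly x y = x ⊗ x ⊗ x ⊕ (⊝ (y ⊗ y) ⊕ y ⊖ (:1 ⊕ :1)) ⊗ (x ⊗ x)
       ⊕ (⊝ (y ⊗ y ⊗ y) ⊕ (:1 ⊕ :1) ⊗ (y ⊗ y) ⊖ y ⊕ :1) ⊗ x ⊕ y ⊗ y ⊖ y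

module Proof (ℝ : RealField) where
  open Geometry ℝ

  ℝ-ring : CommutativeRing _ _
  ℝ-ring = record { isCommutativeRing = isCommutativeRing }

  module R = CommutativeRing ℝ-ring
  open import Algebra.Properties.Ring R.ring
    using (+-cancelʳ; -‿injective; -‿distribˡ-*; -‿distribʳ-*; -‿+-comm; -0#≈0#; -‿involutive; x∙y⁻¹≈ε⇒x≈y)
  open import Algebra.Properties.CommutativeSemigroup R.+-commutativeSemigroup using (interchange)
  open import Algebra.Properties.Semiring.Mult.TCOptimised R.semiring using (×-homo-+; ×1-homo-*) renaming (_×_ to _·_)

  ⟦_⟧ℤ : ℤ → Carrier
  ⟦ ℤ.+ n ⟧ℤ      = n · 1#
  ⟦ -[1+ n ] ⟧ℤ = - (suc n · 1#)

  ⟦⟧-neg : ∀ i → ⟦ ℤ.- i ⟧ℤ ≡ - ⟦ i ⟧ℤ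
  ⟦⟧-neg (ℤ.+ zero)   = sym -0#≈0#
  ⟦⟧-neg (ℤ.+ suc n)  = refl
  ⟦⟧-neg (-[1+ n ]) = sym (-‿involutive _)

  ⟦⟧-⊖ : ∀ m n → ⟦ m ℤ.⊖ n ⟧ℤ ≡ m · 1# - n · 1#
  ⟦⟧-⊖ m zero = sym (trans (cong (m · 1# +_) -0#≈0#) (R.+-identityʳ _))
  ⟦⟧-⊖ zero (suc n) = sym (R.+-identityˡ _)
  ⟦⟧-⊖ (suc m) (suc n) = begin
    ⟦ suc m ℤ.⊖ suc n ⟧ℤ               ≡⟨ cong ⟦_⟧ℤ (ℤₚ.[1+m]⊖[1+n]≡m⊖n m n) ⟩
    ⟦ m ℤ.⊖ n ⟧ℤ                       ≡⟨ ⟦⟧-⊖ m n ⟩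
    m · 1# - n · 1#                     ≡⟨ R.+-identityˡ _ ⟨
    0# + (m · 1# - n · 1#)              ≡⟨ cong (_+ (m · 1# - n · 1#)) (R.-‿inverseʳ 1#) ⟨
    1# - 1# + (m · 1# - n · 1#)         ≡⟨ interchange 1# (- 1#) (m · 1#) (- (n · 1#)) ⟩
    1# + m · 1# + (- 1# - n · 1#)       ≡⟨ cong (1# + m · 1# +_) (-‿+-comm 1# (n · 1#)) ⟩
    1# + m · 1# - (1# + n · 1#)         ≡⟨ cong₂ _-_ (×-homo-+ 1# 1 m) (×-homo-+ 1# 1 n) ⟨
    suc m · 1# - suc n · 1#             ∎
    where open ≡-Reasoning

  ⟦⟧-+ : ∀ i j → ⟦ i ℤ.+ j ⟧ℤ ≡ ⟦ i ⟧ℤ + ⟦ j ⟧ℤ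
  ⟦⟧-+ (ℤ.+ m) (ℤ.+ n)           = ×-homo-+ 1# m n
  ⟦⟧-+ (ℤ.+ m) (-[1+ n ])      = ⟦⟧-⊖ m (suc n)
  ⟦⟧-+ (-[1+ m ]) (ℤ.+ n)      = trans (⟦⟧-⊖ n (suc m)) (R.+-comm _ _)
  ⟦⟧-+ (-[1+ m ]) (-[1+ n ]) = begin
    ⟦ -[1+ m ] ℤ.+ -[1+ n ] ⟧ℤ         ≡⟨ cong ⟦_⟧ℤ (ℤₚ.neg-distrib-+ (ℤ.+ suc m) (ℤ.+ suc n)) ⟨
    - ((suc m ℕ.+ suc n) · 1#)          ≡⟨ cong -_ (×-homo-+ 1# (suc m) (suc n)) ⟩
    - (suc m · 1# + suc n · 1#)         ≡⟨ -‿+-comm _ _ ⟨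
    - (suc m · 1#) - suc n · 1#         ∎
    where open ≡-Reasoning

  ⟦⟧-*⁺ : ∀ m j → ⟦ ℤ.+ m ℤ.* j ⟧ℤ ≡ m · 1# * ⟦ j ⟧ℤ
  ⟦⟧-*⁺ m (ℤ.+ n) = trans (cong ⟦_⟧ℤ (sym (ℤₚ.pos-* m n))) (×1-homo-* m n)
  ⟦⟧-*⁺ m (-[1+ n ]) = begin
    ⟦ ℤ.+ m ℤ.* -[1+ n ] ⟧ℤ        ≡⟨ cong ⟦_⟧ℤ (ℤₚ.neg-distribʳ-* (ℤ.+ m) (ℤ.+ suc n)) ⟨
    ⟦ ℤ.- (ℤ.+ m ℤ.* ℤ.+ suc n) ⟧ℤ ≡⟨ ⟦⟧-neg (ℤ.+ m ℤ.* ℤ.+ suc n) ⟩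
    - ⟦ ℤ.+ m ℤ.* ℤ.+ suc n ⟧ℤ     ≡⟨ cong -_ (⟦⟧-*⁺ m (ℤ.+ suc n)) ⟩
    - (m · 1# * suc n · 1#)         ≡⟨ -‿distribʳ-* _ _ ⟩
    m · 1# * - (suc n · 1#)         ∎
    where open ≡-Reasoning

  ⟦⟧-* : ∀ i j → ⟦ i ℤ.* j ⟧ℤ ≡ ⟦ i ⟧ℤ * ⟦ j ⟧ℤ
  ⟦⟧-* (ℤ.+ m) j = ⟦⟧-*⁺ m j
  ⟦⟧-* (-[1+ m ]) j = begin
    ⟦ -[1+ m ] ℤ.* j ⟧ℤ            ≡⟨ cong ⟦_⟧ℤ (ℤₚ.neg-distribˡ-* (ℤ.+ suc m) j) ⟨
    ⟦ ℤ.- (ℤ.+ suc m ℤ.* j) ⟧ℤ     ≡⟨ ⟦⟧-neg (ℤ.+ suc m ℤ.* j) ⟩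
    - ⟦ ℤ.+ suc m ℤ.* j ⟧ℤ         ≡⟨ cong -_ (⟦⟧-*⁺ (suc m) j) ⟩
    - (suc m · 1# * ⟦ j ⟧ℤ)        ≡⟨ -‿distribˡ-* _ _ ⟩
    - (suc m · 1#) * ⟦ j ⟧ℤ        ∎
    where open ≡-Reasoning

  isZeroℤ-sound : ∀ i → Bool.T (isZeroℤ i) → 0# ≡ ⟦ i ⟧ℤ
  isZeroℤ-sound (ℤ.+ 0) _ = refl

  homo : Homomorphism _ _ _ _
  homo = record
    { from = ℤ-coeff
    ; to = fromCommutativeRing ℝ-ring (λ _ → nothing)
    ; morphism = record
      { ⟦_⟧ = ⟦_⟧ℤ ; +-homo = ⟦⟧-+ ; *-homo = ⟦⟧-* ; -‿homo = ⟦⟧-neg ; 0-homo = refl ; 1-homo = refl }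
    ; Zero-C⟶Zero-R = isZeroℤ-sound
    }

  open Eval R.rawRing ⟦_⟧ℤ public
  open import Tactic.RingSolver.Core.Polynomial.Homomorphism homo
  open import Tactic.RingSolver.Core.Polynomial.Homomorphism.Lemmas homo using (zero-hom)
  open import Tactic.RingSolver.Core.Polynomial.Semantics homo using () renaming (⟦_⟧ to ⟦_⟧ₚ)
  open import Algebra.Properties.Semiring.Exp.TCOptimised R.semiring using (^-congˡ)

  norm-correct : ∀ {n} (e : Expr ℤ n) ρ → ⟦ norm e ⟧ₚ ρ ≡ ⟦ e ⟧ ρ
  norm-correct (Κ x)   ρ = κ-hom x ρ
  norm-correct (Ι x)   ρ = ι-hom x ρ
  norm-correct (x ⊕ y) ρ = trans (⊞-hom (norm x) (norm y) ρ) (cong₂ _+_ (norm-correct x ρ) (norm-correct y ρ))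
  norm-correct (x ⊗ y) ρ = trans (⊠-hom (norm x) (norm y) ρ) (cong₂ _*_ (norm-correct x ρ) (norm-correct y ρ))
  norm-correct (⊝ x)   ρ = trans (⊟-hom (norm x) ρ) (cong -_ (norm-correct x ρ))
  norm-correct (x ⊛ i) ρ = trans (⊡-hom (norm x) i ρ) (^-congˡ i (norm-correct x ρ))

  open import Relation.Binary.Reflection (setoid Carrier) Ι ⟦_⟧ (λ e → ⟦ norm e ⟧ₚ) norm-correct using (close)

  -- For a valid identity the hypothesis on the normalised difference computes to the unit type.
  -- Hence `tt` certifies it, and no normal forms over the reals are compared.
  prove : ∀ {n} (l r : Expr ℤ n) → Zero (norm (l ⊖ r)) → ∀ ρ → ⟦ l ⟧ ρ ≡ ⟦ r ⟧ ρ
  prove l r z ρ = x∙y⁻¹≈ε⇒x≈y _ _ (trans (sym (norm-correct (l ⊖ r) ρ)) (sym (zero-hom (norm (l ⊖ r)) z ρ)))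

  ring : ∀ n (f : N-ary n (Expr ℤ n) (Expr ℤ n × Expr ℤ n)) →
         (let l , r = close n f) → Zero (norm (l ⊖ r)) →
         ∀ⁿ n (curryⁿ λ ρ → ⟦ l ⟧ ρ ≡ ⟦ r ⟧ ρ)
  ring n f z = Equivalence.from (uncurry-∀ⁿ n) λ ρ →
    subst id (sym (left-inverse (λ ρ → ⟦ proj₁ (close n f) ⟧ ρ ≡ ⟦ proj₂ (close n f) ⟧ ρ) ρ))
      (prove (proj₁ (close n f)) (proj₂ (close n f)) z ρ)

  -- Ordered fields

  open IsStrictTotalOrder isStrictTotalOrder public using (compare) renaming (trans to <-trans)

  -- Reduces an equation that is a linear consequence x ≡ y of hypotheses to a ring identity.
  lin : ∀ {l r x y} → x ≡ y → l + y ≡ r + x → l ≡ r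
  lin refl eq = +-cancelʳ _ _ _ eq

  <-irrefl : ∀ {x} → ¬ (x < x)
  <-irrefl = IsStrictTotalOrder.irrefl isStrictTotalOrder refl

  <-asym : ∀ {x y} → x < y → ¬ (y < x)
  <-asym x<y y<x = <-irrefl (<-trans x<y y<x)

  <⇒≢ : ∀ {x y} → x < y → x ≢ y
  <⇒≢ x<y refl = <-irrefl x<y

  >⇒≢ : ∀ {x y} → y < x → x ≢ y
  >⇒≢ y<x refl = <-irrefl y<x

  <⇒pos : ∀ {x y} → x < y → 0# < y - x
  <⇒pos {x} x<y = subst (_< _) (R.-‿inverseʳ x) (+-mono-< (- x) x<y)

  pos⇒< : ∀ {x y} → 0# < y - x → x < y
  pos⇒< {x} {y} h = subst₂ _<_ (R.+-identityˡ x) (ring 2 (λ x y → y ⊖ x ⊕ x ⊜ y) tt x y) (+-mono-< x h)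

  <-cert : ∀ {x y e} → 0# < e → e ≡ y - x → x < y
  <-cert h eq = pos⇒< (subst (0# <_) eq h)

  pos-by : ∀ {x y} → 0# < x → x ≡ y → 0# < y
  pos-by h eq = subst (0# <_) eq h

  +-pos : ∀ {x y} → 0# < x → 0# < y → 0# < x + y
  +-pos {x} {y} 0<x 0<y = <-trans 0<y (subst (_< x + y) (R.+-identityˡ y) (+-mono-< y 0<x))

  neg-pos : ∀ {x} → x < 0# → 0# < - x
  neg-pos {x} h = pos-by (<⇒pos h) (ring 1 (λ x → :0 ⊖ x ⊜ ⊝ x) tt x)

  neg-neg : ∀ {x} → 0# < - x → x < 0#
  neg-neg {x} h = <-cert h (ring 1 (λ x → ⊝ x ⊜ :0 ⊖ x) tt x)

  0<1 : 0# < 1#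
  0<1 with compare 0# 1#
  ... | tri< h _ _ = h
  ... | tri≈ _ e _ = ⊥-elim (0≢1 e)
  ... | tri> _ _ h = pos-by (*-pos (neg-pos h) (neg-pos h)) (ring 0 (⊝ :1 ⊗ ⊝ :1 ⊜ :1) tt)

  pos≢0 : ∀ {x} → 0# < x → x ≢ 0#
  pos≢0 h refl = <-irrefl h

  *-cancel-pos : ∀ {x y} → 0# < x → 0# < x * y → 0# < y
  *-cancel-pos {x} {y} hx h with compare 0# y
  ... | tri< hy _ _ = hy
  ... | tri≈ _ refl _ = ⊥-elim (<-irrefl (subst (0# <_) (R.zeroʳ x) h))
  ... | tri> _ _ hy = ⊥-elim (<-irrefl (pos-by (+-pos h (*-pos hx (neg-pos hy)))
                        (ring 2 (λ x y → x ⊗ y ⊕ x ⊗ ⊝ y ⊜ :0) tt x y)))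

  *-mono-< : ∀ {a b c d} → 0# < a → a < b → 0# < c → c < d → a * c < b * d
  *-mono-< {a} {b} {c} {d} 0<a a<b 0<c c<d =
    <-cert (+-pos (*-pos (<⇒pos a<b) (<-trans 0<c c<d)) (*-pos 0<a (<⇒pos c<d)))
      (ring 4 (λ a b c d → (b ⊖ a) ⊗ d ⊕ a ⊗ (d ⊖ c) ⊜ b ⊗ d ⊖ a ⊗ c) tt a b c d)

  infix 8 _⁻¹
  -- Total, with value 0 at 0, so that quotients can be written down before their denominators are
  -- known to be nonzero.
  _⁻¹ : Carrier → Carrier
  x ⁻¹ with compare x 0#
  ... | tri< _ x≢0 _ = proj₁ (inverse x x≢0)
  ... | tri≈ _ _ _   = 0#
  ... | tri> _ x≢0 _ = proj₁ (inverse x x≢0)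

  ⁻¹-inverseʳ : ∀ {x} → x ≢ 0# → x * x ⁻¹ ≡ 1#
  ⁻¹-inverseʳ {x} x≢0 with compare x 0#
  ... | tri< _ h _ = proj₂ (inverse x h)
  ... | tri≈ _ e _ = ⊥-elim (x≢0 e)
  ... | tri> _ h _ = proj₂ (inverse x h)

  *-cancelˡ : ∀ {x y z} → x ≢ 0# → x * y ≡ x * z → y ≡ z
  *-cancelˡ {x} {y} {z} x≢0 eq =
    lin (cong₂ _+_ (cong (λ t → (z - y) * t) (⁻¹-inverseʳ x≢0)) (cong (x ⁻¹ *_) eq))
      (ring 4 (λ x y z i → y ⊕ ((z ⊖ y) ⊗ :1 ⊕ i ⊗ (x ⊗ z)) ⊜ z ⊕ ((z ⊖ y) ⊗ (x ⊗ i) ⊕ i ⊗ (x ⊗ y))) tt x y z (x ⁻¹))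

  *-≡0 : ∀ {x y} → x ≢ 0# → x * y ≡ 0# → y ≡ 0#
  *-≡0 {x} x≢0 eq = *-cancelˡ x≢0 (trans eq (sym (R.zeroʳ x)))

  *-≢0 : ∀ {x y} → x ≢ 0# → y ≢ 0# → x * y ≢ 0#
  *-≢0 x≢0 y≢0 eq = y≢0 (*-≡0 x≢0 eq)

  *-≢0ˡ : ∀ {x y} → x * y ≢ 0# → x ≢ 0#
  *-≢0ˡ {x} {y} h refl = h (R.zeroˡ y)

  *-≢0ʳ : ∀ {x y} → x * y ≢ 0# → y ≢ 0#
  *-≢0ʳ {x} {y} h refl = h (R.zeroʳ x)

  ⁻¹-pos : ∀ {x} → 0# < x → 0# < x ⁻¹
  ⁻¹-pos h = *-cancel-pos h (pos-by 0<1 (sym (⁻¹-inverseʳ (pos≢0 h))))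

  -≢0 : ∀ {x y} → x ≢ y → x - y ≢ 0#
  -≢0 {x} {y} x≢y eq = x≢y (lin eq (ring 2 (λ x y → x ⊕ :0 ⊜ y ⊕ (x ⊖ y)) tt x y))

  nonneg-+ : ∀ {x y} → 0# ≤ x → 0# ≤ y → 0# ≤ (x + y)
  nonneg-+ (inj₁ h) (inj₁ k) = inj₁ (+-pos h k)
  nonneg-+ {x} (inj₁ h) (inj₂ refl) = inj₁ (pos-by h (sym (R.+-identityʳ x)))
  nonneg-+ {y = y} (inj₂ refl) k = subst (0# ≤_) (sym (R.+-identityˡ y)) k

  nonneg-* : ∀ {x y} → 0# ≤ x → 0# ≤ y → 0# ≤ (x * y)
  nonneg-* (inj₁ h) (inj₁ k) = inj₁ (*-pos h k)
  nonneg-* {x} (inj₁ h) (inj₂ refl) = inj₂ (sym (R.zeroʳ x))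
  nonneg-* {y = y} (inj₂ refl) k = inj₂ (sym (R.zeroˡ y))

  nonneg-+≡0 : ∀ {x y} → 0# ≤ x → 0# ≤ y → x + y ≡ 0# → (x ≡ 0#) × (y ≡ 0#)
  nonneg-+≡0 (inj₂ refl) _ eq = refl , trans (sym (R.+-identityˡ _)) eq
  nonneg-+≡0 (inj₁ h) (inj₂ refl) eq = trans (sym (R.+-identityʳ _)) eq , refl
  nonneg-+≡0 (inj₁ h) (inj₁ k) eq = ⊥-elim (pos≢0 (+-pos h k) eq)

  nonneg-*≡0 : ∀ {x y} → 0# < y → x * y ≡ 0# → x ≡ 0#
  nonneg-*≡0 {x} {y} h eq = *-≡0 (pos≢0 h) (trans (R.*-comm y x) eq)

  <⇒≤-⊥ : ∀ {x} → 0# ≤ x → ¬ (x < 0#)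
  <⇒≤-⊥ (inj₁ h) k = <-asym h k
  <⇒≤-⊥ (inj₂ refl) k = <-irrefl k

  square-pos : ∀ {x} → x ≢ 0# → 0# < x * x
  square-pos {x} x≢0 with compare 0# x
  ... | tri< h _ _ = *-pos h h
  ... | tri≈ _ e _ = ⊥-elim (x≢0 (sym e))
  ... | tri> _ _ h = pos-by (*-pos (neg-pos h) (neg-pos h)) (ring 1 (λ x → ⊝ x ⊗ ⊝ x ⊜ x ⊗ x) tt x)

  quotient-* : ∀ {x y} → y ≢ 0# → x ≡ x * y ⁻¹ * y
  quotient-* {x} {y} y≢0 = lin (cong (x *_) (sym (⁻¹-inverseʳ y≢0)))
    (ring 3 (λ x y i → x ⊕ x ⊗ (y ⊗ i) ⊜ x ⊗ i ⊗ y ⊕ x ⊗ :1) tt x y (y ⁻¹))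

  -- Turns

  ringᵖ : ∀ m n f (let l , r = closeᵖ m n f) → Zero (norm (l ⊖ r)) → (ps : Vec Point m) (xs : Vec Carrier n) →
          ⟦ l ⟧ (fromPairs ps xs) ≡ ⟦ r ⟧ (fromPairs ps xs)
  ringᵖ m n f z ps xs = prove (proj₁ (closeᵖ m n f)) (proj₂ (closeᵖ m n f)) z (fromPairs ps xs)

  cross³ : Point → Point → Point → Carrier
  cross³ a b c = cross (b −ᵖ a) (c −ᵖ b)

  -- Both sides are twice the signed area of the quadrangle, split along one diagonal or the other.
  turn-sum : ∀ A B C D → cross³ A B C + cross³ C D A ≡ cross³ B C D + cross³ D A B
  turn-sum A B C D = ringᵖ 4 0 (λ A B C D → cross³ᴱ A B C ⊕ cross³ᴱ C D A ⊜ cross³ᴱ B C D ⊕ cross³ᴱ D A B) tt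
    (A ∷ B ∷ C ∷ D ∷ []) []

  module _ (A B C D : Point) (s s′ t t′ : Carrier) where
    private
      P  = lerp A B s
      P′ = lerp A B s′
      Q  = lerp D C t
      Q′ = lerp D C t′

    -- A turn is twice a signed triangle area. The base PP′ is s′ - s times AB, and the height of Q′
    -- over AB interpolates linearly between those of D and C. The other three turns are analogous.
    slab-turn₀ : cross³ P P′ Q′ ≡ (s′ - s) * (cross³ D A B + t′ * (cross³ A B C - cross³ D A B))
    slab-turn₀ = ringᵖ 4 3 (λ A B C D s s′ t′ → cross³ᴱ (lerpᴱ A B s) (lerpᴱ A B s′) (lerpᴱ D C t′) ⊜
      (s′ ⊖ s) ⊗ (cross³ᴱ D A B ⊕ t′ ⊗ (cross³ᴱ A B C ⊖ cross³ᴱ D A B))) tt (A ∷ B ∷ C ∷ D ∷ []) (s ∷ s′ ∷ t′ ∷ [])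

    slab-turn₁ : cross³ P′ Q′ Q ≡ (t′ - t) * (cross³ C D A + s′ * (cross³ B C D - cross³ C D A))
    slab-turn₁ = ringᵖ 4 3 (λ A B C D s′ t t′ → cross³ᴱ (lerpᴱ A B s′) (lerpᴱ D C t′) (lerpᴱ D C t) ⊜
      (t′ ⊖ t) ⊗ (cross³ᴱ C D A ⊕ s′ ⊗ (cross³ᴱ B C D ⊖ cross³ᴱ C D A))) tt (A ∷ B ∷ C ∷ D ∷ []) (s′ ∷ t ∷ t′ ∷ [])

    slab-turn₂ : cross³ Q′ Q P ≡ (t′ - t) * (cross³ C D A + s * (cross³ B C D - cross³ C D A))
    slab-turn₂ = ringᵖ 4 3 (λ A B C D s t t′ → cross³ᴱ (lerpᴱ D C t′) (lerpᴱ D C t) (lerpᴱ A B s) ⊜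
      (t′ ⊖ t) ⊗ (cross³ᴱ C D A ⊕ s ⊗ (cross³ᴱ B C D ⊖ cross³ᴱ C D A))) tt (A ∷ B ∷ C ∷ D ∷ []) (s ∷ t ∷ t′ ∷ [])

    slab-turn₃ : cross³ Q P P′ ≡ (s′ - s) * (cross³ D A B + t * (cross³ A B C - cross³ D A B))
    slab-turn₃ = ringᵖ 4 3 (λ A B C D s s′ t → cross³ᴱ (lerpᴱ D C t) (lerpᴱ A B s) (lerpᴱ A B s′) ⊜
      (s′ ⊖ s) ⊗ (cross³ᴱ D A B ⊕ t ⊗ (cross³ᴱ A B C ⊖ cross³ᴱ D A B))) tt (A ∷ B ∷ C ∷ D ∷ []) (s ∷ s′ ∷ t ∷ [])

  -- Hulls and affine maps

  open Equivalence

  relabelled : Quad → Fin 4 → Bool → Quad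
  relabelled Q k b i = Q (relabel k b (toℕ i))

  sum₄ : (Fin 4 → Carrier) → Carrier
  sum₄ g = g 0F + g 1F + g 2F + g 3F

  comb : (Fin 4 → Carrier) → Quad → Point
  comb l Q = sum₄ (λ i → l i * proj₁ (Q i)) , sum₄ (λ i → l i * proj₂ (Q i))

  sum₄-cong : ∀ {g h} → (∀ i → g i ≡ h i) → sum₄ g ≡ sum₄ h
  sum₄-cong e = cong₂ _+_ (cong₂ _+_ (cong₂ _+_ (e 0F) (e 1F)) (e 2F)) (e 3F)

  comb-cong : ∀ l {P Q} → (∀ i → P i ≡ Q i) → comb l P ≡ comb l Q
  comb-cong l e = cong₂ _,_ (sum₄-cong (λ i → cong (λ p → l i * proj₁ p) (e i)))
                            (sum₄-cong (λ i → cong (λ p → l i * proj₂ p) (e i)))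

  sum₄-relabel : ∀ k b g → sum₄ (λ i → g (relabel k b (toℕ i))) ≡ sum₄ g
  sum₄-relabel 0F true  g = refl
  sum₄-relabel 1F true  g = ring 4 (λ a b c d → b ⊕ c ⊕ d ⊕ a ⊜ a ⊕ b ⊕ c ⊕ d) tt (g 0F) (g 1F) (g 2F) (g 3F)
  sum₄-relabel 2F true  g = ring 4 (λ a b c d → c ⊕ d ⊕ a ⊕ b ⊜ a ⊕ b ⊕ c ⊕ d) tt (g 0F) (g 1F) (g 2F) (g 3F)
  sum₄-relabel 3F true  g = ring 4 (λ a b c d → d ⊕ a ⊕ b ⊕ c ⊜ a ⊕ b ⊕ c ⊕ d) tt (g 0F) (g 1F) (g 2F) (g 3F)
  sum₄-relabel 0F false g = ring 4 (λ a b c d → a ⊕ d ⊕ c ⊕ b ⊜ a ⊕ b ⊕ c ⊕ d) tt (g 0F) (g 1F) (g 2F) (g 3F)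
  sum₄-relabel 1F false g = ring 4 (λ a b c d → b ⊕ a ⊕ d ⊕ c ⊜ a ⊕ b ⊕ c ⊕ d) tt (g 0F) (g 1F) (g 2F) (g 3F)
  sum₄-relabel 2F false g = ring 4 (λ a b c d → c ⊕ b ⊕ a ⊕ d ⊜ a ⊕ b ⊕ c ⊕ d) tt (g 0F) (g 1F) (g 2F) (g 3F)
  sum₄-relabel 3F false g = ring 4 (λ a b c d → d ⊕ c ⊕ b ⊕ a ⊜ a ⊕ b ⊕ c ⊕ d) tt (g 0F) (g 1F) (g 2F) (g 3F)

  InQuad-rl : ∀ Q k b {p} → InQuad Q p → InQuad (relabelled Q k b) p
  InQuad-rl Q k b (l , l≥0 , Σl , eq) =
    (λ i → l (relabel k b (toℕ i))) , (λ i → l≥0 (relabel k b (toℕ i))) , trans (sum₄-relabel k b l) Σl ,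
    trans (cong₂ _,_ (sum₄-relabel k b (λ i → l i * proj₁ (Q i))) (sum₄-relabel k b (λ i → l i * proj₂ (Q i)))) eq

  -- A rotation by k is undone by the rotation by 4 - k, and each reflection by itself; for a
  -- concrete label the resulting hull is definitionally the original one.
  InQuad-rl⁻¹ : ∀ Q k b {p} → InQuad (relabelled Q k b) p → InQuad Q p
  InQuad-rl⁻¹ Q 0F true  = id
  InQuad-rl⁻¹ Q 1F true  = InQuad-rl (relabelled Q 1F true) 3F true
  InQuad-rl⁻¹ Q 2F true  = InQuad-rl (relabelled Q 2F true) 2F true
  InQuad-rl⁻¹ Q 3F true  = InQuad-rl (relabelled Q 3F true) 1F true
  InQuad-rl⁻¹ Q 0F false = InQuad-rl (relabelled Q 0F false) 0F false
  InQuad-rl⁻¹ Q 1F false = InQuad-rl (relabelled Q 1F false) 1F false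
  InQuad-rl⁻¹ Q 2F false = InQuad-rl (relabelled Q 2F false) 2F false
  InQuad-rl⁻¹ Q 3F false = InQuad-rl (relabelled Q 3F false) 3F false

  image-rlˡ : ∀ f Q P k b → ImageUnder f Q P → ImageUnder f (relabelled Q k b) P
  image-rlˡ f Q P k b im p = mk⇔
    (λ h → let q , hq , eq = to (im p) h in q , InQuad-rl Q k b hq , eq)
    (λ (q , hq , eq) → from (im p) (q , InQuad-rl⁻¹ Q k b hq , eq))

  image-rlʳ : ∀ f Q P k b → ImageUnder f Q P → ImageUnder f Q (relabelled P k b)
  image-rlʳ f Q P k b im p = mk⇔
    (λ h → to (im p) (InQuad-rl⁻¹ P k b h))
    (λ h → InQuad-rl P k b (from (im p) h))

  image-rlˡ⁻¹ : ∀ f Q P k b → ImageUnder f (relabelled Q k b) P → ImageUnder f Q P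
  image-rlˡ⁻¹ f Q P k b im p = mk⇔
    (λ h → let q , hq , eq = to (im p) h in q , InQuad-rl⁻¹ Q k b hq , eq)
    (λ (q , hq , eq) → from (im p) (q , InQuad-rl Q k b hq , eq))

  InQuad-vertex : ∀ Q j → InQuad Q (Q j)
  InQuad-vertex Q j = δ j , δ≥0 j , Σδ j , cong₂ _,_ (δ-sum j (proj₁ ∘ Q)) (δ-sum j (proj₂ ∘ Q))
    where
    δ : Fin 4 → Fin 4 → Carrier
    δ 0F 0F = 1#
    δ 1F 1F = 1#
    δ 2F 2F = 1#
    δ 3F 3F = 1#
    δ _  _  = 0#

    δ≥0 : ∀ j i → 0# ≤ δ j i
    δ≥0 0F 0F = inj₁ 0<1
    δ≥0 0F 1F = inj₂ refl
    δ≥0 0F 2F = inj₂ refl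
    δ≥0 0F 3F = inj₂ refl
    δ≥0 1F 0F = inj₂ refl
    δ≥0 1F 1F = inj₁ 0<1
    δ≥0 1F 2F = inj₂ refl
    δ≥0 1F 3F = inj₂ refl
    δ≥0 2F 0F = inj₂ refl
    δ≥0 2F 1F = inj₂ refl
    δ≥0 2F 2F = inj₁ 0<1
    δ≥0 2F 3F = inj₂ refl
    δ≥0 3F 0F = inj₂ refl
    δ≥0 3F 1F = inj₂ refl
    δ≥0 3F 2F = inj₂ refl
    δ≥0 3F 3F = inj₁ 0<1

    Σδ : ∀ j → sum₄ (δ j) ≡ 1#
    Σδ 0F = ring 0 (:1 ⊕ :0 ⊕ :0 ⊕ :0 ⊜ :1) tt
    Σδ 1F = ring 0 (:0 ⊕ :1 ⊕ :0 ⊕ :0 ⊜ :1) tt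
    Σδ 2F = ring 0 (:0 ⊕ :0 ⊕ :1 ⊕ :0 ⊜ :1) tt
    Σδ 3F = ring 0 (:0 ⊕ :0 ⊕ :0 ⊕ :1 ⊜ :1) tt

    δ-sum : ∀ j g → sum₄ (λ i → δ j i * g i) ≡ g j
    δ-sum 0F g = ring 4 (λ a b c d → :1 ⊗ a ⊕ :0 ⊗ b ⊕ :0 ⊗ c ⊕ :0 ⊗ d ⊜ a) tt (g 0F) (g 1F) (g 2F) (g 3F)
    δ-sum 1F g = ring 4 (λ a b c d → :0 ⊗ a ⊕ :1 ⊗ b ⊕ :0 ⊗ c ⊕ :0 ⊗ d ⊜ b) tt (g 0F) (g 1F) (g 2F) (g 3F)
    δ-sum 2F g = ring 4 (λ a b c d → :0 ⊗ a ⊕ :0 ⊗ b ⊕ :1 ⊗ c ⊕ :0 ⊗ d ⊜ c) tt (g 0F) (g 1F) (g 2F) (g 3F)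
    δ-sum 3F g = ring 4 (λ a b c d → :0 ⊗ a ⊕ :0 ⊗ b ⊕ :0 ⊗ c ⊕ :1 ⊗ d ⊜ d) tt (g 0F) (g 1F) (g 2F) (g 3F)

  det : AffineMap → Carrier
  det f = m₁₁ * m₂₂ - m₁₂ * m₂₁ where open AffineMap f

  cross³-apply : ∀ f a b c → cross³ (apply f a) (apply f b) (apply f c) ≡ det f * cross³ a b c
  cross³-apply f a b c = ringᵖ 3 6
    (λ a b c m₁₁ m₁₂ m₂₁ m₂₂ t₁ t₂ →
      let ap = λ p → (m₁₁ ⊗ proj₁ p ⊕ m₁₂ ⊗ proj₂ p ⊕ t₁) , (m₂₁ ⊗ proj₁ p ⊕ m₂₂ ⊗ proj₂ p ⊕ t₂) in
      cross³ᴱ (ap a) (ap b) (ap c) ⊜ (m₁₁ ⊗ m₂₂ ⊖ m₁₂ ⊗ m₂₁) ⊗ cross³ᴱ a b c) tt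
    (a ∷ b ∷ c ∷ []) (m₁₁ ∷ m₁₂ ∷ m₂₁ ∷ m₂₂ ∷ t₁ ∷ t₂ ∷ [])
    where open AffineMap f

  private
    apply-comb-coord : ∀ m m′ t (l : Fin 4 → Carrier) (P : Quad) → sum₄ l ≡ 1# →
      m * sum₄ (λ i → l i * proj₁ (P i)) + m′ * sum₄ (λ i → l i * proj₂ (P i)) + t ≡
      sum₄ (λ i → l i * (m * proj₁ (P i) + m′ * proj₂ (P i) + t))
    apply-comb-coord m m′ t l P Σl = lin (cong (t *_) (sym Σl)) (ringᵖ 4 7
      (λ A B C D l₀ l₁ l₂ l₃ m m′ t →
        let f = λ p → m ⊗ proj₁ p ⊕ m′ ⊗ proj₂ p ⊕ t in
        (m ⊗ (l₀ ⊗ proj₁ A ⊕ l₁ ⊗ proj₁ B ⊕ l₂ ⊗ proj₁ C ⊕ l₃ ⊗ proj₁ D)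
          ⊕ m′ ⊗ (l₀ ⊗ proj₂ A ⊕ l₁ ⊗ proj₂ B ⊕ l₂ ⊗ proj₂ C ⊕ l₃ ⊗ proj₂ D) ⊕ t) ⊕ t ⊗ (l₀ ⊕ l₁ ⊕ l₂ ⊕ l₃)
        ⊜ (l₀ ⊗ f A ⊕ l₁ ⊗ f B ⊕ l₂ ⊗ f C ⊕ l₃ ⊗ f D) ⊕ t ⊗ :1) tt
      (P 0F ∷ P 1F ∷ P 2F ∷ P 3F ∷ []) (l 0F ∷ l 1F ∷ l 2F ∷ l 3F ∷ m ∷ m′ ∷ t ∷ []))

  apply-comb : ∀ f l Q → sum₄ l ≡ 1# → apply f (comb l Q) ≡ comb l (apply f ∘ Q)
  apply-comb f l Q Σl = cong₂ _,_ (apply-comb-coord m₁₁ m₁₂ t₁ l Q Σl) (apply-comb-coord m₂₁ m₂₂ t₂ l Q Σl)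
    where open AffineMap f

  vertices⇒image : ∀ f Q P → (∀ i → apply f (Q i) ≡ P i) → ImageUnder f Q P
  vertices⇒image f Q P e p = mk⇔
    (λ (l , l≥0 , Σl , eq) → comb l Q , (l , l≥0 , Σl , refl) ,
      trans (apply-comb f l Q Σl) (trans (comb-cong l e) eq))
    (λ (q , (l , l≥0 , Σl , eq) , fq) → l , l≥0 , Σl ,
      trans (sym (comb-cong l e)) (trans (sym (apply-comb f l Q Σl)) (trans (cong (apply f) eq) fq)))

  private
    -- As an affine function of p, the turn has the form of a coordinate of an affine map, so the
    -- computation in `apply-comb-coord` also shows that it respects convex combinations.
    cross³-affine : ∀ a b p → cross³ a b p ≡
      (proj₂ a - proj₂ b) * proj₁ p + (proj₁ b - proj₁ a) * proj₂ p + cross (b −ᵖ a) (pt 0# 0# −ᵖ b)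
    cross³-affine a b p = ringᵖ 3 0 (λ a b p → cross³ᴱ a b p ⊜
      (proj₂ a ⊖ proj₂ b) ⊗ proj₁ p ⊕ (proj₁ b ⊖ proj₁ a) ⊗ proj₂ p
        ⊕ crossᴱ (proj₁ b ⊖ proj₁ a , proj₂ b ⊖ proj₂ a) (:0 ⊖ proj₁ b , :0 ⊖ proj₂ b)) tt (a ∷ b ∷ p ∷ []) []

  cross³-comb : ∀ a b l (P : Quad) → sum₄ l ≡ 1# → cross³ a b (comb l P) ≡ sum₄ (λ i → l i * cross³ a b (P i))
  cross³-comb a b l P Σl = trans (cross³-affine a b (comb l P)) (trans
    (apply-comb-coord (proj₂ a - proj₂ b) (proj₁ b - proj₁ a) (cross (b −ᵖ a) (pt 0# 0# −ᵖ b)) l P Σl)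
    (sum₄-cong (λ i → cong (l i *_) (sym (cross³-affine a b (P i))))))

  -- Vertices of affine images

  -- The factor `sign` absorbs the orientation, so that both cases of `ConvexQuad`, and reversed
  -- labellings, are treated at once.
  record Oriented (Q : Quad) : Set where
    constructor _by_
    field
      sign     : Carrier
      turn-pos : ∀ i → 0# < sign * turn Q i
  open Oriented

  oriented : ∀ {Q} σ → 0# < σ * turn Q 0 → 0# < σ * turn Q 1 → 0# < σ * turn Q 2 → 0# < σ * turn Q 3 → Oriented Q
  oriented {Q} σ h₀ h₁ h₂ h₃ = σ by go
    where
    go : ∀ i → 0# < σ * turn Q i
    go 0 = h₀
    go 1 = h₁
    go 2 = h₂
    go 3 = h₃
    go (suc (suc (suc (suc i)))) = go i

  convex⇒oriented : ∀ {Q} → ConvexQuad Q → Oriented Q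
  convex⇒oriented (inj₁ h) = 1# by λ i → pos-by (h i) (sym (R.*-identityˡ _))
  convex⇒oriented {Q} (inj₂ h) = (- 1#) by λ i → pos-by (neg-pos (h i)) (ring 1 (λ t → ⊝ t ⊜ ⊝ :1 ⊗ t) tt (turn Q i))

  cross³-reverse : ∀ a b c → cross³ c b a ≡ - cross³ a b c
  cross³-reverse a b c = ringᵖ 3 0 (λ a b c → cross³ᴱ c b a ⊜ ⊝ cross³ᴱ a b c) tt (a ∷ b ∷ c ∷ []) []

  oriented-rl : ∀ {Q} k b → Oriented Q → Oriented (relabelled Q k b)
  oriented-rl 0F true  (σ by h) = oriented σ (h 0) (h 1) (h 2) (h 3)
  oriented-rl 1F true  (σ by h) = oriented σ (h 1) (h 2) (h 3) (h 0)
  oriented-rl 2F true  (σ by h) = oriented σ (h 2) (h 3) (h 0) (h 1)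
  oriented-rl 3F true  (σ by h) = oriented σ (h 3) (h 0) (h 1) (h 2)
  oriented-rl {Q} k false (σ by h) = go k
    where
    flip : ∀ i → 0# < - σ * cross³ (V Q (suc (suc i))) (V Q (suc i)) (V Q i)
    flip i = pos-by (h i) (trans (ring 2 (λ s t → s ⊗ t ⊜ ⊝ s ⊗ ⊝ t) tt σ (turn Q i))
      (cong (- σ *_) (sym (cross³-reverse (V Q i) (V Q (suc i)) (V Q (suc (suc i)))))))

    go : ∀ k → Oriented (relabelled Q k false)
    go 0F = oriented (- σ) (flip 2) (flip 1) (flip 0) (flip 3)
    go 1F = oriented (- σ) (flip 3) (flip 2) (flip 1) (flip 0)
    go 2F = oriented (- σ) (flip 0) (flip 3) (flip 2) (flip 1)
    go 3F = oriented (- σ) (flip 1) (flip 0) (flip 3) (flip 2)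

  turn≢0 : ∀ {Q} → Oriented Q → ∀ i → turn Q i ≢ 0#
  turn≢0 (σ by h) i = *-≢0ʳ (pos≢0 (h i))

  sum₄≡0 : ∀ g → (∀ i → 0# ≤ g i) → sum₄ g ≡ 0# → ∀ i → g i ≡ 0#
  sum₄≡0 g g≥0 Σ≡0 = go
    where
    e₃ = nonneg-+≡0 (nonneg-+ (nonneg-+ (g≥0 0F) (g≥0 1F)) (g≥0 2F)) (g≥0 3F) Σ≡0
    e₂ = nonneg-+≡0 (nonneg-+ (g≥0 0F) (g≥0 1F)) (g≥0 2F) (proj₁ e₃)
    e₁ = nonneg-+≡0 (g≥0 0F) (g≥0 1F) (proj₁ e₂)
    go : ∀ i → g i ≡ 0#
    go 0F = proj₁ e₁
    go 1F = proj₂ e₁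
    go 2F = proj₂ e₂
    go 3F = proj₂ e₃

  sum₄-nonneg : ∀ g → (∀ i → 0# ≤ g i) → 0# ≤ sum₄ g
  sum₄-nonneg g g≥0 = nonneg-+ (nonneg-+ (nonneg-+ (g≥0 0F) (g≥0 1F)) (g≥0 2F)) (g≥0 3F)

  some-positive : ∀ l → (∀ i → 0# ≤ l i) → sum₄ l ≡ 1# → ∃[ j ] (0# < l j)
  some-positive l l≥0 Σl with l≥0 0F | l≥0 1F | l≥0 2F | l≥0 3F
  ... | inj₁ h | _ | _ | _ = 0F , h
  ... | inj₂ _ | inj₁ h | _ | _ = 1F , h
  ... | inj₂ _ | inj₂ _ | inj₁ h | _ = 2F , h
  ... | inj₂ _ | inj₂ _ | inj₂ _ | inj₁ h = 3F , h
  ... | inj₂ e₀ | inj₂ e₁ | inj₂ e₂ | inj₂ e₃ = ⊥-elim (0≢1 (trans (trans (ring 0 (:0 ⊜ :0 ⊕ :0 ⊕ :0 ⊕ :0) tt)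
        (cong₂ _+_ (cong₂ _+_ (cong₂ _+_ e₀ e₁) e₂) e₃)) Σl))

  -- The functional ψ is nonnegative on the hull of P and vanishes there only at the vertex P 0F,
  -- so an image hull can only reach P 0F at the image of a vertex.
  module _ (f : AffineMap) (P Q : Quad) (oP : Oriented P) (im : ImageUnder f Q P) where
    private
      σ = sign oP
      -- Up to positive weights, the sum of the distances from the two sides that meet in `P 0F`.
      ψ : Point → Carrier
      ψ p = σ * (cross³ (P 0F) (P 1F) p + cross³ (P 3F) (P 0F) p)

      ψ-comb : ∀ l X → sum₄ l ≡ 1# → ψ (comb l X) ≡ sum₄ (λ i → l i * ψ (X i))
      ψ-comb l X Σl = trans (cong₂ (λ u v → σ * (u + v)) (cross³-comb (P 0F) (P 1F) l X Σl) (cross³-comb (P 3F) (P 0F) l X Σl))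
        (ring 13 (λ s a b c d x y z w x′ y′ z′ w′ →
            s ⊗ ((a ⊗ x ⊕ b ⊗ y ⊕ c ⊗ z ⊕ d ⊗ w) ⊕ (a ⊗ x′ ⊕ b ⊗ y′ ⊕ c ⊗ z′ ⊕ d ⊗ w′))
            ⊜ a ⊗ (s ⊗ (x ⊕ x′)) ⊕ b ⊗ (s ⊗ (y ⊕ y′)) ⊕ c ⊗ (s ⊗ (z ⊕ z′)) ⊕ d ⊗ (s ⊗ (w ⊕ w′))) tt
          σ (l 0F) (l 1F) (l 2F) (l 3F)
          (cross³ (P 0F) (P 1F) (X 0F)) (cross³ (P 0F) (P 1F) (X 1F)) (cross³ (P 0F) (P 1F) (X 2F)) (cross³ (P 0F) (P 1F) (X 3F))
          (cross³ (P 3F) (P 0F) (X 0F)) (cross³ (P 3F) (P 0F) (X 1F)) (cross³ (P 3F) (P 0F) (X 2F)) (cross³ (P 3F) (P 0F) (X 3F)))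

      ψ₀ : ψ (P 0F) ≡ 0#
      ψ₀ = ringᵖ 3 1 (λ A B D s → s ⊗ (cross³ᴱ A B A ⊕ cross³ᴱ D A A) ⊜ :0) tt (P 0F ∷ P 1F ∷ P 3F ∷ []) (σ ∷ [])

      ψ₁ : 0# < ψ (P 1F)
      ψ₁ = pos-by (turn-pos oP 3) (ringᵖ 3 1 (λ A B D s → s ⊗ cross³ᴱ D A B ⊜ s ⊗ (cross³ᴱ A B B ⊕ cross³ᴱ D A B)) tt
        (P 0F ∷ P 1F ∷ P 3F ∷ []) (σ ∷ []))

      ψ₂ : 0# < ψ (P 2F)
      ψ₂ = pos-by (+-pos (turn-pos oP 0) (turn-pos oP 2)) (ringᵖ 4 1 (λ A B C D s →
        s ⊗ cross³ᴱ A B C ⊕ s ⊗ cross³ᴱ C D A ⊜ s ⊗ (cross³ᴱ A B C ⊕ cross³ᴱ D A C)) tt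
        (P 0F ∷ P 1F ∷ P 2F ∷ P 3F ∷ []) (σ ∷ []))

      ψ₃ : 0# < ψ (P 3F)
      ψ₃ = pos-by (turn-pos oP 3) (ringᵖ 3 1 (λ A B D s → s ⊗ cross³ᴱ D A B ⊜ s ⊗ (cross³ᴱ A B D ⊕ cross³ᴱ D A D)) tt
        (P 0F ∷ P 1F ∷ P 3F ∷ []) (σ ∷ []))

      ψ≥0 : ∀ i → 0# ≤ ψ (P i)
      ψ≥0 0F = inj₂ (sym ψ₀)
      ψ≥0 1F = inj₁ ψ₁
      ψ≥0 2F = inj₁ ψ₂
      ψ≥0 3F = inj₁ ψ₃

      image-in : ∀ j → InQuad P (apply f (Q j))
      image-in j = from (im _) (Q j , InQuad-vertex Q j , refl)

      ψ-image≥0 : ∀ j → 0# ≤ ψ (apply f (Q j))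
      ψ-image≥0 j = let m , m≥0 , Σm , eq = image-in j in
        subst (0# ≤_) (trans (sym (ψ-comb m P Σm)) (cong ψ eq))
          (sum₄-nonneg (λ i → m i * ψ (P i)) (λ i → nonneg-* (m≥0 i) (ψ≥0 i)))

      ψ≡0⇒vertex : ∀ {p} → InQuad P p → ψ p ≡ 0# → p ≡ P 0F
      ψ≡0⇒vertex {p} (m , m≥0 , Σm , eq) ψp≡0 = trans (sym eq) (cong₂ _,_ (coord (proj₁ ∘ P)) (coord (proj₂ ∘ P)))
        where
        z : ∀ i → m i * ψ (P i) ≡ 0#
        z = sum₄≡0 (λ i → m i * ψ (P i)) (λ i → nonneg-* (m≥0 i) (ψ≥0 i))
              (trans (sym (ψ-comb m P Σm)) (trans (cong ψ eq) ψp≡0))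
        coord : ∀ g → sum₄ (λ i → m i * g i) ≡ g 0F
        coord g = lin (cong₂ _+_ (cong₂ _+_ (cong₂ _+_ (cong (g 0F *_) Σm)
            (cong ((g 1F - g 0F) *_) (nonneg-*≡0 ψ₁ (z 1F)))) (cong ((g 2F - g 0F) *_) (nonneg-*≡0 ψ₂ (z 2F))))
            (cong ((g 3F - g 0F) *_) (nonneg-*≡0 ψ₃ (z 3F))))
          (ring 8 (λ a b c d x y z w → (a ⊗ x ⊕ b ⊗ y ⊕ c ⊗ z ⊕ d ⊗ w) ⊕ (x ⊗ :1 ⊕ (y ⊖ x) ⊗ :0 ⊕ (z ⊖ x) ⊗ :0 ⊕ (w ⊖ x) ⊗ :0)
              ⊜ x ⊕ (x ⊗ (a ⊕ b ⊕ c ⊕ d) ⊕ (y ⊖ x) ⊗ b ⊕ (z ⊖ x) ⊗ c ⊕ (w ⊖ x) ⊗ d)) tt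
            (m 0F) (m 1F) (m 2F) (m 3F) (g 0F) (g 1F) (g 2F) (g 3F))

    vertex₀-preimage : ∃[ j ] (apply f (Q j) ≡ P 0F)
    vertex₀-preimage =
      let q , (l , l≥0 , Σl , lq) , fq = to (im (P 0F)) (InQuad-vertex P 0F)
          j , lj>0 = some-positive l l≥0 Σl
          Σ≡0 = trans (sym (ψ-comb l (apply f ∘ Q) Σl))
                  (trans (cong ψ (trans (sym (apply-comb f l Q Σl)) (trans (cong (apply f) lq) fq))) ψ₀)
          z = sum₄≡0 (λ i → l i * ψ (apply f (Q i))) (λ i → nonneg-* (l≥0 i) (ψ-image≥0 i)) Σ≡0 j
      in j , ψ≡0⇒vertex (image-in j) (*-≡0 (pos≢0 lj>0) z)

    private
      side : ∀ j → 0# ≤ (σ * cross³ (P 0F) (P 1F) (apply f (Q j)))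
      side j = let m , m≥0 , Σm , eq = image-in j in
        subst (0# ≤_) (trans (ring 9 (λ s a b c d x y z w → a ⊗ (s ⊗ x) ⊕ b ⊗ (s ⊗ y) ⊕ c ⊗ (s ⊗ z) ⊕ d ⊗ (s ⊗ w)
              ⊜ s ⊗ (a ⊗ x ⊕ b ⊗ y ⊕ c ⊗ z ⊕ d ⊗ w)) tt
              σ (m 0F) (m 1F) (m 2F) (m 3F) (φ 0F) (φ 1F) (φ 2F) (φ 3F))
            (cong (σ *_) (trans (sym (cross³-comb (P 0F) (P 1F) m P Σm)) (cong (cross³ (P 0F) (P 1F)) eq))))
          (sum₄-nonneg (λ i → m i * (σ * φ i)) (λ i → nonneg-* (m≥0 i) (φ≥0 i)))
        where
        φ : Fin 4 → Carrier
        φ i = cross³ (P 0F) (P 1F) (P i)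
        φ≥0 : ∀ i → 0# ≤ (σ * φ i)
        φ≥0 0F = inj₂ (ringᵖ 2 1 (λ A B s → :0 ⊜ s ⊗ cross³ᴱ A B A) tt (P 0F ∷ P 1F ∷ []) (σ ∷ []))
        φ≥0 1F = inj₂ (ringᵖ 2 1 (λ A B s → :0 ⊜ s ⊗ cross³ᴱ A B B) tt (P 0F ∷ P 1F ∷ []) (σ ∷ []))
        φ≥0 2F = inj₁ (turn-pos oP 0)
        φ≥0 3F = inj₁ (pos-by (turn-pos oP 3) (ringᵖ 3 1 (λ A B D s → s ⊗ cross³ᴱ D A B ⊜ s ⊗ cross³ᴱ A B D) tt
          (P 0F ∷ P 1F ∷ P 3F ∷ []) (σ ∷ [])))

    -- Opposite vertices of Q lie on a diagonal, which separates the other two; an edge of P separates nothing.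
    ¬diagonal→edge : Oriented Q → apply f (Q 0F) ≡ P 0F → apply f (Q 2F) ≡ P 1F → ⊥
    ¬diagonal→edge (ρ by hQ) e₀ e₂ = <⇒≤-⊥
        -- The values at the other two vertices multiply to -(σ · det f)² · turn Q 0 · turn Q 2. The
        -- factor ρ² turns this into a negative number whatever the orientation of `Q`.
        (nonneg-* (nonneg-* (side 1F) (side 3F)) (inj₁ (square-pos ρ≢0)))
        (neg-neg (pos-by (*-pos (square-pos (*-≢0 σ≢0 (AffineMap.nondeg f))) (*-pos (hQ 0) (hQ 2)))
          (trans (ring 5 (λ s d r t t′ → s ⊗ d ⊗ (s ⊗ d) ⊗ (r ⊗ t ⊗ (r ⊗ t′)) ⊜ ⊝ (s ⊗ (d ⊗ ⊝ t) ⊗ (s ⊗ (d ⊗ t′)) ⊗ (r ⊗ r))) tt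
              σ (det f) ρ (turn Q 0) (turn Q 2))
            (cong -_ (cong₂ (λ u v → σ * u * (σ * v) * (ρ * ρ)) (sym image₁) (sym image₃))))))
      where
      σ≢0 : σ ≢ 0#
      σ≢0 = *-≢0ˡ (pos≢0 (turn-pos oP 0))
      ρ≢0 : ρ ≢ 0#
      ρ≢0 = *-≢0ˡ (pos≢0 (hQ 0))
      image : ∀ j → cross³ (P 0F) (P 1F) (apply f (Q j)) ≡ det f * cross³ (Q 0F) (Q 2F) (Q j)
      image j = trans (cong₂ (λ u v → cross³ u v (apply f (Q j))) (sym e₀) (sym e₂)) (cross³-apply f (Q 0F) (Q 2F) (Q j))
      image₁ : cross³ (P 0F) (P 1F) (apply f (Q 1F)) ≡ det f * (- turn Q 0)
      image₁ = trans (image 1F) (cong (det f *_) (ringᵖ 3 0 (λ A B C → cross³ᴱ A C B ⊜ ⊝ cross³ᴱ A B C) tt (Q 0F ∷ Q 1F ∷ Q 2F ∷ []) []))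
      image₃ : cross³ (P 0F) (P 1F) (apply f (Q 3F)) ≡ det f * turn Q 2
      image₃ = trans (image 3F) (cong (det f *_) (ringᵖ 3 0 (λ A C D → cross³ᴱ A C D ⊜ cross³ᴱ C D A) tt (Q 0F ∷ Q 2F ∷ Q 3F ∷ []) []))

  relabel-zero : ∀ k → relabel k true 0 ≡ k
  relabel-zero = from-yes (all? λ k → relabel k true 0 ≟ k)

  _∘ᵇ_ : Bool → Bool → Bool
  true  ∘ᵇ b = b
  false ∘ᵇ b = not b

  -- The labellings form the dihedral group of order eight; its multiplication table is checked by
  -- enumeration, for each pair of directions separately.
  relabel-∘ : ∀ k b k′ b′ (i : Fin 4) → relabel k b (toℕ (relabel k′ b′ (toℕ i))) ≡ relabel (relabel k b (toℕ k′)) (b ∘ᵇ b′) (toℕ i)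
  relabel-∘ k b k′ b′ = check b b′ k k′
    where
    composes? : ∀ b b′ → Dec (∀ k k′ (i : Fin 4) →
      relabel k b (toℕ (relabel k′ b′ (toℕ i))) ≡ relabel (relabel k b (toℕ k′)) (b ∘ᵇ b′) (toℕ i))
    composes? b b′ = all? λ k → all? λ k′ → all? λ i →
      relabel k b (toℕ (relabel k′ b′ (toℕ i))) ≟ relabel (relabel k b (toℕ k′)) (b ∘ᵇ b′) (toℕ i)
    check : ∀ b b′ k k′ (i : Fin 4) → relabel k b (toℕ (relabel k′ b′ (toℕ i))) ≡ relabel (relabel k b (toℕ k′)) (b ∘ᵇ b′) (toℕ i)
    check true  true  = from-yes (composes? true true)
    check true  false = from-yes (composes? true false)
    check false true  = from-yes (composes? false true)
    check false false = from-yes (composes? false false)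

  rl-∘ : ∀ Q k b k′ b′ i → relabelled (relabelled Q k b) k′ b′ i ≡ relabelled Q (relabel k b (toℕ k′)) (b ∘ᵇ b′) i
  rl-∘ Q k b k′ b′ i = cong Q (relabel-∘ k b k′ b′ i)

  relabel-inverse : ∀ k b → Σ (Fin 4) λ k′ → ∀ i → relabel k b (toℕ (relabel k′ b (toℕ i))) ≡ i
  -- The label is 3k, which is -k modulo 4.
  relabel-inverse k true  = relabel 0F false (toℕ k) ,
    from-yes (all? λ k → all? λ i → relabel k true (toℕ (relabel (relabel 0F false (toℕ k)) true (toℕ i))) ≟ i) k
  relabel-inverse k false = k , from-yes (all? λ k → all? λ i → relabel k false (toℕ (relabel k false (toℕ i))) ≟ i) k

  cross³-aab : ∀ {a b} c → a ≡ b → cross³ a b c ≡ 0#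
  cross³-aab {a} c refl = ringᵖ 2 0 (λ a c → cross³ᴱ a a c ⊜ :0) tt (a ∷ c ∷ []) []

  cross³-aba : ∀ {a b} c → a ≡ b → cross³ a c b ≡ 0#
  cross³-aba {a} c refl = ringᵖ 2 0 (λ a c → cross³ᴱ a c a ⊜ :0) tt (a ∷ c ∷ []) []

  -- Each vertex of `P` is the image of a vertex of `Q`. Once the preimage of `P 0F` is rotated to
  -- index 0, the cyclic order is forced up to direction, because a diagonal of `Q` cannot be mapped
  -- to an edge of `P`.
  image⇒vertices : ∀ f P Q → Oriented P → Oriented Q → ImageUnder f Q P →
    Σ (Fin 4) λ k → Σ Bool λ b → ∀ i → apply f (relabelled Q k b i) ≡ P i
  image⇒vertices f P Q oP oQ im = k , proj₁ m , λ i → trans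
      (cong (apply f) (sym (trans (rl-∘ Q k true 0F (proj₁ m) i) (cong (λ j → relabelled Q j (proj₁ m) i) (relabel-zero k)))))
      (proj₂ m i)
    where
    k = proj₁ (vertex₀-preimage f P Q oP im)
    Q′ = relabelled Q k true
    oQ′ = oriented-rl k true oQ
    im′ : ImageUnder f Q′ P
    im′ = image-rlˡ f Q P k true im

    preimage : ∀ j → ∃[ i ] (apply f (Q′ i) ≡ relabelled P j true 0F)
    preimage j = vertex₀-preimage f (relabelled P j true) Q′ (oriented-rl j true oP) (image-rlʳ f Q′ P j true im′)

    e₀ : apply f (Q′ 0F) ≡ P 0F
    e₀ = trans (cong (λ j → apply f (Q j)) (relabel-zero k)) (proj₂ (vertex₀-preimage f P Q oP im))

    -- The indices a, b, c belong to preimages of the vertices 1, 2, 3 of `P`. A repeated index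
    -- would identify two vertices of `P` and annihilate one of its turns; an index that is not
    -- adjacent to its predecessor would put a diagonal on an edge.
    go : ∀ a b c → apply f (Q′ a) ≡ P 1F → apply f (Q′ b) ≡ P 2F → apply f (Q′ c) ≡ P 3F →
         Σ Bool λ β → ∀ i → apply f (relabelled Q′ 0F β i) ≡ P i
    go 0F _ _ e₁ _ _ = ⊥-elim (turn≢0 oP 0 (cross³-aab _ (trans (sym e₀) e₁)))
    go 2F _ _ e₁ _ _ = ⊥-elim (¬diagonal→edge f P Q′ oP im′ oQ′ e₀ e₁)
    go 1F 0F _ e₁ e₂ _ = ⊥-elim (turn≢0 oP 0 (cross³-aba _ (trans (sym e₀) e₂)))
    go 1F 1F _ e₁ e₂ _ = ⊥-elim (turn≢0 oP 1 (cross³-aab _ (trans (sym e₁) e₂)))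
    go 1F 3F _ e₁ e₂ _ = ⊥-elim (¬diagonal→edge f (relabelled P 1F true) (relabelled Q′ 1F true) (oriented-rl 1F true oP)
      (image-rlʳ f (relabelled Q′ 1F true) P 1F true (image-rlˡ f Q′ P 1F true im′)) (oriented-rl 1F true oQ′) e₁ e₂)
    go 1F 2F 0F e₁ e₂ e₃ = ⊥-elim (turn≢0 oP 3 (cross³-aab _ (trans (sym e₃) e₀)))
    go 1F 2F 1F e₁ e₂ e₃ = ⊥-elim (turn≢0 oP 1 (cross³-aba _ (trans (sym e₁) e₃)))
    go 1F 2F 2F e₁ e₂ e₃ = ⊥-elim (turn≢0 oP 2 (cross³-aab _ (trans (sym e₂) e₃)))
    go 1F 2F 3F e₁ e₂ e₃ = true , λ { 0F → e₀ ; 1F → e₁ ; 2F → e₂ ; 3F → e₃ }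
    go 3F 0F _ e₁ e₂ _ = ⊥-elim (turn≢0 oP 0 (cross³-aba _ (trans (sym e₀) e₂)))
    go 3F 3F _ e₁ e₂ _ = ⊥-elim (turn≢0 oP 1 (cross³-aab _ (trans (sym e₁) e₂)))
    go 3F 1F _ e₁ e₂ _ = ⊥-elim (¬diagonal→edge f (relabelled P 1F true) (relabelled Q′ 3F true) (oriented-rl 1F true oP)
      (image-rlʳ f (relabelled Q′ 3F true) P 1F true (image-rlˡ f Q′ P 3F true im′)) (oriented-rl 3F true oQ′) e₁ e₂)
    go 3F 2F 0F e₁ e₂ e₃ = ⊥-elim (turn≢0 oP 3 (cross³-aab _ (trans (sym e₃) e₀)))
    go 3F 2F 3F e₁ e₂ e₃ = ⊥-elim (turn≢0 oP 1 (cross³-aba _ (trans (sym e₁) e₃)))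
    go 3F 2F 2F e₁ e₂ e₃ = ⊥-elim (turn≢0 oP 2 (cross³-aab _ (trans (sym e₂) e₃)))
    go 3F 2F 1F e₁ e₂ e₃ = false , λ { 0F → e₀ ; 1F → e₁ ; 2F → e₂ ; 3F → e₃ }

    m = let a , e₁ = preimage 1F ; b , e₂ = preimage 2F ; c , e₃ = preimage 3F in go a b c e₁ e₂ e₃

  -- Turns determine the affine type

  turn-cong : ∀ {P Q} → (∀ i → P i ≡ Q i) → ∀ i → turn P i ≡ turn Q i
  turn-cong e i = trans (cong₂ (λ a b → cross³ a b _) (e (mod4 i)) (e (mod4 (suc i)))) (cong (cross³ _ _) (e (mod4 (suc (suc i)))))

  record _∝_ (P Q : Quad) : Set where
    constructor proportional
    field
      scale   : Carrier
      scale≢0 : scale ≢ 0#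
      scaled₀ : turn P 0 ≡ scale * turn Q 0
      scaled₁ : turn P 1 ≡ scale * turn Q 1
      scaled₂ : turn P 2 ≡ scale * turn Q 2
      scaled₃ : turn P 3 ≡ scale * turn Q 3

  vertices⇒∝ : ∀ f P Q → (∀ i → apply f (Q i) ≡ P i) → P ∝ Q
  vertices⇒∝ f P Q e = proportional (det f) (AffineMap.nondeg f) (go 0) (go 1) (go 2) (go 3)
    where
    go : ∀ i → turn P i ≡ det f * turn Q i
    go i = trans (sym (turn-cong {λ i → apply f (Q i)} {P} e i)) (cross³-apply f _ _ _)

  module _ (A B C : Point) (Δ≢0 : cross³ A B C ≢ 0#) where
    private
      i = cross³ A B C ⁻¹
      module Row (a b c : Carrier) where
        -- Cramer's rule for the row that sends the edge vectors B - A and C - B to b - a and c - b.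
        m  = i * ((proj₂ C - proj₂ B) * (b - a) - (proj₂ B - proj₂ A) * (c - b))
        m′ = i * ((proj₁ B - proj₁ A) * (c - b) - (proj₁ C - proj₁ B) * (b - a))
        t  = a - (m * proj₁ A + m′ * proj₂ A)
        at-A : m * proj₁ A + m′ * proj₂ A + t ≡ a
        at-A = ring 2 (λ a x → x ⊕ (a ⊖ x) ⊜ a) tt a (m * proj₁ A + m′ * proj₂ A)
        at-B : m * proj₁ B + m′ * proj₂ B + t ≡ b
        at-B = lin (cong ((b - a) *_) (⁻¹-inverseʳ Δ≢0)) (ringᵖ 3 4 (λ A B C a b c i →
          let m  = i ⊗ ((proj₂ C ⊖ proj₂ B) ⊗ (b ⊖ a) ⊖ (proj₂ B ⊖ proj₂ A) ⊗ (c ⊖ b))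
              m′ = i ⊗ ((proj₁ B ⊖ proj₁ A) ⊗ (c ⊖ b) ⊖ (proj₁ C ⊖ proj₁ B) ⊗ (b ⊖ a)) in
          (m ⊗ proj₁ B ⊕ m′ ⊗ proj₂ B ⊕ (a ⊖ (m ⊗ proj₁ A ⊕ m′ ⊗ proj₂ A))) ⊕ (b ⊖ a) ⊗ :1
            ⊜ b ⊕ (b ⊖ a) ⊗ (cross³ᴱ A B C ⊗ i)) tt (A ∷ B ∷ C ∷ []) (a ∷ b ∷ c ∷ i ∷ []))
        at-C : m * proj₁ C + m′ * proj₂ C + t ≡ c
        at-C = lin (cong ((c - a) *_) (⁻¹-inverseʳ Δ≢0)) (ringᵖ 3 4 (λ A B C a b c i →
          let m  = i ⊗ ((proj₂ C ⊖ proj₂ B) ⊗ (b ⊖ a) ⊖ (proj₂ B ⊖ proj₂ A) ⊗ (c ⊖ b))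
              m′ = i ⊗ ((proj₁ B ⊖ proj₁ A) ⊗ (c ⊖ b) ⊖ (proj₁ C ⊖ proj₁ B) ⊗ (b ⊖ a)) in
          (m ⊗ proj₁ C ⊕ m′ ⊗ proj₂ C ⊕ (a ⊖ (m ⊗ proj₁ A ⊕ m′ ⊗ proj₂ A))) ⊕ (c ⊖ a) ⊗ :1
            ⊜ c ⊕ (c ⊖ a) ⊗ (cross³ᴱ A B C ⊗ i)) tt (A ∷ B ∷ C ∷ []) (a ∷ b ∷ c ∷ i ∷ []))

    affine-through : ∀ A′ B′ C′ → cross³ A′ B′ C′ ≢ 0# →
      ∃[ f ] ((apply f A ≡ A′) × (apply f B ≡ B′) × (apply f C ≡ C′))
    affine-through A′ B′ C′ Δ′≢0 = affine X.m X.m′ Y.m Y.m′ X.t Y.t nondeg ,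
        cong₂ _,_ X.at-A Y.at-A , cong₂ _,_ X.at-B Y.at-B , cong₂ _,_ X.at-C Y.at-C
      where
      module X = Row (proj₁ A′) (proj₁ B′) (proj₁ C′)
      module Y = Row (proj₂ A′) (proj₂ B′) (proj₂ C′)
      i≢0 : i ≢ 0#
      i≢0 = *-≢0ʳ (λ e → 0≢1 (sym (trans (sym (⁻¹-inverseʳ Δ≢0)) e)))
      nondeg : X.m * Y.m′ - X.m′ * Y.m ≢ 0#
      -- The determinant is i² times the product of the turns of the two triangles.
      nondeg e = *-≢0 (*-≢0 i≢0 i≢0) (*-≢0 Δ≢0 Δ′≢0) (trans (ring 9 (λ i ux uy vx vy ux′ uy′ vx′ vy′ →
          i ⊗ i ⊗ ((ux ⊗ vy ⊖ uy ⊗ vx) ⊗ (ux′ ⊗ vy′ ⊖ uy′ ⊗ vx′)) ⊜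
          (i ⊗ (vy ⊗ ux′ ⊖ uy ⊗ vx′)) ⊗ (i ⊗ (ux ⊗ vy′ ⊖ vx ⊗ uy′)) ⊖ (i ⊗ (ux ⊗ vx′ ⊖ vx ⊗ ux′)) ⊗ (i ⊗ (vy ⊗ uy′ ⊖ uy ⊗ vy′))) tt
          i (proj₁ B - proj₁ A) (proj₂ B - proj₂ A) (proj₁ C - proj₁ B) (proj₂ C - proj₂ B)
          (proj₁ B′ - proj₁ A′) (proj₂ B′ - proj₂ A′) (proj₁ C′ - proj₁ B′) (proj₂ C′ - proj₂ B′)) e)

  -- Cramer's rule: turn P 0 · D = turn P 1 · A − turn P 2 · B + turn P 3 · C, and the coefficients add up.
  private
    cramer : ∀ A B C D m m′ t → cross³ A B C * (m * proj₁ D + m′ * proj₂ D + t) ≡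
      cross³ B C D * (m * proj₁ A + m′ * proj₂ A + t) - cross³ C D A * (m * proj₁ B + m′ * proj₂ B + t)
        + cross³ D A B * (m * proj₁ C + m′ * proj₂ C + t)
    cramer A B C D m m′ t = ringᵖ 4 3 (λ A B C D m m′ t → cross³ᴱ A B C ⊗ (m ⊗ proj₁ D ⊕ m′ ⊗ proj₂ D ⊕ t) ⊜
      cross³ᴱ B C D ⊗ (m ⊗ proj₁ A ⊕ m′ ⊗ proj₂ A ⊕ t) ⊖ cross³ᴱ C D A ⊗ (m ⊗ proj₁ B ⊕ m′ ⊗ proj₂ B ⊕ t)
        ⊕ cross³ᴱ D A B ⊗ (m ⊗ proj₁ C ⊕ m′ ⊗ proj₂ C ⊕ t)) tt (A ∷ B ∷ C ∷ D ∷ []) (m ∷ m′ ∷ t ∷ [])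

    cramer₁ : ∀ A B C D → cross³ A B C * proj₁ D ≡
      cross³ B C D * proj₁ A - cross³ C D A * proj₁ B + cross³ D A B * proj₁ C
    cramer₁ A B C D = ringᵖ 4 0 (λ A B C D → cross³ᴱ A B C ⊗ proj₁ D ⊜
      cross³ᴱ B C D ⊗ proj₁ A ⊖ cross³ᴱ C D A ⊗ proj₁ B ⊕ cross³ᴱ D A B ⊗ proj₁ C) tt (A ∷ B ∷ C ∷ D ∷ []) []

    cramer₂ : ∀ A B C D → cross³ A B C * proj₂ D ≡
      cross³ B C D * proj₂ A - cross³ C D A * proj₂ B + cross³ D A B * proj₂ C
    cramer₂ A B C D = ringᵖ 4 0 (λ A B C D → cross³ᴱ A B C ⊗ proj₂ D ⊜
      cross³ᴱ B C D ⊗ proj₂ A ⊖ cross³ᴱ C D A ⊗ proj₂ B ⊕ cross³ᴱ D A B ⊗ proj₂ C) tt (A ∷ B ∷ C ∷ D ∷ []) []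

  -- Three vertices determine the map. By Cramer's relation the fourth is an affine combination of
  -- them whose coefficients are quotients of turns, and these are the same for both quadrangles.
  ∝⇒vertices : ∀ P Q → turn Q 0 ≢ 0# → P ∝ Q → ∃[ f ] (∀ i → apply f (Q i) ≡ P i)
  ∝⇒vertices P Q t≢0 (proportional r r≢0 e₀ e₁ e₂ e₃) = f , λ { 0F → fA ; 1F → fB ; 2F → fC ; 3F → fD }
    where
    through = affine-through (Q 0F) (Q 1F) (Q 2F) t≢0 (P 0F) (P 1F) (P 2F)
      (λ e → *-≢0 r≢0 t≢0 (trans (sym e₀) e))
    f  = proj₁ through
    fA = proj₁ (proj₂ through)
    fB = proj₁ (proj₂ (proj₂ through))
    fC = proj₂ (proj₂ (proj₂ through))
    open AffineMap f
    coord : ∀ m m′ t (x : Point → Carrier) →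
      (∀ A B C D → cross³ A B C * x D ≡ cross³ B C D * x A - cross³ C D A * x B + cross³ D A B * x C) →
      m * proj₁ (Q 0F) + m′ * proj₂ (Q 0F) + t ≡ x (P 0F) →
      m * proj₁ (Q 1F) + m′ * proj₂ (Q 1F) + t ≡ x (P 1F) →
      m * proj₁ (Q 2F) + m′ * proj₂ (Q 2F) + t ≡ x (P 2F) →
      m * proj₁ (Q 3F) + m′ * proj₂ (Q 3F) + t ≡ x (P 3F)
    coord m m′ t x cr a b c = *-cancelˡ t≢0 (*-cancelˡ r≢0 (begin
      r * (turn Q 0 * (m * proj₁ (Q 3F) + m′ * proj₂ (Q 3F) + t))
        ≡⟨ cong (r *_) (cramer (Q 0F) (Q 1F) (Q 2F) (Q 3F) m m′ t) ⟩
      r * (turn Q 1 * _ - turn Q 2 * _ + turn Q 3 * _)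
        ≡⟨ cong (r *_) (cong₂ _+_ (cong₂ (λ u v → turn Q 1 * u - turn Q 2 * v) a b) (cong (turn Q 3 *_) c)) ⟩
      r * (turn Q 1 * x (P 0F) - turn Q 2 * x (P 1F) + turn Q 3 * x (P 2F))
        ≡⟨ ring 7 (λ r u v w a b c → r ⊗ (u ⊗ a ⊖ v ⊗ b ⊕ w ⊗ c) ⊜ (r ⊗ u) ⊗ a ⊖ (r ⊗ v) ⊗ b ⊕ (r ⊗ w) ⊗ c) tt
             r (turn Q 1) (turn Q 2) (turn Q 3) (x (P 0F)) (x (P 1F)) (x (P 2F)) ⟩
      r * turn Q 1 * x (P 0F) - r * turn Q 2 * x (P 1F) + r * turn Q 3 * x (P 2F)
        ≡⟨ cong₂ _+_ (cong₂ (λ u v → u * x (P 0F) - v * x (P 1F)) e₁ e₂) (cong (_* x (P 2F)) e₃) ⟨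
      turn P 1 * x (P 0F) - turn P 2 * x (P 1F) + turn P 3 * x (P 2F)
        ≡⟨ cr (P 0F) (P 1F) (P 2F) (P 3F) ⟨
      turn P 0 * x (P 3F)
        ≡⟨ cong (_* x (P 3F)) e₀ ⟩
      r * turn Q 0 * x (P 3F)
        ≡⟨ R.*-assoc r (turn Q 0) (x (P 3F)) ⟩
      r * (turn Q 0 * x (P 3F)) ∎))
      where open ≡-Reasoning
    fD : apply f (Q 3F) ≡ P 3F
    fD = cong₂ _,_ (coord m₁₁ m₁₂ t₁ proj₁ cramer₁ (cong proj₁ fA) (cong proj₁ fB) (cong proj₁ fC))
                   (coord m₂₁ m₂₂ t₂ proj₂ cramer₂ (cong proj₂ fA) (cong proj₂ fB) (cong proj₂ fC))

  -- Ratios on a pair of opposite sides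

  -- If the lines V₀V₁ and V₃V₂ meet in O, then a = OV₀/OV₁ and b = OV₃/OV₂.
  record HasRatios (Q : Quad) (a b : Carrier) : Set where
    constructor ratios
    field
      ratio₁ : turn Q 2 ≡ a * turn Q 1
      ratio₂ : turn Q 3 ≡ b * turn Q 0
  open HasRatios

  -- A piece fixes its ratios along the cut sides, but the map from `Q` may reach these sides under
  -- any labelling. The pairs collected here are those available to a piece.
  record RatiosOf (Q : Quad) (a b : Carrier) : Set where
    constructor labelled
    field
      start   : Fin 4
      forward : Bool
      has     : HasRatios (relabelled Q start forward) a b

  HasRatios-cong : ∀ {P Q a b} → (∀ i → P i ≡ Q i) → HasRatios P a b → HasRatios Q a b
  HasRatios-cong {P} {Q} {a} {b} e (ratios h₁ h₂) = ratios
    (trans (sym (t 2)) (trans h₁ (cong (a *_) (t 1)))) (trans (sym (t 3)) (trans h₂ (cong (b *_) (t 0))))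
    where t = turn-cong {P} {Q} e

  RatiosOf-rl : ∀ {Q a b} k β → RatiosOf (relabelled Q k β) a b → RatiosOf Q a b
  RatiosOf-rl {Q} k β (labelled k′ β′ h) = labelled (relabel k β (toℕ k′)) (β ∘ᵇ β′) (HasRatios-cong (rl-∘ Q k β k′ β′) h)

  RatiosOf-rl⁻¹ : ∀ {Q a b} k β → RatiosOf Q a b → RatiosOf (relabelled Q k β) a b
  RatiosOf-rl⁻¹ {Q} {a} {b} k β (labelled k′ β′ h) =
    let k⁻ , e = relabel-inverse k β in
    RatiosOf-rl k⁻ β (labelled k′ β′ (HasRatios-cong (λ i → sym (cong Q (e (relabel k′ β′ (toℕ i))))) h))

  turn-balance : ∀ Q → turn Q 0 + turn Q 2 ≡ turn Q 1 + turn Q 3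
  turn-balance Q = turn-sum (Q 0F) (Q 1F) (Q 2F) (Q 3F)

  ratio-balance : ∀ {Q a b} → HasRatios Q a b → turn Q 0 * (1# - b) ≡ turn Q 1 * (1# - a)
  ratio-balance {Q} {a} {b} (ratios h₁ h₂) = lin (cong₂ _-_ (turn-balance Q) (cong₂ _-_ h₁ h₂))
    (ring 6 (λ t u v w a b → t ⊗ (:1 ⊖ b) ⊕ (u ⊕ w ⊖ (a ⊗ u ⊖ b ⊗ t)) ⊜ u ⊗ (:1 ⊖ a) ⊕ (t ⊕ v ⊖ (v ⊖ w))) tt
      (turn Q 0) (turn Q 1) (turn Q 2) (turn Q 3) a b)

  -neg : ∀ {x y} a → x ≡ a * y → - x ≡ a * - y
  -neg {x} {y} a e = trans (cong -_ e) (ring 2 (λ a y → ⊝ (a ⊗ y) ⊜ a ⊗ ⊝ y) tt a y)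

  cross³-reverse-* : ∀ {A B C A′ B′ C′ c} → cross³ A B C ≡ c * cross³ A′ B′ C′ → cross³ C B A ≡ c * cross³ C′ B′ A′
  cross³-reverse-* {A} {B} {C} {A′} {B′} {C′} {c} h =
    trans (cross³-reverse A B C) (trans (-neg c h) (cong (c *_) (sym (cross³-reverse A′ B′ C′))))

  -- The labellings that keep the pair of sides V₀V₁, V₂V₃ swap a and b or invert both.
  swap-ratios : ∀ {Q a b} → HasRatios Q a b → HasRatios (relabelled Q 3F false) b a
  swap-ratios (ratios h₁ h₂) = ratios (cross³-reverse-* h₂) (cross³-reverse-* h₁)

  invert-ratios : ∀ {Q a b c d} → a * c ≡ 1# → b * d ≡ 1# → HasRatios Q a b → HasRatios (relabelled Q 2F true) d c
  invert-ratios {Q} {a} {b} {c} {d} ac bd (ratios h₁ h₂) = ratios (inv bd h₂) (inv ac h₁)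
    where
    inv : ∀ {x y a c} → a * c ≡ 1# → x ≡ a * y → y ≡ c * x
    inv {x} {y} {a} {c} ac h = lin (cong₂ _+_ (cong (y *_) (sym ac)) (cong (c *_) (sym h)))
      (ring 4 (λ x y a c → y ⊕ (y ⊗ (a ⊗ c) ⊕ c ⊗ x) ⊜ c ⊗ x ⊕ (y ⊗ :1 ⊕ c ⊗ (a ⊗ y))) tt x y a c)

  RatiosOf-swap : ∀ {Q a b} → RatiosOf Q a b → RatiosOf Q b a
  RatiosOf-swap (labelled k β h) = RatiosOf-rl k β (labelled 3F false (swap-ratios h))

  RatiosOf-invert : ∀ {Q a b c d} → a * c ≡ 1# → b * d ≡ 1# → RatiosOf Q a b → RatiosOf Q c d
  RatiosOf-invert ac bd (labelled k β h) = RatiosOf-swap (RatiosOf-rl k β (labelled 2F true (invert-ratios ac bd h)))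

  -- Triangles over a common side have equal areas exactly when the opposite side is parallel to it:
  -- this is `NonTrapezoid` expressed by turns, together with convexity.
  record Generic (Q : Quad) : Set where
    constructor generic
    field
      orientation : Oriented Q
      turns₀₁     : turn Q 0 ≢ turn Q 1
      turns₀₃     : turn Q 0 ≢ turn Q 3
  open Generic public

  nonTrapezoid⇒generic : ∀ {Q} → ConvexQuad Q → NonTrapezoid Q → Generic Q
  nonTrapezoid⇒generic {Q} cvx (n₁ , n₂) = generic (convex⇒oriented cvx)
    (λ e → n₂ (trans (ringᵖ 4 0 (λ A B C D → crossᴱ (proj₁ C ⊖ proj₁ B , proj₂ C ⊖ proj₂ B) (proj₁ A ⊖ proj₁ D , proj₂ A ⊖ proj₂ D)
        ⊜ cross³ᴱ A B C ⊖ cross³ᴱ B C D) tt (Q 0F ∷ Q 1F ∷ Q 2F ∷ Q 3F ∷ []) []) (trans (cong (_- turn Q 1) e) (R.-‿inverseʳ _))))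
    (λ e → n₁ (trans (ringᵖ 4 0 (λ A B C D → crossᴱ (proj₁ B ⊖ proj₁ A , proj₂ B ⊖ proj₂ A) (proj₁ D ⊖ proj₁ C , proj₂ D ⊖ proj₂ C)
        ⊜ cross³ᴱ D A B ⊖ cross³ᴱ A B C) tt (Q 0F ∷ Q 1F ∷ Q 2F ∷ Q 3F ∷ []) []) (trans (cong (λ x → turn Q 3 - x) e) (R.-‿inverseʳ _))))

  generic-rl : ∀ {Q} k β → Generic Q → Generic (relabelled Q k β)
  generic-rl {Q} k β (generic o n₀₁ n₀₃) = generic (oriented-rl k β o) (go₀₁ k β) (go₀₃ k β)
    where
    t₀ = turn Q 0
    t₁ = turn Q 1
    t₂ = turn Q 2
    t₃ = turn Q 3
    -- The other two pairs of adjacent turns differ as well, since t₀ + t₂ = t₁ + t₃.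
    n₁₂ : t₁ ≢ t₂
    n₁₂ e = n₀₃ (lin (cong₂ _+_ (turn-balance Q) e) (ring 4 (λ a b c d → a ⊕ (b ⊕ d ⊕ c) ⊜ d ⊕ (a ⊕ c ⊕ b)) tt t₀ t₁ t₂ t₃))
    n₂₃ : t₂ ≢ t₃
    n₂₃ e = n₀₁ (lin (cong₂ _-_ (turn-balance Q) e) (ring 4 (λ a b c d → a ⊕ (b ⊕ d ⊖ d) ⊜ b ⊕ (a ⊕ c ⊖ c)) tt t₀ t₁ t₂ t₃))
    rev : ∀ {x y A B C A′ B′ C′} → cross³ A B C ≡ x → cross³ A′ B′ C′ ≡ y → x ≢ y → cross³ C B A ≢ cross³ C′ B′ A′
    rev {x} {y} {A} {B} {C} {A′} {B′} {C′} refl refl ne e =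
      ne (-‿injective (trans (sym (cross³-reverse A B C)) (trans e (cross³-reverse A′ B′ C′))))
    go₀₁ : ∀ k β → turn (relabelled Q k β) 0 ≢ turn (relabelled Q k β) 1
    go₀₁ 0F true  = n₀₁
    go₀₁ 1F true  = n₁₂
    go₀₁ 2F true  = n₂₃
    go₀₁ 3F true  = n₀₃ ∘ sym
    go₀₁ 0F false = rev {t₂} {t₁} refl refl (n₁₂ ∘ sym)
    go₀₁ 1F false = rev {t₃} {t₂} refl refl (n₂₃ ∘ sym)
    go₀₁ 2F false = rev {t₀} {t₃} refl refl n₀₃
    go₀₁ 3F false = rev {t₁} {t₀} refl refl (n₀₁ ∘ sym)
    go₀₃ : ∀ k β → turn (relabelled Q k β) 0 ≢ turn (relabelled Q k β) 3
    go₀₃ 0F true  = n₀₃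
    go₀₃ 1F true  = n₀₁ ∘ sym
    go₀₃ 2F true  = n₁₂ ∘ sym
    go₀₃ 3F true  = n₂₃ ∘ sym
    go₀₃ 0F false = rev {t₂} {t₃} refl refl n₂₃
    go₀₃ 1F false = rev {t₃} {t₀} refl refl (n₀₃ ∘ sym)
    go₀₃ 2F false = rev {t₀} {t₁} refl refl n₀₁
    go₀₃ 3F false = rev {t₁} {t₂} refl refl n₁₂

  Below Above : Carrier → Carrier → Set
  Below a b = (a < 1#) × (b < 1#)
  Above a b = (1# < a) × (1# < b)

  ratios-positive : ∀ {Q a b} → Oriented Q → HasRatios Q a b → (0# < a) × (0# < b)
  ratios-positive {Q} {a} {b} (σ by h) (ratios h₁ h₂) = pos (h 1) (h 2) h₁ , pos (h 0) (h 3) h₂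
    where
    pos : ∀ {x y a} → 0# < σ * y → 0# < σ * x → x ≡ a * y → 0# < a
    pos {x} {y} {a} hy hx e = *-cancel-pos hy (pos-by hx (trans (cong (σ *_) e) (ring 3 (λ s a y → s ⊗ (a ⊗ y) ⊜ s ⊗ y ⊗ a) tt σ a y)))

  1-pos : ∀ {Q a b} → Oriented Q → HasRatios Q a b → 0# < 1# - a → 0# < 1# - b
  1-pos {Q} {a} {b} (σ by h) hr lt = *-cancel-pos (h 0) (pos-by (*-pos (h 1) lt)
    (trans (R.*-assoc σ (turn Q 1) _) (trans (cong (σ *_) (sym (ratio-balance hr))) (sym (R.*-assoc σ (turn Q 0) _)))))

  1-neg : ∀ {Q a b} → Oriented Q → HasRatios Q a b → 0# < a - 1# → 0# < b - 1#
  1-neg {Q} {a} {b} (σ by h) hr lt = *-cancel-pos (h 0) (pos-by (*-pos (h 1) lt)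
    (trans (ring 3 (λ s t a → s ⊗ t ⊗ (a ⊖ :1) ⊜ s ⊗ ⊝ (t ⊗ (:1 ⊖ a))) tt σ (turn Q 1) a)
      (trans (cong (λ x → σ * - x) (sym (ratio-balance hr))) (ring 3 (λ s t b → s ⊗ ⊝ (t ⊗ (:1 ⊖ b)) ⊜ s ⊗ t ⊗ (b ⊖ :1)) tt σ (turn Q 0) b))))

  module _ {Q : Quad} {a b : Carrier} (g : Generic Q) where
    RatiosOf-pos : RatiosOf Q a b → (0# < a) × (0# < b)
    RatiosOf-pos (labelled k β h) = ratios-positive (oriented-rl k β (orientation g)) h

    -- The value 1 would put O at infinity, making V₀V₁ and V₃V₂ parallel.
    RatiosOf-≢1 : RatiosOf Q a b → a ≢ 1#
    RatiosOf-≢1 (labelled k β h) refl = turns₀₃ g′ (lin (cong₂ _+_ (turn-balance Q′) (sym (ratio₁ h)))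
        (ring 4 (λ t u v w → t ⊕ (u ⊕ w ⊕ v) ⊜ w ⊕ (t ⊕ v ⊕ :1 ⊗ u)) tt (turn Q′ 0) (turn Q′ 1) (turn Q′ 2) (turn Q′ 3)))
      where
      Q′ = relabelled Q k β
      g′ = generic-rl k β g

    -- By the intercept theorem equal ratios would make V₀V₃ and V₁V₂ parallel.
    RatiosOf-≢ : RatiosOf Q a b → a ≢ b
    RatiosOf-≢ r@(labelled k β h) refl = turns₀₁ (generic-rl k β g)
      (*-cancelˡ (λ e → RatiosOf-≢1 r (sym (x∙y⁻¹≈ε⇒x≈y _ _ e))) (trans (R.*-comm _ _) (trans (ratio-balance h) (R.*-comm _ _))))

    -- By `ratio-balance` the numbers 1 - a and 1 - b differ by a quotient of two turns, which is
    -- positive: O lies beyond V₀V₃ or beyond V₁V₂.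
    RatiosOf-side : RatiosOf Q a b → Below a b ⊎ Above a b
    RatiosOf-side r@(labelled k β h) with compare a 1#
    ... | tri< lt _ _ = inj₁ (lt , pos⇒< (1-pos (oriented-rl k β (orientation g)) h (<⇒pos lt)))
    ... | tri≈ _ e _ = ⊥-elim (RatiosOf-≢1 r e)
    ... | tri> _ _ gt = inj₂ (gt , pos⇒< (1-neg (oriented-rl k β (orientation g)) h (<⇒pos gt)))

  -- By ratio-balance the turns of Q are determined by a ≢ 1, b and turn Q 0.
  ratios⇒∝ : ∀ {P Q a b} → turn P 0 ≢ 0# → turn Q 0 ≢ 0# → a ≢ 1# → HasRatios P a b → HasRatios Q a b → P ∝ Q
  ratios⇒∝ {P} {Q} {a} {b} p≢0 q≢0 a≢1 hP hQ = proportional r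
      (*-≢0 p≢0 (*-≢0ʳ (λ e → 0≢1 (sym (trans (sym (⁻¹-inverseʳ q≢0)) e))))) e₀ e₁ (step a (ratio₁ hP) (ratio₁ hQ) e₁) (step b (ratio₂ hP) (ratio₂ hQ) e₀)
    where
    r = turn P 0 * turn Q 0 ⁻¹
    e₀ : turn P 0 ≡ r * turn Q 0
    e₀ = lin (cong (turn P 0 *_) (sym (⁻¹-inverseʳ q≢0)))
      (ring 3 (λ p q i → p ⊕ p ⊗ (q ⊗ i) ⊜ p ⊗ i ⊗ q ⊕ p ⊗ :1) tt (turn P 0) (turn Q 0) (turn Q 0 ⁻¹))
    e₁ : turn P 1 ≡ r * turn Q 1
    e₁ = *-cancelˡ (-≢0 (a≢1 ∘ sym)) (begin
      (1# - a) * turn P 1         ≡⟨ R.*-comm _ _ ⟩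
      turn P 1 * (1# - a)         ≡⟨ ratio-balance hP ⟨
      turn P 0 * (1# - b)         ≡⟨ cong (_* (1# - b)) e₀ ⟩
      r * turn Q 0 * (1# - b)     ≡⟨ R.*-assoc _ _ _ ⟩
      r * (turn Q 0 * (1# - b))   ≡⟨ cong (r *_) (ratio-balance hQ) ⟩
      r * (turn Q 1 * (1# - a))   ≡⟨ ring 3 (λ r t a → r ⊗ (t ⊗ (:1 ⊖ a)) ⊜ (:1 ⊖ a) ⊗ (r ⊗ t)) tt r (turn Q 1) a ⟩
      (1# - a) * (r * turn Q 1)   ∎)
      where open ≡-Reasoning
    step : ∀ {x y u v} c → x ≡ c * u → y ≡ c * v → u ≡ r * v → x ≡ r * y
    step {x} {y} {u} {v} c refl refl refl = ring 3 (λ c r v → c ⊗ (r ⊗ v) ⊜ r ⊗ (c ⊗ v)) tt c r v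

  ∝-ratios : ∀ {P Q a b} → P ∝ Q → HasRatios P a b → HasRatios Q a b
  ∝-ratios {P} {Q} {a} {b} (proportional r r≢0 e₀ e₁ e₂ e₃) (ratios h₁ h₂) = ratios (step e₂ e₁ h₁) (step e₃ e₀ h₂)
    where
    step : ∀ {x y u v c} → x ≡ r * u → y ≡ r * v → x ≡ c * y → u ≡ c * v
    step {x} {y} {u} {v} {c} refl refl h = *-cancelˡ r≢0 (trans h (ring 3 (λ c r v → c ⊗ (r ⊗ v) ⊜ r ⊗ (c ⊗ v)) tt c r v))

  image⇒ratios : ∀ {W Q a b} → Oriented W → Oriented Q → HasRatios W a b → IsAffineImageOf W Q → RatiosOf Q a b
  image⇒ratios {W} {Q} oW oQ h (f , im) = let k , β , e = image⇒vertices f W Q oW oQ im in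
    labelled k β (∝-ratios (vertices⇒∝ f W (relabelled Q k β) e) h)

  ratios⇒image : ∀ {W Q a b} → Oriented W → Generic Q → HasRatios W a b → RatiosOf Q a b → IsAffineImageOf W Q
  ratios⇒image {W} {Q} oW g h r@(labelled k β h′) =
    let t≢0 = turn≢0 (oriented-rl k β (orientation g)) 0
        f , e = ∝⇒vertices W (relabelled Q k β) t≢0 (ratios⇒∝ (turn≢0 oW 0) t≢0 (RatiosOf-≢1 g r) h h′)
    in f , image-rlˡ⁻¹ f Q W k β (vertices⇒image f (relabelled Q k β) W e)

  -- Standard quadrangles and their pairs of ratios

  standard : Carrier → Carrier → Quad
  standard x y = quad (pt 0# 1#) (pt 0# 0#) (pt 1# 0#) (pt x y)

  standard-turn₀ : ∀ x y → turn (standard x y) 0 ≡ 1#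
  standard-turn₀ x y = ring 2 (λ x y → cross³ᴱ (:0 , :1) (:0 , :0) (:1 , :0) ⊜ :1) tt x y

  standard-turn₁ : ∀ x y → turn (standard x y) 1 ≡ y
  standard-turn₁ x y = ring 2 (λ x y → cross³ᴱ (:0 , :0) (:1 , :0) (x , y) ⊜ y) tt x y

  standard-turn₂ : ∀ x y → turn (standard x y) 2 ≡ x + y - 1#
  standard-turn₂ x y = ring 2 (λ x y → cross³ᴱ (:1 , :0) (x , y) (:0 , :1) ⊜ x ⊕ y ⊖ :1) tt x y

  standard-turn₃ : ∀ x y → turn (standard x y) 3 ≡ x
  standard-turn₃ x y = ring 2 (λ x y → cross³ᴱ (x , y) (:0 , :1) (:0 , :0) ⊜ x) tt x y

  -- Stands for q = x, q′ = y, p = z/y, p′ = z/x with z = x + y - 1; both products in `pq′≡p′q` are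
  -- z. No order between q and q′ is required, so the primed and the unprimed pair are
  -- interchangeable.
  record Shape (p q p′ q′ : Carrier) : Set where
    field
      0<p  : 0# < p
      p<q  : p < q
      q<1  : q < 1#
      0<p′ : 0# < p′
      p′<q′ : p′ < q′
      q′<1 : q′ < 1#
      pq′≡p′q : p * q′ ≡ p′ * q
      q+q′≡1+pq′ : q + q′ ≡ 1# + p * q′
    0<q : 0# < q
    0<q = <-trans 0<p p<q
    0<q′ : 0# < q′
    0<q′ = <-trans 0<p′ p′<q′
    p<1 : p < 1#
    p<1 = <-trans p<q q<1
    p′<1 : p′ < 1#
    p′<1 = <-trans p′<q′ q′<1

  record HasShape (N : Quad) (p q p′ q′ : Carrier) : Set where
    field
      shape : Shape p q p′ q′
      turn₂ : turn N 2 ≡ p * turn N 1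
      turn₃ : turn N 3 ≡ q * turn N 0
      turn₂′ : turn N 2 ≡ p′ * turn N 3
      turn₁′ : turn N 1 ≡ q′ * turn N 0

  Ascending : (p q p′ q′ a b : Carrier) → Set
  Ascending p q p′ q′ a b = ((a ≡ p) × (b ≡ q)) ⊎ ((a ≡ p′) × (b ≡ q′))

  -- Of the eight labellings four have ratios that are inverses of numbers below 1, which a < 1
  -- excludes; the others give the two pairs and their reversals.
  classify : ∀ {Q p q p′ q′ a b} k β → Generic Q → HasShape (relabelled Q k β) p q p′ q′ → RatiosOf Q a b → a < 1# →
    Ascending p q p′ q′ a b ⊎ Ascending p q p′ q′ b a
  classify {Q} {p} {q} {p′} {q′} {a} {b} k β g hs r a<1 = go (RatiosOf-rl⁻¹ k β r)
    where
    N = relabelled Q k β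
    o = oriented-rl k β (orientation g)
    open HasShape hs
    open Shape shape
    0<a = proj₁ (RatiosOf-pos g r)
    match : ∀ {x y c d} i → y ≡ turn N i → x ≡ c * y → x ≡ d * y → c ≡ d
    match {x} {y} {c} {d} i e h h′ = *-cancelˡ (λ z → turn≢0 o i (trans (sym e) z)) (trans (R.*-comm y c) (trans (sym h) (trans h′ (R.*-comm d y))))
    absurd : ∀ {x y c} {A : Set} i → y ≡ turn N i → x ≡ c * y → y ≡ a * x → 0# < c → c < 1# → A
    absurd {x} {y} {c} i e h h′ 0<c c<1 = ⊥-elim (<⇒≢ (*-mono-< 0<a a<1 0<c c<1)
      (*-cancelˡ (λ z → turn≢0 o i (trans (sym e) z)) (trans (ring 3 (λ y a c → y ⊗ (a ⊗ c) ⊜ a ⊗ (c ⊗ y)) tt y a c)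
        (trans (cong (a *_) (sym h)) (trans (sym h′) (ring 1 (λ y → y ⊜ y ⊗ (:1 ⊗ :1)) tt y))))))
    go : RatiosOf N a b → Ascending p q p′ q′ a b ⊎ Ascending p q p′ q′ b a
    go (labelled 0F true (ratios h₁ h₂)) = inj₁ (inj₁ (match 1 refl h₁ turn₂ , match 0 refl h₂ turn₃))
    go (labelled 1F true (ratios h₁ h₂)) = absurd 3 refl turn₂′ h₁ 0<p′ p′<1
    go (labelled 2F true (ratios h₁ h₂)) = absurd 0 refl turn₃ h₁ 0<q q<1
    go (labelled 3F true (ratios h₁ h₂)) = inj₂ (inj₂ (match 3 refl h₂ turn₂′ , match 0 refl h₁ turn₁′))
    go (labelled 0F false (ratios h₁ h₂)) = absurd 0 refl turn₁′ (cross³-reverse-* h₁) 0<q′ q′<1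
    go (labelled 1F false (ratios h₁ h₂)) = absurd 1 refl turn₂ (cross³-reverse-* h₁) 0<p p<1
    go (labelled 2F false (ratios h₁ h₂)) = inj₁ (inj₂ (match 3 refl (cross³-reverse-* h₁) turn₂′ , match 0 refl (cross³-reverse-* h₂) turn₁′))
    go (labelled 3F false (ratios h₁ h₂)) = inj₂ (inj₁ (match 1 refl (cross³-reverse-* h₂) turn₂ , match 0 refl (cross³-reverse-* h₁) turn₃))

  shape-ratios : ∀ {N p q p′ q′} → HasShape N p q p′ q′ → HasRatios N p q
  shape-ratios hs = ratios (HasShape.turn₂ hs) (HasShape.turn₃ hs)

  shape-ratios′ : ∀ {N p q p′ q′} → HasShape N p q p′ q′ → HasRatios (relabelled N 2F false) p′ q′
  shape-ratios′ hs = ratios (cross³-reverse-* (HasShape.turn₂′ hs)) (cross³-reverse-* (HasShape.turn₁′ hs))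

  -- The primed pair is read off the other two sides. Its bounds come from q′(q - p) = q(q′ - p′)
  -- and (1 - p)(1 - q′) = q - p.
  ratios⇒shape : ∀ {N p q} → Generic N → HasRatios N p q → p < q → q < 1# → ∃[ p′ ] ∃[ q′ ] HasShape N p q p′ q′
  ratios⇒shape {N} {p} {q} g h@(ratios h₁ h₂) p<q q<1 = p′ , q′ , hs
    where
    o = orientation g
    t = turn N
    p′ = t 2 * t 3 ⁻¹
    q′ = t 1 * t 0 ⁻¹
    e₂ : t 2 ≡ p′ * t 3
    e₂ = quotient-* (turn≢0 o 3)
    e₁ : t 1 ≡ q′ * t 0
    e₁ = quotient-* (turn≢0 o 0)
    0<p = proj₁ (ratios-positive o h)
    0<q = proj₂ (ratios-positive o h)
    pos′ = ratios-positive {a = p′} {b = q′} (oriented-rl 2F false o) (ratios (cross³-reverse-* e₂) (cross³-reverse-* e₁))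
    0<p′ = proj₁ pos′
    0<q′ = proj₂ pos′
    cross-eq : p * q′ ≡ p′ * q
    cross-eq = *-cancelˡ (turn≢0 o 0) (lin (cong₂ _+_ (cong₂ _+_ (cong (p *_) (sym e₁)) (sym h₁)) (cong₂ _+_ e₂ (cong (p′ *_) h₂)))
      (ring 8 (λ a b c d p q p′ q′ → a ⊗ (p ⊗ q′) ⊕ (p ⊗ b ⊕ c ⊕ (p′ ⊗ d ⊕ p′ ⊗ (q ⊗ a)))
        ⊜ a ⊗ (p′ ⊗ q) ⊕ (p ⊗ (q′ ⊗ a) ⊕ p ⊗ b ⊕ (c ⊕ p′ ⊗ d))) tt (t 0) (t 1) (t 2) (t 3) p q p′ q′))
    sum : q + q′ ≡ 1# + p * q′
    sum = *-cancelˡ (turn≢0 o 0) (lin (cong₂ _+_ (sym (ratio-balance h)) (cong (_* (1# - p)) (sym e₁)))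
      (ring 5 (λ a b p q q′ → a ⊗ (q ⊕ q′) ⊕ (a ⊗ (:1 ⊖ q) ⊕ b ⊗ (:1 ⊖ p))
        ⊜ a ⊗ (:1 ⊕ p ⊗ q′) ⊕ (b ⊗ (:1 ⊖ p) ⊕ q′ ⊗ a ⊗ (:1 ⊖ p))) tt (t 0) (t 1) p q q′))
    hs : HasShape N p q p′ q′
    hs = record { turn₂ = h₁ ; turn₃ = h₂ ; turn₂′ = e₂ ; turn₁′ = e₁ ; shape = record
      { 0<p = 0<p ; p<q = p<q ; q<1 = q<1 ; 0<p′ = 0<p′
      ; p′<q′ = pos⇒< (*-cancel-pos 0<q (pos-by (*-pos 0<q′ (<⇒pos p<q))
          (lin (sym cross-eq) (ring 4 (λ p q p′ q′ → q′ ⊗ (q ⊖ p) ⊕ p ⊗ q′ ⊜ q ⊗ (q′ ⊖ p′) ⊕ p′ ⊗ q) tt p q p′ q′))))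
      ; q′<1 = pos⇒< (*-cancel-pos (<⇒pos (<-trans p<q q<1)) (pos-by (<⇒pos p<q)
          (lin sum (ring 3 (λ p q q′ → q ⊖ p ⊕ (:1 ⊕ p ⊗ q′) ⊜ (:1 ⊖ p) ⊗ (:1 ⊖ q′) ⊕ (q ⊕ q′)) tt p q q′))))
      ; pq′≡p′q = cross-eq ; q+q′≡1+pq′ = sum } }

  -- Scaled so that the first turn is 1, the turns are 1, q′, pq′ = q + q′ - 1 and q, which are
  -- those of `standard q q′`.
  shape⇒affineType : ∀ {Q p q p′ q′} k β → Oriented (relabelled Q k β) → HasShape (relabelled Q k β) p q p′ q′ → AffineType Q q q′
  shape⇒affineType {Q} {p} {q} {p′} {q′} k β o hs =
    let f , e = ∝⇒vertices (standard q q′) N (turn≢0 o 0) std∝N in k , β , f , e 0F , e 1F , e 2F , e 3F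
    where
    open HasShape hs
    open Shape shape
    N = relabelled Q k β
    i = turn N 0 ⁻¹
    inv = ⁻¹-inverseʳ (turn≢0 o 0)
    scaled : ∀ {x c} → x ≡ c * turn N 0 → c ≡ i * x
    scaled {x} {c} refl = lin (cong (c *_) (sym inv)) (ring 3 (λ c t i → c ⊕ c ⊗ (t ⊗ i) ⊜ i ⊗ (c ⊗ t) ⊕ c ⊗ :1) tt c (turn N 0) i)
    std∝N : standard q q′ ∝ N
    std∝N = proportional i (*-≢0ʳ (λ e → 0≢1 (sym (trans (sym inv) e))))
      (trans (standard-turn₀ q q′) (scaled (sym (R.*-identityˡ _))))
      (trans (standard-turn₁ q q′) (scaled turn₁′))
      (trans (standard-turn₂ q q′) (trans (lin q+q′≡1+pq′ (ring 3 (λ p q q′ → q ⊕ q′ ⊖ :1 ⊕ (:1 ⊕ p ⊗ q′) ⊜ p ⊗ q′ ⊕ (q ⊕ q′)) tt p q q′))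
        (scaled (trans turn₂ (trans (cong (p *_) turn₁′) (sym (R.*-assoc p q′ (turn N 0))))))))
      (trans (standard-turn₃ q q′) (scaled turn₃))

  affineType⇒shape : ∀ {Q x y} → AffineType Q x y → Base x y →
    ∃[ k ] ∃[ β ] ∃[ p ] ∃[ p′ ] HasShape (relabelled Q k β) p x p′ y
  affineType⇒shape {Q} {x} {y} (k , β , f , e₀ , e₁ , e₂ , e₃) (1<x+y , y<1 , x<y) = k , β , p , p′ , hs
    where
    N = relabelled Q k β
    similar : standard x y ∝ N
    similar = vertices⇒∝ f (standard x y) N (λ { 0F → e₀ ; 1F → e₁ ; 2F → e₂ ; 3F → e₃ })
    open _∝_ similar
    z = x + y - 1#
    p = z * y ⁻¹
    p′ = z * x ⁻¹
    0<z : 0# < z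
    0<z = <⇒pos 1<x+y
    0<x : 0# < x
    0<x = pos-by (+-pos 0<z (<⇒pos y<1)) (ring 2 (λ x y → x ⊕ y ⊖ :1 ⊕ (:1 ⊖ y) ⊜ x) tt x y)
    0<y : 0# < y
    0<y = <-trans 0<x x<y
    x<1 : x < 1#
    x<1 = <-trans x<y y<1
    py≡z : ∀ {w} → 0# < w → z * w ⁻¹ * w ≡ z
    py≡z 0<w = sym (quotient-* (pos≢0 0<w))
    -- Both p < x and p′ < y amount to z < xy, that is to (1 - x)(1 - y) > 0.
    less : ∀ {u w} → 0# < w → u * w ≡ x * y → z * w ⁻¹ < u
    less {u} {w} 0<w e = pos⇒< (*-cancel-pos 0<w (pos-by (*-pos (<⇒pos x<1) (<⇒pos y<1)) (lin (cong₂ _-_ (py≡z 0<w) e)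
      (ring 5 (λ x y u w v → (:1 ⊖ x) ⊗ (:1 ⊖ y) ⊕ (x ⊕ y ⊖ :1 ⊖ x ⊗ y) ⊜ w ⊗ (u ⊖ v) ⊕ (v ⊗ w ⊖ u ⊗ w)) tt x y u w (z * w ⁻¹)))))
    standardize : ∀ {s t u v c} → s ≡ scale * t → u ≡ scale * v → s ≡ c * u → t ≡ c * v
    standardize {s} {t} {u} {v} {c} refl refl h = *-cancelˡ scale≢0 (trans h (ring 3 (λ c r v → c ⊗ (r ⊗ v) ⊜ r ⊗ (c ⊗ v)) tt c scale v))
    s₀ = trans (sym (standard-turn₀ x y)) scaled₀
    s₁ = trans (sym (standard-turn₁ x y)) scaled₁
    s₂ = trans (sym (standard-turn₂ x y)) scaled₂
    s₃ = trans (sym (standard-turn₃ x y)) scaled₃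
    hs : HasShape N p x p′ y
    hs = record
      { turn₂ = standardize s₂ s₁ (sym (py≡z 0<y)) ; turn₃ = standardize s₃ s₀ (sym (R.*-identityʳ x))
      ; turn₂′ = standardize s₂ s₃ (sym (py≡z 0<x)) ; turn₁′ = standardize s₁ s₀ (sym (R.*-identityʳ y))
      ; shape = record
        { 0<p = *-pos 0<z (⁻¹-pos 0<y) ; p<q = less 0<y refl ; q<1 = x<1
        ; 0<p′ = *-pos 0<z (⁻¹-pos 0<x) ; p′<q′ = less 0<x (R.*-comm y x) ; q′<1 = y<1
        ; pq′≡p′q = trans (py≡z 0<y) (sym (py≡z 0<x))
        ; q+q′≡1+pq′ = trans (ring 2 (λ x y → x ⊕ y ⊜ :1 ⊕ (x ⊕ y ⊖ :1)) tt x y) (cong (1# +_) (sym (py≡z 0<y))) } }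

  -- Slabs between two opposite sides

  lerp-0 : ∀ A B → lerp A B 0# ≡ A
  lerp-0 A B = cong₂ _,_ (e (proj₁ A) (proj₁ B)) (e (proj₂ A) (proj₂ B))
    where
    e : ∀ a b → a + 0# * (b - a) ≡ a
    e = ring 2 (λ a b → a ⊕ :0 ⊗ (b ⊖ a) ⊜ a) tt

  lerp-1 : ∀ A B → lerp A B 1# ≡ B
  lerp-1 A B = cong₂ _,_ (e (proj₁ A) (proj₁ B)) (e (proj₂ A) (proj₂ B))
    where
    e : ∀ a b → a + 1# * (b - a) ≡ b
    e = ring 2 (λ a b → a ⊕ :1 ⊗ (b ⊖ a) ⊜ b) tt

  -- The coordinate of the point of parameter s on the side V₀V₁, measured from O and with V₁ at 1.
  along : Carrier → Carrier → Carrier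
  along a s = a + s * (1# - a)

  along-0 : ∀ a → along a 0# ≡ a
  along-0 = ring 1 (λ a → a ⊕ :0 ⊗ (:1 ⊖ a) ⊜ a) tt

  along-1 : ∀ a → along a 1# ≡ 1#
  along-1 = ring 1 (λ a → a ⊕ :1 ⊗ (:1 ⊖ a) ⊜ :1) tt

  -- Positivity of the coordinates says that O is not between the two points. Endpoints 0 and 1 are
  -- allowed, so first, middle and last pieces are treated alike.
  record Stage (a s s′ : Carrier) : Set where
    constructor stage
    field
      s<s′    : s < s′
      along>0 : 0# < along a s
      along′>0 : 0# < along a s′

  along-pos : ∀ {a s} → 0# < a → InOpenUnit s → 0# < along a s
  along-pos {a} {s} 0<a (0<s , s<1) = pos-by (+-pos (*-pos (<⇒pos s<1) 0<a) 0<s)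
    (ring 2 (λ a s → (:1 ⊖ s) ⊗ a ⊕ s ⊜ a ⊕ s ⊗ (:1 ⊖ a)) tt a s)

  first-stage : ∀ {a s} → 0# < a → InOpenUnit s → Stage a 0# s
  first-stage {a} 0<a h = stage (proj₁ h) (pos-by 0<a (sym (along-0 a))) (along-pos 0<a h)

  last-stage : ∀ {a s} → 0# < a → InOpenUnit s → Stage a s 1#
  last-stage {a} 0<a h = stage (proj₂ h) (along-pos 0<a h) (pos-by 0<1 (sym (along-1 a)))

  middle-stage : ∀ {a s s′} → 0# < a → InOpenUnit s → InOpenUnit s′ → s < s′ → Stage a s s′
  middle-stage 0<a h h′ s<s′ = stage s<s′ (along-pos 0<a h) (along-pos 0<a h′)

  along-increasing : ∀ {a s s′} → a < 1# → s < s′ → along a s < along a s′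
  along-increasing {a} {s} {s′} a<1 s<s′ = <-cert (*-pos (<⇒pos s<s′) (<⇒pos a<1))
    (ring 3 (λ a s t → (t ⊖ s) ⊗ (:1 ⊖ a) ⊜ a ⊕ t ⊗ (:1 ⊖ a) ⊖ (a ⊕ s ⊗ (:1 ⊖ a))) tt a s s′)

  along-decreasing : ∀ {a s s′} → 1# < a → s < s′ → along a s′ < along a s
  along-decreasing {a} {s} {s′} 1<a s<s′ = <-cert (*-pos (<⇒pos s<s′) (<⇒pos 1<a))
    (ring 3 (λ a s t → (t ⊖ s) ⊗ (a ⊖ :1) ⊜ a ⊕ s ⊗ (:1 ⊖ a) ⊖ (a ⊕ t ⊗ (:1 ⊖ a))) tt a s s′)

  -- This is OP/OP′ for the points P and P′ of parameters s and s′; over consecutive intervals from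
  -- 0 to 1 these quotients telescope to a.
  quot : Carrier → Carrier → Carrier → Carrier
  quot a s s′ = along a s * along a s′ ⁻¹

  quot-along : ∀ {a s s′} → Stage a s s′ → quot a s s′ * along a s′ ≡ along a s
  quot-along st = sym (quotient-* (pos≢0 (Stage.along′>0 st)))

  quot<1 : ∀ {a s s′} → a < 1# → Stage a s s′ → quot a s s′ < 1#
  quot<1 {a} {s} {s′} a<1 st = pos⇒< (*-cancel-pos (Stage.along′>0 st) (pos-by (<⇒pos (along-increasing a<1 (Stage.s<s′ st)))
    (lin (quot-along st) (ring 3 (λ q x y → y ⊖ x ⊕ x ⊜ y ⊗ (:1 ⊖ q) ⊕ q ⊗ y) tt (quot a s s′) (along a s) (along a s′)))))

  1<quot : ∀ {a s s′} → 1# < a → Stage a s s′ → 1# < quot a s s′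
  1<quot {a} {s} {s′} 1<a st = pos⇒< (*-cancel-pos (Stage.along′>0 st) (pos-by (<⇒pos (along-decreasing 1<a (Stage.s<s′ st)))
    (lin (sym (quot-along st)) (ring 3 (λ q x y → x ⊖ y ⊕ q ⊗ y ⊜ y ⊗ (q ⊖ :1) ⊕ x) tt (quot a s s′) (along a s) (along a s′)))))

  first-quot : ∀ {a s} → Stage a 0# s → quot a 0# s * along a s ≡ a
  first-quot {a} st = trans (quot-along st) (along-0 a)

  last-quot : ∀ {a s} → Stage a s 1# → quot a s 1# ≡ along a s
  last-quot {a} {s} st = trans (sym (R.*-identityʳ _)) (trans (cong (quot a s 1# *_) (sym (along-1 a))) (quot-along st))

  module _ (A B C D : Point) where
    slab : (s s′ t t′ : Carrier) → Quad
    slab s s′ t t′ = quad (lerp A B s) (lerp A B s′) (lerp D C t′) (lerp D C t)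

    module _ {a b : Carrier} (o : Oriented (quad A B C D)) (h : HasRatios (quad A B C D) a b)
             {s s′ t t′ : Carrier} (hs : Stage a s s′) (ht : Stage b t t′) where
      private
        W  = quad A B C D
        t₀ = turn W 0
        t₁ = turn W 1
        t₂ = turn W 2
        t₃ = turn W 3
        σ  = sign o
        module S = Stage hs
        module T = Stage ht
        toward : ∀ {x y c} r l → x ≡ c * y → l * (x + r * (y - x)) ≡ l * along c r * y
        toward {y = y} {c} r l refl = ring 4 (λ y c r l → l ⊗ (c ⊗ y ⊕ r ⊗ (y ⊖ c ⊗ y)) ⊜ l ⊗ (c ⊕ r ⊗ (:1 ⊖ c)) ⊗ y) tt y c r l
        e₀ : turn (slab s s′ t t′) 0 ≡ (s′ - s) * along b t′ * t₀
        e₀ = trans (slab-turn₀ A B C D s s′ t t′) (toward t′ (s′ - s) (ratio₂ h))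
        e₁ : turn (slab s s′ t t′) 1 ≡ (t′ - t) * along a s′ * t₁
        e₁ = trans (slab-turn₁ A B C D s s′ t t′) (toward s′ (t′ - t) (ratio₁ h))
        e₂ : turn (slab s s′ t t′) 2 ≡ (t′ - t) * along a s * t₁
        e₂ = trans (slab-turn₂ A B C D s s′ t t′) (toward s (t′ - t) (ratio₁ h))
        e₃ : turn (slab s s′ t t′) 3 ≡ (s′ - s) * along b t * t₀
        e₃ = trans (slab-turn₃ A B C D s s′ t t′) (toward t (s′ - s) (ratio₂ h))
        signed : ∀ {x l c y} → 0# < l → 0# < c → 0# < σ * y → x ≡ l * c * y → 0# < σ * x
        signed {l = l} {c} {y} hl hc hy refl = pos-by (*-pos (*-pos hl hc) hy)
          (ring 4 (λ l c s y → l ⊗ c ⊗ (s ⊗ y) ⊜ s ⊗ (l ⊗ c ⊗ y)) tt l c σ y)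

      slab-oriented : Oriented (slab s s′ t t′)
      slab-oriented = oriented σ
        (signed (<⇒pos S.s<s′) T.along′>0 (turn-pos o 0) e₀) (signed (<⇒pos T.s<s′) S.along′>0 (turn-pos o 1) e₁)
        (signed (<⇒pos T.s<s′) S.along>0 (turn-pos o 1) e₂) (signed (<⇒pos S.s<s′) T.along>0 (turn-pos o 0) e₃)

      -- The two turns that are compared share a factor s′ - s or t′ - t and a turn of the whole
      -- quadrangle; only the coordinates measured from O remain.
      slab-ratios : ∀ {c d} → c * along a s′ ≡ along a s → d * along b t′ ≡ along b t → HasRatios (slab s s′ t t′) c d
      slab-ratios {c} {d} hc hd = ratios (step c e₂ e₁ hc) (step d e₃ e₀ hd)
        where
        step : ∀ {x y l u v w} c → x ≡ l * v * w → y ≡ l * u * w → c * u ≡ v → x ≡ c * y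
        step {l = l} {u} {v} {w} c refl refl refl = ring 4 (λ l u w c → l ⊗ (c ⊗ u) ⊗ w ⊜ c ⊗ (l ⊗ u ⊗ w)) tt l u w c

      piece⇒ratios : ∀ {Q} → Generic Q → IsAffineImageOf (slab s s′ t t′) Q → RatiosOf Q (quot a s s′) (quot b t t′)
      piece⇒ratios g im = image⇒ratios slab-oriented (orientation g) (slab-ratios (quot-along hs) (quot-along ht)) im

      ratios⇒piece : ∀ {Q c d} → Generic Q → c * along a s′ ≡ along a s → d * along b t′ ≡ along b t → RatiosOf Q c d →
        IsAffineImageOf (slab s s′ t t′) Q
      ratios⇒piece g hc hd r = ratios⇒image slab-oriented g (slab-ratios hc hd) r

  -- Inverse of `along a`: the parameter of the point with coordinate x.
  at : Carrier → Carrier → Carrier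
  at a x = (x - a) * (1# - a) ⁻¹

  along-at : ∀ {a x} → a ≢ 1# → along a (at a x) ≡ x
  along-at {a} {x} a≢1 = lin (cong ((x - a) *_) (⁻¹-inverseʳ (-≢0 (a≢1 ∘ sym))))
    (ring 3 (λ a x i → a ⊕ (x ⊖ a) ⊗ i ⊗ (:1 ⊖ a) ⊕ (x ⊖ a) ⊗ :1 ⊜ x ⊕ (x ⊖ a) ⊗ ((:1 ⊖ a) ⊗ i)) tt a x ((1# - a) ⁻¹))

  at-increasing : ∀ {a x y} → a < 1# → x < y → at a x < at a y
  at-increasing {a} {x} {y} a<1 x<y = <-cert (*-pos (<⇒pos x<y) (⁻¹-pos (<⇒pos a<1)))
    (ring 4 (λ a x y i → (y ⊖ x) ⊗ i ⊜ (y ⊖ a) ⊗ i ⊖ (x ⊖ a) ⊗ i) tt a x y ((1# - a) ⁻¹))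

  Between : Carrier → Carrier → Set
  Between a x = ((a < x) × (x < 1#)) ⊎ ((x < a) × (1# < x))

  between⇒≢1 : ∀ {a x} → Between a x → a ≢ 1#
  between⇒≢1 (inj₁ (h , h′)) = <⇒≢ (<-trans h h′)
  between⇒≢1 (inj₂ (h , h′)) = >⇒≢ (<-trans h′ h)

  between⇒unit : ∀ {a x} → Between a x → InOpenUnit (at a x)
  between⇒unit {a} {x} (inj₁ (a<x , x<1)) = *-pos (<⇒pos a<x) 0<i , <-cert (*-pos (<⇒pos x<1) 0<i)
      (lin (⁻¹-inverseʳ (pos≢0 (<⇒pos a<1))) (ring 3 (λ a x i → (:1 ⊖ x) ⊗ i ⊕ :1 ⊜ :1 ⊖ (x ⊖ a) ⊗ i ⊕ (:1 ⊖ a) ⊗ i) tt a x ((1# - a) ⁻¹)))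
    where
    a<1 = <-trans a<x x<1
    0<i = ⁻¹-pos (<⇒pos a<1)
  between⇒unit {a} {x} (inj₂ (x<a , 1<x)) =
      pos-by (*-pos (<⇒pos x<a) 0<-i) (ring 3 (λ a x i → (a ⊖ x) ⊗ ⊝ i ⊜ (x ⊖ a) ⊗ i) tt a x i) ,
      <-cert (*-pos (<⇒pos 1<x) 0<-i) (lin inv (ring 3 (λ a x i → (x ⊖ :1) ⊗ ⊝ i ⊕ :1 ⊜ :1 ⊖ (x ⊖ a) ⊗ i ⊕ (:1 ⊖ a) ⊗ i) tt a x i))
    where
    i = (1# - a) ⁻¹
    1<a = <-trans 1<x x<a
    inv : (1# - a) * i ≡ 1#
    inv = ⁻¹-inverseʳ (-≢0 (<⇒≢ 1<a))
    0<-i : 0# < - i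
    0<-i = *-cancel-pos (<⇒pos 1<a) (pos-by 0<1 (trans (sym inv) (ring 2 (λ a i → (:1 ⊖ a) ⊗ i ⊜ (a ⊖ :1) ⊗ ⊝ i) tt a i)))

  first-at : ∀ {a x y} → a ≢ 1# → x * y ≡ a → x * along a (at a y) ≡ along a 0#
  first-at {a} {x} a≢1 e = trans (cong (x *_) (along-at a≢1)) (trans e (sym (along-0 a)))

  middle-at : ∀ {a x y} → a ≢ 1# → x * along a (at a y) ≡ along a (at a (x * y))
  middle-at {a} {x} a≢1 = trans (cong (x *_) (along-at a≢1)) (sym (along-at a≢1))

  last-at : ∀ {a x} → a ≢ 1# → x * along a 1# ≡ along a (at a x)
  last-at {a} {x} a≢1 = trans (cong (x *_) (along-1 a)) (trans (R.*-identityʳ x) (sym (along-at a≢1)))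

  -- Dissections as factorizations of pairs

  DissectionA : Quad → Point → Point → Point → Point → Set
  DissectionA Q A B C D =
    Σ Carrier λ s₁ → Σ Carrier λ s₂ → Σ Carrier λ t₁ → Σ Carrier λ t₂ →
    let P₁ = lerp A B s₁ ; P₂ = lerp A B s₂
        Q₁ = lerp D C t₁ ; Q₂ = lerp D C t₂ in
      InOpenUnit s₁ × InOpenUnit s₂ × InOpenUnit t₁ × InOpenUnit t₂
    × s₁ < s₂ × t₁ < t₂
    × IsAffineImageOf (quad A P₁ Q₁ D) Q
    × IsAffineImageOf (quad P₁ P₂ Q₂ Q₁) Q
    × IsAffineImageOf (quad P₂ B C Q₂) Q

  DissectionB : Quad → Point → Point → Point → Point → Set
  DissectionB Q A B C D =
    Σ Carrier λ s → Σ Carrier λ t → Σ Carrier λ r → Σ Carrier λ u →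
    let P = lerp A B s ; Q′ = lerp D C t ; R = lerp P Q′ r in
      InOpenUnit s × InOpenUnit t × InOpenUnit r × InOpenUnit u
    × ( ( IsAffineImageOf (quad P B C Q′) Q
        × IsAffineImageOf (quad A P R (lerp A D u)) Q
        × IsAffineImageOf (quad (lerp A D u) R Q′ D) Q )
      ⊎ ( IsAffineImageOf (quad A P Q′ D) Q
        × IsAffineImageOf (quad P B (lerp B C u) R) Q
        × IsAffineImageOf (quad R (lerp B C u) C Q′) Q ) )

  -- The pieces share the point O with the whole, hence all factors lie on one side of 1. Recording
  -- this in `side` rules out factorizations that mix pairs below and above 1.
  record ChainA (Q : Quad) (a b : Carrier) : Set where
    field
      {a₁ a₂ a₃ b₁ b₂ b₃} : Carrier
      a-product : a₁ * a₂ * a₃ ≡ a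
      b-product : b₁ * b₂ * b₃ ≡ b
      ratios₁ : RatiosOf Q a₁ b₁
      ratios₂ : RatiosOf Q a₂ b₂
      ratios₃ : RatiosOf Q a₃ b₃
      side : (Below a₁ b₁ × Below a₂ b₂ × Below a₃ b₃) ⊎ (Above a₁ b₁ × Above a₂ b₂ × Above a₃ b₃)

  -- m′, n′ are the ratios on the other pair of sides of the quadrangle with ratios m, n.
  record Transverse (Q : Quad) (m n : Carrier) : Set where
    field
      {m′ n′ a₁ a₂ b₁ b₂} : Carrier
      0<m′ : 0# < m′
      0<n′ : 0# < n′
      n′-def : n′ * (1# - n) ≡ 1# - m
      m′-def : m * m′ ≡ n * n′
      a-product : a₁ * a₂ ≡ m′
      b-product : b₁ * b₂ ≡ n′
      ratios₁ : RatiosOf Q a₁ b₁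
      ratios₂ : RatiosOf Q a₂ b₂
      side : (Below a₁ b₁ × Below a₂ b₂) ⊎ (Above a₁ b₁ × Above a₂ b₂)

  -- The pair (u, v) belongs to the piece cut off first and (m, n) to the remainder. The remainder
  -- need not be an image of `Q`, so positivity of m and n is recorded separately.
  record ChainB (Q : Quad) (a b : Carrier) : Set where
    field
      {m n u v} : Carrier
      0<m : 0# < m
      0<n : 0# < n
      a-product : m * u ≡ a
      b-product : n * v ≡ b
      outer : RatiosOf Q u v
      inner : Transverse Q m n
      side : (Below m n × Below u v) ⊎ (Above m n × Above u v)

  product<1 : ∀ {x y z} → 0# < x → 0# < y → x < 1# → y < 1# → x * y ≡ z → z < y
  product<1 {x} {y} hx hy x<1 y<1 refl = <-cert (*-pos (<⇒pos x<1) hy) (ring 2 (λ x y → (:1 ⊖ x) ⊗ y ⊜ y ⊖ x ⊗ y) tt x y)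

  product>1 : ∀ {x y z} → 1# < x → 1# < y → x * y ≡ z → y < z
  product>1 {x} {y} 1<x 1<y refl = <-cert (*-pos (<⇒pos 1<x) (<-trans 0<1 1<y)) (ring 2 (λ x y → (x ⊖ :1) ⊗ y ⊜ x ⊗ y ⊖ y) tt x y)

  product-between : ∀ {x y z} → 0# < x → 0# < y → x * y ≡ z →
    ((x < 1#) × (y < 1#)) ⊎ ((1# < x) × (1# < y)) → Between z y
  product-between hx hy e (inj₁ (x<1 , y<1)) = inj₁ (product<1 hx hy x<1 y<1 e , y<1)
  product-between hx hy e (inj₂ (1<x , 1<y)) = inj₂ (product>1 1<x 1<y e , 1<y)

  product₃>1 : ∀ {x y z w} → 1# < x → 1# < y → 1# < z → x * y * z ≡ w → 1# < w
  product₃>1 hx hy hz e = <-trans hz (product>1 (<-trans hy (product>1 hx hy refl)) hz e)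

  module _ {Q : Quad} (g : Generic Q) where

    below : ∀ {a b} → RatiosOf Q a b → a < 1# → Below a b
    below r a<1 with RatiosOf-side g r
    ... | inj₁ h = h
    ... | inj₂ (1<a , _) = ⊥-elim (<-asym a<1 1<a)

    above : ∀ {a b} → RatiosOf Q a b → 1# < a → Above a b
    above r 1<a with RatiosOf-side g r
    ... | inj₁ (a<1 , _) = ⊥-elim (<-asym a<1 1<a)
    ... | inj₂ h = h

    dissectionA⇒chain : ∀ A B C D {a b} → Oriented (quad A B C D) → HasRatios (quad A B C D) a b → RatiosOf Q a b →
      DissectionA Q A B C D → ChainA Q a b
    dissectionA⇒chain A B C D {a} {b} o h r (s₁ , s₂ , t₁ , t₂ , us₁ , us₂ , ut₁ , ut₂ , s₁<s₂ , t₁<t₂ , i₁ , i₂ , i₃) = record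
      { a-product = product 0<a us₁ us₂ s₁<s₂ ; b-product = product 0<b ut₁ ut₂ t₁<t₂
      ; ratios₁ = r₁ ; ratios₂ = r₂ ; ratios₃ = r₃ ; side = side (RatiosOf-side g r) }
      where
      0<a = proj₁ (RatiosOf-pos g r)
      0<b = proj₂ (RatiosOf-pos g r)
      S₁ : Stage a 0# s₁
      S₁ = first-stage 0<a us₁
      S₂ : Stage a s₁ s₂
      S₂ = middle-stage 0<a us₁ us₂ s₁<s₂
      S₃ : Stage a s₂ 1#
      S₃ = last-stage 0<a us₂
      T₁ : Stage b 0# t₁
      T₁ = first-stage 0<b ut₁
      T₂ : Stage b t₁ t₂
      T₂ = middle-stage 0<b ut₁ ut₂ t₁<t₂
      T₃ : Stage b t₂ 1#
      T₃ = last-stage 0<b ut₂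
      i₁′ : IsAffineImageOf (slab A B C D 0# s₁ 0# t₁) Q
      i₁′ = subst₂ (λ x y → IsAffineImageOf (quad x (lerp A B s₁) (lerp D C t₁) y) Q) (sym (lerp-0 A B)) (sym (lerp-0 D C)) i₁
      i₃′ : IsAffineImageOf (slab A B C D s₂ 1# t₂ 1#) Q
      i₃′ = subst₂ (λ x y → IsAffineImageOf (quad (lerp A B s₂) x y (lerp D C t₂)) Q) (sym (lerp-1 A B)) (sym (lerp-1 D C)) i₃
      r₁ : RatiosOf Q (quot a 0# s₁) (quot b 0# t₁)
      r₁ = piece⇒ratios A B C D o h S₁ T₁ g i₁′
      r₂ : RatiosOf Q (quot a s₁ s₂) (quot b t₁ t₂)
      r₂ = piece⇒ratios A B C D o h S₂ T₂ g i₂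
      r₃ : RatiosOf Q (quot a s₂ 1#) (quot b t₂ 1#)
      r₃ = piece⇒ratios A B C D o h S₃ T₃ g i₃′
      product : ∀ {a s s′} → 0# < a → InOpenUnit s → InOpenUnit s′ → s < s′ → quot a 0# s * quot a s s′ * quot a s′ 1# ≡ a
      product {a} {s} {s′} 0<a us us′ s<s′ = trans (cong (quot a 0# s * quot a s s′ *_) (last-quot (last-stage 0<a us′)))
        (trans (R.*-assoc _ _ _) (trans (cong (quot a 0# s *_) (quot-along (middle-stage 0<a us us′ s<s′))) (first-quot (first-stage 0<a us))))
      side : Below a b ⊎ Above a b →
        (Below (quot a 0# s₁) (quot b 0# t₁) × Below (quot a s₁ s₂) (quot b t₁ t₂) × Below (quot a s₂ 1#) (quot b t₂ 1#)) ⊎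
        (Above (quot a 0# s₁) (quot b 0# t₁) × Above (quot a s₁ s₂) (quot b t₁ t₂) × Above (quot a s₂ 1#) (quot b t₂ 1#))
      side (inj₁ (a<1 , _)) = inj₁ (below r₁ (quot<1 a<1 S₁) , below r₂ (quot<1 a<1 S₂) , below r₃ (quot<1 a<1 S₃))
      side (inj₂ (1<a , _)) = inj₂ (above r₁ (1<quot 1<a S₁) , above r₂ (1<quot 1<a S₂) , above r₃ (1<quot 1<a S₃))

    chain⇒dissectionA : ∀ A B C D {a b} → Oriented (quad A B C D) → HasRatios (quad A B C D) a b → Below a b →
      ChainA Q a b → DissectionA Q A B C D
    chain⇒dissectionA A B C D {a} {b} o h (a<1 , b<1) ch with ChainA.side ch
    ... | inj₂ (A₁ , A₂ , A₃) = ⊥-elim (<-asym a<1 (product₃>1 (proj₁ A₁) (proj₁ A₂) (proj₁ A₃) (ChainA.a-product ch)))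
    ... | inj₁ (B₁ , B₂ , B₃) =
      s₁ , s₂ , t₁ , t₂ , us₁ , us₂ , ut₁ , ut₂ , s₁<s₂ , t₁<t₂ ,
      subst₂ (λ x y → IsAffineImageOf (quad x (lerp A B s₁) (lerp D C t₁) y) Q) (lerp-0 A B) (lerp-0 D C) i₁ ,
      i₂ ,
      subst₂ (λ x y → IsAffineImageOf (quad (lerp A B s₂) x y (lerp D C t₂)) Q) (lerp-1 A B) (lerp-1 D C) i₃
      where
      open ChainA ch
      a≢1 = <⇒≢ a<1
      b≢1 = <⇒≢ b<1
      0<a₁ = proj₁ (RatiosOf-pos g ratios₁)
      0<a₂ = proj₁ (RatiosOf-pos g ratios₂)
      0<a₃ = proj₁ (RatiosOf-pos g ratios₃)
      0<b₁ = proj₂ (RatiosOf-pos g ratios₁)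
      0<b₂ = proj₂ (RatiosOf-pos g ratios₂)
      0<b₃ = proj₂ (RatiosOf-pos g ratios₃)
      0<a = proj₁ (ratios-positive o h)
      0<b = proj₂ (ratios-positive o h)
      -- Coordinates of the cut points: the last piece ends at 1 and therefore starts at a₃, the
      -- middle one starts at a₂a₃.
      x₁ = a₂ * a₃
      x₂ = a₃
      y₁ = b₂ * b₃
      y₂ = b₃
      ax : a₁ * x₁ ≡ a
      ax = trans (sym (R.*-assoc a₁ a₂ a₃)) a-product
      by′ : b₁ * y₁ ≡ b
      by′ = trans (sym (R.*-assoc b₁ b₂ b₃)) b-product
      x₁<x₂ = product<1 0<a₂ 0<a₃ (proj₁ B₂) (proj₁ B₃) refl
      y₁<y₂ = product<1 0<b₂ 0<b₃ (proj₂ B₂) (proj₂ B₃) refl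
      x₁<1 = <-trans x₁<x₂ (proj₁ B₃)
      y₁<1 = <-trans y₁<y₂ (proj₂ B₃)
      a<x₁ = product<1 0<a₁ (*-pos 0<a₂ 0<a₃) (proj₁ B₁) x₁<1 ax
      b<y₁ = product<1 0<b₁ (*-pos 0<b₂ 0<b₃) (proj₂ B₁) y₁<1 by′
      s₁ = at a x₁
      s₂ = at a x₂
      t₁ = at b y₁
      t₂ = at b y₂
      us₁ : InOpenUnit s₁
      us₁ = between⇒unit (inj₁ (a<x₁ , x₁<1))
      us₂ : InOpenUnit s₂
      us₂ = between⇒unit (inj₁ (<-trans a<x₁ x₁<x₂ , proj₁ B₃))
      ut₁ : InOpenUnit t₁
      ut₁ = between⇒unit (inj₁ (b<y₁ , y₁<1))
      ut₂ : InOpenUnit t₂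
      ut₂ = between⇒unit (inj₁ (<-trans b<y₁ y₁<y₂ , proj₂ B₃))
      s₁<s₂ : s₁ < s₂
      s₁<s₂ = at-increasing a<1 x₁<x₂
      t₁<t₂ : t₁ < t₂
      t₁<t₂ = at-increasing b<1 y₁<y₂
      i₁ : IsAffineImageOf (slab A B C D 0# s₁ 0# t₁) Q
      i₁ = ratios⇒piece A B C D o h (first-stage 0<a us₁) (first-stage 0<b ut₁) g (first-at a≢1 ax) (first-at b≢1 by′) ratios₁
      i₂ : IsAffineImageOf (slab A B C D s₁ s₂ t₁ t₂) Q
      i₂ = ratios⇒piece A B C D o h (middle-stage 0<a us₁ us₂ s₁<s₂) (middle-stage 0<b ut₁ ut₂ t₁<t₂) g (middle-at a≢1) (middle-at b≢1) ratios₂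
      i₃ : IsAffineImageOf (slab A B C D s₂ 1# t₂ 1#) Q
      i₃ = ratios⇒piece A B C D o h (last-stage 0<a us₂) (last-stage 0<b ut₂) g (last-at a≢1) (last-at b≢1) ratios₃

  rotate-image : ∀ {A B C D} Q → IsAffineImageOf (quad A B C D) Q → IsAffineImageOf (quad B C D A) Q
  rotate-image {A} {B} {C} {D} Q (f , im) = f , image-rlʳ f Q (quad A B C D) 1F true im

  unrotate-image : ∀ {A B C D} Q → IsAffineImageOf (quad B C D A) Q → IsAffineImageOf (quad A B C D) Q
  unrotate-image {A} {B} {C} {D} Q (f , im) = f , image-rlʳ f Q (quad B C D A) 3F true im

  rotate-oriented : ∀ {A B C D} → Oriented (quad A B C D) → Oriented (quad B C D A)
  rotate-oriented (σ by h) = oriented σ (h 1) (h 2) (h 3) (h 0)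

  module _ {Q : Quad} (g : Generic Q) where

    module _ (K L M N : Point) {m n : Carrier} (o : Oriented (quad K L M N)) (h : HasRatios (quad K L M N) m n) where
      private
        t = turn (quad K L M N)

      -- With t₀ = n′t₁ and t₃ = m′t₂ the two defining equations are `ratio-balance` and the
      -- equality of t₃ = m′mt₁ with t₃ = nn′t₁.
      transverse-ratios : ∀ {m′ n′} → n ≢ 1# → n′ * (1# - n) ≡ 1# - m → m * m′ ≡ n * n′ → HasRatios (quad L M N K) m′ n′
      transverse-ratios {m′} {n′} n≢1 n′-def m′-def = ratios e₃ e₀
        where
        e₀ : t 0 ≡ n′ * t 1
        e₀ = *-cancelˡ (-≢0 (n≢1 ∘ sym)) (lin (cong₂ _+_ (ratio-balance h) (cong (t 1 *_) (sym n′-def)))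
          (ring 5 (λ a b m n n′ → (:1 ⊖ n) ⊗ a ⊕ (b ⊗ (:1 ⊖ m) ⊕ b ⊗ (n′ ⊗ (:1 ⊖ n))) ⊜
            (:1 ⊖ n) ⊗ (n′ ⊗ b) ⊕ (a ⊗ (:1 ⊖ n) ⊕ b ⊗ (:1 ⊖ m))) tt (t 0) (t 1) m n n′))
        e₃ : t 3 ≡ m′ * t 2
        e₃ = lin (cong₂ _+_ (cong₂ _+_ (ratio₂ h) (cong (n *_) e₀)) (cong₂ _+_ (cong (t 1 *_) (sym m′-def)) (cong (m′ *_) (sym (ratio₁ h)))))
          (ring 8 (λ a b c d m n m′ n′ → d ⊕ (n ⊗ a ⊕ n ⊗ (n′ ⊗ b) ⊕ (b ⊗ (m ⊗ m′) ⊕ m′ ⊗ c)) ⊜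
            m′ ⊗ c ⊕ (d ⊕ n ⊗ a ⊕ (b ⊗ (n ⊗ n′) ⊕ m′ ⊗ (m ⊗ b)))) tt (t 0) (t 1) (t 2) (t 3) m n m′ n′)

      private
        m′ = t 3 * t 2 ⁻¹
        n′ = t 0 * t 1 ⁻¹
        h′ : HasRatios (quad L M N K) m′ n′
        h′ = ratios (quotient-* (turn≢0 o 2)) (quotient-* (turn≢0 o 1))
        o′ : Oriented (quad L M N K)
        o′ = rotate-oriented o
        n′-def : n′ * (1# - n) ≡ 1# - m
        n′-def = *-cancelˡ (turn≢0 o 1) (lin (cong₂ _+_ (ratio-balance h) (cong (_* (1# - n)) (sym (ratio₂ h′))))
          (ring 5 (λ a b m n n′ → b ⊗ (n′ ⊗ (:1 ⊖ n)) ⊕ (b ⊗ (:1 ⊖ m) ⊕ a ⊗ (:1 ⊖ n)) ⊜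
            b ⊗ (:1 ⊖ m) ⊕ (a ⊗ (:1 ⊖ n) ⊕ n′ ⊗ b ⊗ (:1 ⊖ n))) tt (t 0) (t 1) m n n′))
        m′-def : m * m′ ≡ n * n′
        m′-def = *-cancelˡ (turn≢0 o 1) (lin (cong₂ _+_ (cong₂ _+_ (cong (m′ *_) (sym (ratio₁ h))) (sym (ratio₁ h′)))
            (cong₂ _+_ (ratio₂ h) (cong (n *_) (ratio₂ h′))))
          (ring 8 (λ a b c d m n m′ n′ → b ⊗ (m ⊗ m′) ⊕ (m′ ⊗ c ⊕ d ⊕ (n ⊗ a ⊕ n ⊗ (n′ ⊗ b))) ⊜
            b ⊗ (n ⊗ n′) ⊕ (m′ ⊗ (m ⊗ b) ⊕ m′ ⊗ c ⊕ (d ⊕ n ⊗ a))) tt (t 0) (t 1) (t 2) (t 3) m n m′ n′))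
        0<m′ = proj₁ (ratios-positive o′ h′)
        0<n′ = proj₂ (ratios-positive o′ h′)

      -- The second cut joins LM to KN, so its two pieces are slabs of the rotated quadrangle LMNK.
      cut⇒transverse : ∀ r u → InOpenUnit r → InOpenUnit u →
        IsAffineImageOf (quad K L (lerp L M r) (lerp K N u)) Q → IsAffineImageOf (quad (lerp K N u) (lerp L M r) M N) Q →
        Transverse Q m n
      cut⇒transverse r u ur uu i₁ i₂ = record
        { 0<m′ = 0<m′ ; 0<n′ = 0<n′ ; n′-def = n′-def ; m′-def = m′-def
        ; a-product = product S₁ S₂ ; b-product = product T₁ T₂ ; ratios₁ = r₁ ; ratios₂ = r₂ ; side = side }
        where
        S₁ : Stage m′ 0# r
        S₁ = first-stage 0<m′ ur
        S₂ : Stage m′ r 1#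
        S₂ = last-stage 0<m′ ur
        T₁ : Stage n′ 0# u
        T₁ = first-stage 0<n′ uu
        T₂ : Stage n′ u 1#
        T₂ = last-stage 0<n′ uu
        i₁′ : IsAffineImageOf (slab L M N K 0# r 0# u) Q
        i₁′ = subst₂ (λ x y → IsAffineImageOf (quad x (lerp L M r) (lerp K N u) y) Q) (sym (lerp-0 L M)) (sym (lerp-0 K N))
          (rotate-image Q i₁)
        i₂′ : IsAffineImageOf (slab L M N K r 1# u 1#) Q
        i₂′ = subst₂ (λ x y → IsAffineImageOf (quad (lerp L M r) x y (lerp K N u)) Q) (sym (lerp-1 L M)) (sym (lerp-1 K N))
          (rotate-image Q i₂)
        r₁ : RatiosOf Q (quot m′ 0# r) (quot n′ 0# u)
        r₁ = piece⇒ratios L M N K o′ h′ S₁ T₁ g i₁′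
        r₂ : RatiosOf Q (quot m′ r 1#) (quot n′ u 1#)
        r₂ = piece⇒ratios L M N K o′ h′ S₂ T₂ g i₂′
        product : ∀ {a s} → Stage a 0# s → Stage a s 1# → quot a 0# s * quot a s 1# ≡ a
        product {a} {s} st st′ = trans (cong (quot a 0# s *_) (last-quot st′)) (first-quot st)
        side : (Below (quot m′ 0# r) (quot n′ 0# u) × Below (quot m′ r 1#) (quot n′ u 1#)) ⊎
               (Above (quot m′ 0# r) (quot n′ 0# u) × Above (quot m′ r 1#) (quot n′ u 1#))
        side with compare m′ 1#
        ... | tri< lt _ _ = inj₁ (below g r₁ (quot<1 lt S₁) , below g r₂ (quot<1 lt S₂))
        ... | tri> _ _ gt = inj₂ (above g r₁ (1<quot gt S₁) , above g r₂ (1<quot gt S₂))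
        -- The remainder could a priori be a trapezoid. With parallel sides LM and KN the first
        -- piece would have ratio 1 as well, which an image of `Q` cannot have.
        ... | tri≈ _ e _ = ⊥-elim (RatiosOf-≢1 g r₁ (lin
            (cong₂ _+_ (first-quot S₁) (cong (_* (1# - quot m′ 0# r * (1# - r))) e))
            (ring 3 (λ q a r → q ⊕ (a ⊕ :1 ⊗ (:1 ⊖ q ⊗ (:1 ⊖ r))) ⊜ :1 ⊕ (q ⊗ (a ⊕ r ⊗ (:1 ⊖ a)) ⊕ a ⊗ (:1 ⊖ q ⊗ (:1 ⊖ r)))) tt (quot m′ 0# r) m′ r)))

      transverse⇒cut : n ≢ 1# → Transverse Q m n → Σ Carrier λ r → Σ Carrier λ u → InOpenUnit r × InOpenUnit u ×
        IsAffineImageOf (quad K L (lerp L M r) (lerp K N u)) Q × IsAffineImageOf (quad (lerp K N u) (lerp L M r) M N) Q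
      transverse⇒cut n≢1 tr = r , u , ur , uu ,
          unrotate-image Q (subst₂ (λ x y → IsAffineImageOf (quad x (lerp L M r) (lerp K N u) y) Q) (lerp-0 L M) (lerp-0 K N) i₁) ,
          unrotate-image Q (subst₂ (λ x y → IsAffineImageOf (quad (lerp L M r) x y (lerp K N u)) Q) (lerp-1 L M) (lerp-1 K N) i₂)
        where
        module T = Transverse tr
        open T using (a₁; a₂; b₁; b₂)
        r = at T.m′ a₂
        u = at T.n′ b₂
        hT : HasRatios (quad L M N K) T.m′ T.n′
        hT = transverse-ratios n≢1 T.n′-def T.m′-def
        splitᵃ : Between T.m′ a₂
        splitᵃ = product-between (proj₁ (RatiosOf-pos g T.ratios₁)) (proj₁ (RatiosOf-pos g T.ratios₂)) T.a-product
          (Sum.map (Product.map proj₁ proj₁) (Product.map proj₁ proj₁) T.side)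
        splitᵇ : Between T.n′ b₂
        splitᵇ = product-between (proj₂ (RatiosOf-pos g T.ratios₁)) (proj₂ (RatiosOf-pos g T.ratios₂)) T.b-product
          (Sum.map (Product.map proj₂ proj₂) (Product.map proj₂ proj₂) T.side)
        ur : InOpenUnit r
        ur = between⇒unit splitᵃ
        uu : InOpenUnit u
        uu = between⇒unit splitᵇ
        i₁ : IsAffineImageOf (slab L M N K 0# r 0# u) Q
        i₁ = ratios⇒piece L M N K o′ hT (first-stage T.0<m′ ur) (first-stage T.0<n′ uu) g
          (first-at (between⇒≢1 splitᵃ) T.a-product) (first-at (between⇒≢1 splitᵇ) T.b-product) T.ratios₁
        i₂ : IsAffineImageOf (slab L M N K r 1# u 1#) Q
        i₂ = ratios⇒piece L M N K o′ hT (last-stage T.0<m′ ur) (last-stage T.0<n′ uu) g (last-at (between⇒≢1 splitᵃ)) (last-at (between⇒≢1 splitᵇ)) T.ratios₂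

    module _ (A B C D : Point) {a b : Carrier} (o : Oriented (quad A B C D)) (h : HasRatios (quad A B C D) a b) where
      private
        0<a = proj₁ (ratios-positive o h)
        0<b = proj₂ (ratios-positive o h)

        left-oriented : ∀ {s t} → Stage a 0# s → Stage b 0# t → Oriented (quad A (lerp A B s) (lerp D C t) D)
        left-oriented {s} {t} S T = subst₂ (λ x y → Oriented (quad x (lerp A B s) (lerp D C t) y)) (lerp-0 A B) (lerp-0 D C)
          (slab-oriented A B C D o h S T)

        left-ratios : ∀ {s t m n} → Stage a 0# s → Stage b 0# t → m * along a s ≡ a → n * along b t ≡ b →
          HasRatios (quad A (lerp A B s) (lerp D C t) D) m n
        left-ratios {s} {t} {m} {n} S T e e′ = subst₂ (λ x y → HasRatios (quad x (lerp A B s) (lerp D C t) y) m n) (lerp-0 A B) (lerp-0 D C)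
          (slab-ratios A B C D o h S T (trans e (sym (along-0 a))) (trans e′ (sym (along-0 b))))

        right-oriented : ∀ {s t} → Stage a s 1# → Stage b t 1# → Oriented (quad (lerp A B s) B C (lerp D C t))
        right-oriented {s} {t} S T = subst₂ (λ x y → Oriented (quad (lerp A B s) x y (lerp D C t))) (lerp-1 A B) (lerp-1 D C)
          (slab-oriented A B C D o h S T)

        right-ratios : ∀ {s t} → Stage a s 1# → Stage b t 1# → HasRatios (quad (lerp A B s) B C (lerp D C t)) (along a s) (along b t)
        right-ratios {s} {t} S T = subst₂ (λ x y → HasRatios (quad (lerp A B s) x y (lerp D C t)) (along a s) (along b t)) (lerp-1 A B) (lerp-1 D C)
          (slab-ratios A B C D o h S T (trans (cong (along a s *_) (along-1 a)) (R.*-identityʳ _)) (trans (cong (along b t *_) (along-1 b)) (R.*-identityʳ _)))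

        sides : ∀ {s t} → Stage a 0# s → Stage a s 1# → Stage b 0# t → Stage b t 1# → Below a b ⊎ Above a b →
          (Below (quot a 0# s) (quot b 0# t) × Below (along a s) (along b t)) ⊎ (Above (quot a 0# s) (quot b 0# t) × Above (along a s) (along b t))
        sides S S′ T T′ (inj₁ (a<1 , b<1)) = inj₁ ((quot<1 a<1 S , quot<1 b<1 T) ,
          subst (_< 1#) (last-quot S′) (quot<1 a<1 S′) , subst (_< 1#) (last-quot T′) (quot<1 b<1 T′))
        sides S S′ T T′ (inj₂ (1<a , 1<b)) = inj₂ ((1<quot 1<a S , 1<quot 1<b T) ,
          subst (1# <_) (last-quot S′) (1<quot 1<a S′) , subst (1# <_) (last-quot T′) (1<quot 1<b T′))

      dissectionB⇒chain : RatiosOf Q a b → DissectionB Q A B C D → ChainB Q a b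
      dissectionB⇒chain ab (s , t , r , u , us , ut , ur , uu , pieces) = go pieces
        where
        S : Stage a 0# s
        S = first-stage 0<a us
        S′ : Stage a s 1#
        S′ = last-stage 0<a us
        T : Stage b 0# t
        T = first-stage 0<b ut
        T′ : Stage b t 1#
        T′ = last-stage 0<b ut
        oL = left-oriented S T
        hL = left-ratios S T (first-quot S) (first-quot T)
        oR = right-oriented S′ T′
        hR = right-ratios S′ T′
        P = lerp A B s
        Q′ = lerp D C t
        go : _ → ChainB Q a b
        go (inj₁ (i , i₁ , i₂)) = record
          { 0<m = proj₁ (ratios-positive oL hL) ; 0<n = proj₂ (ratios-positive oL hL)
          ; a-product = first-quot S ; b-product = first-quot T
          ; outer = image⇒ratios oR (orientation g) hR i
          ; inner = cut⇒transverse A P Q′ D oL hL r u ur uu i₁ i₂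
          ; side = sides S S′ T T′ (RatiosOf-side g ab) }
        -- Now the remainder is PBCQ′. The first cut is its side KN instead of LM, so `r` and `u`
        -- exchange their roles.
        go (inj₂ (i , i₁ , i₂)) = record
          { 0<m = proj₁ (ratios-positive oR hR) ; 0<n = proj₂ (ratios-positive oR hR)
          ; a-product = trans (R.*-comm _ _) (first-quot S) ; b-product = trans (R.*-comm _ _) (first-quot T)
          ; outer = image⇒ratios oL (orientation g) hL i
          ; inner = cut⇒transverse P B C Q′ oR hR u r uu ur i₁ i₂
          ; side = Sum.map Product.swap Product.swap (sides S S′ T T′ (RatiosOf-side g ab)) }

      -- The factors commute, so the remainder may always be placed next to V₀V₃; the first
      -- alternative of the dissection suffices.
      chain⇒dissectionB : ChainB Q a b → DissectionB Q A B C D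
      chain⇒dissectionB ch = s , t , proj₁ cut , proj₁ (proj₂ cut) , us , ut , proj₁ (proj₂ (proj₂ cut)) , proj₁ (proj₂ (proj₂ (proj₂ cut))) ,
          inj₁ (i , proj₂ (proj₂ (proj₂ (proj₂ cut))))
        where
        open ChainB ch
        s = at a u
        t = at b v
        splitᵃ : Between a u
        splitᵃ = product-between 0<m (proj₁ (RatiosOf-pos g outer)) a-product
          (Sum.map (Product.map proj₁ proj₁) (Product.map proj₁ proj₁) side)
        splitᵇ : Between b v
        splitᵇ = product-between 0<n (proj₂ (RatiosOf-pos g outer)) b-product
          (Sum.map (Product.map proj₂ proj₂) (Product.map proj₂ proj₂) side)
        n≢1 : n ≢ 1#
        n≢1 with side
        ... | inj₁ (x , _) = <⇒≢ (proj₂ x)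
        ... | inj₂ (x , _) = >⇒≢ (proj₂ x)
        us : InOpenUnit s
        us = between⇒unit splitᵃ
        ut : InOpenUnit t
        ut = between⇒unit splitᵇ
        as : along a s ≡ u
        as = along-at (between⇒≢1 splitᵃ)
        bt : along b t ≡ v
        bt = along-at (between⇒≢1 splitᵇ)
        oL : Oriented (quad A (lerp A B s) (lerp D C t) D)
        oL = left-oriented (first-stage 0<a us) (first-stage 0<b ut)
        hL : HasRatios (quad A (lerp A B s) (lerp D C t) D) m n
        hL = left-ratios (first-stage 0<a us) (first-stage 0<b ut) (trans (cong (m *_) as) a-product) (trans (cong (n *_) bt) b-product)
        i : IsAffineImageOf (quad (lerp A B s) B C (lerp D C t)) Q
        i = ratios⇒image (right-oriented (last-stage 0<a us) (last-stage 0<b ut)) g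
          (subst₂ (HasRatios (quad (lerp A B s) B C (lerp D C t))) as bt (right-ratios (last-stage 0<a us) (last-stage 0<b ut))) outer
        cut : _
        cut = transverse⇒cut A (lerp A B s) (lerp D C t) D oL hL n≢1 inner

  -- Symmetries of chains of ratios

  ⁻¹>1 : ∀ {x} → 0# < x → x < 1# → 1# < x ⁻¹
  ⁻¹>1 {x} hx x<1 = <-cert (*-pos (<⇒pos x<1) (⁻¹-pos hx)) (lin (sym (⁻¹-inverseʳ (pos≢0 hx)))
    (ring 2 (λ x i → (:1 ⊖ x) ⊗ i ⊕ x ⊗ i ⊜ i ⊖ :1 ⊕ :1) tt x (x ⁻¹)))

  ⁻¹<1 : ∀ {x} → 1# < x → x ⁻¹ < 1#
  ⁻¹<1 {x} 1<x = <-cert (*-pos (<⇒pos 1<x) (⁻¹-pos 0<x)) (lin (⁻¹-inverseʳ (pos≢0 0<x))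
    (ring 2 (λ x i → (x ⊖ :1) ⊗ i ⊕ :1 ⊜ :1 ⊖ i ⊕ x ⊗ i) tt x (x ⁻¹)))
    where 0<x = <-trans 0<1 1<x

  inverse-unique : ∀ {x y z} → x * y ≡ 1# → x * z ≡ 1# → y ≡ z
  inverse-unique {x} e e′ = *-cancelˡ (*-≢0ˡ (λ z → 0≢1 (sym (trans (sym e) z)))) (trans e (sym e′))

  ⁻¹-* : ∀ {x y} → x ≢ 0# → y ≢ 0# → (x * y) * (x ⁻¹ * y ⁻¹) ≡ 1#
  ⁻¹-* {x} {y} hx hy = trans (ring 4 (λ x y i j → x ⊗ y ⊗ (i ⊗ j) ⊜ x ⊗ i ⊗ (y ⊗ j)) tt x y (x ⁻¹) (y ⁻¹))
    (trans (cong₂ _*_ (⁻¹-inverseʳ hx) (⁻¹-inverseʳ hy)) (R.*-identityˡ 1#))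

  below-⁻¹ : ∀ {a b} → 0# < a → 0# < b → Below a b → Above (a ⁻¹) (b ⁻¹)
  below-⁻¹ ha hb (x , y) = ⁻¹>1 ha x , ⁻¹>1 hb y

  above-⁻¹ : ∀ {a b} → Above a b → Below (a ⁻¹) (b ⁻¹)
  above-⁻¹ (x , y) = ⁻¹<1 x , ⁻¹<1 y

  chainA-swap : ∀ {Q a b} → ChainA Q a b → ChainA Q b a
  chainA-swap ch = record
    { a-product = b-product ; b-product = a-product
    ; ratios₁ = RatiosOf-swap ratios₁ ; ratios₂ = RatiosOf-swap ratios₂ ; ratios₃ = RatiosOf-swap ratios₃
    ; side = Sum.map (λ (x , y , z) → Product.swap x , Product.swap y , Product.swap z) (λ (x , y , z) → Product.swap x , Product.swap y , Product.swap z) side }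
    where
    open ChainA ch

  -- Exchanging V₀V₁ with V₃V₂ reverses the direction of the transverse sides and so inverts m′ and
  -- n′.
  transverse-swap : ∀ {Q m n} → Generic Q → Transverse Q m n → Transverse Q n m
  transverse-swap {Q} {m} {n} g tr = record
    { 0<m′ = ⁻¹-pos 0<m′ ; 0<n′ = ⁻¹-pos 0<n′
    ; n′-def = lin (cong₂ _+_ (cong (n′ ⁻¹ *_) (sym n′-def)) (cong (_* (1# - n)) e))
        (ring 4 (λ m n x i → i ⊗ (:1 ⊖ m) ⊕ (i ⊗ (x ⊗ (:1 ⊖ n)) ⊕ :1 ⊗ (:1 ⊖ n)) ⊜ :1 ⊖ n ⊕ (i ⊗ (:1 ⊖ m) ⊕ x ⊗ i ⊗ (:1 ⊖ n))) tt m n n′ (n′ ⁻¹))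
    ; m′-def = lin (cong₂ _+_ (cong₂ _-_ (cong (m * n′ ⁻¹ *_) e′) (cong (n * m′ ⁻¹ *_) e)) (cong (m′ ⁻¹ * n′ ⁻¹ *_) (sym m′-def)))
        (ring 6 (λ m n x i y j → n ⊗ j ⊕ (m ⊗ i ⊗ :1 ⊖ n ⊗ j ⊗ :1 ⊕ j ⊗ i ⊗ (m ⊗ y)) ⊜
          m ⊗ i ⊕ (m ⊗ i ⊗ (y ⊗ j) ⊖ n ⊗ j ⊗ (x ⊗ i) ⊕ j ⊗ i ⊗ (n ⊗ x))) tt m n n′ (n′ ⁻¹) m′ (m′ ⁻¹))
    ; a-product = inverse-unique (subst (λ x → x * (a₁ ⁻¹ * a₂ ⁻¹) ≡ 1#) a-product (⁻¹-* (pos≢0 0<a₁) (pos≢0 0<a₂))) e′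
    ; b-product = inverse-unique (subst (λ x → x * (b₁ ⁻¹ * b₂ ⁻¹) ≡ 1#) b-product (⁻¹-* (pos≢0 0<b₁) (pos≢0 0<b₂))) e
    ; ratios₁ = RatiosOf-invert (⁻¹-inverseʳ (pos≢0 0<a₁)) (⁻¹-inverseʳ (pos≢0 0<b₁)) ratios₁
    ; ratios₂ = RatiosOf-invert (⁻¹-inverseʳ (pos≢0 0<a₂)) (⁻¹-inverseʳ (pos≢0 0<b₂)) ratios₂
    ; side = go side }
    where
    open Transverse tr
    e  = ⁻¹-inverseʳ (pos≢0 0<n′)
    e′ = ⁻¹-inverseʳ (pos≢0 0<m′)
    0<a₁ = proj₁ (RatiosOf-pos g ratios₁)
    0<a₂ = proj₁ (RatiosOf-pos g ratios₂)
    0<b₁ = proj₂ (RatiosOf-pos g ratios₁)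
    0<b₂ = proj₂ (RatiosOf-pos g ratios₂)
    go : (Below a₁ b₁ × Below a₂ b₂) ⊎ (Above a₁ b₁ × Above a₂ b₂) →
         (Below (a₁ ⁻¹) (b₁ ⁻¹) × Below (a₂ ⁻¹) (b₂ ⁻¹)) ⊎ (Above (a₁ ⁻¹) (b₁ ⁻¹) × Above (a₂ ⁻¹) (b₂ ⁻¹))
    go (inj₁ (x , y)) = inj₂ (below-⁻¹ 0<a₁ 0<b₁ x , below-⁻¹ 0<a₂ 0<b₂ y)
    go (inj₂ (x , y)) = inj₁ (above-⁻¹ x , above-⁻¹ y)

  chainB-swap : ∀ {Q a b} → Generic Q → ChainB Q a b → ChainB Q b a
  chainB-swap g ch = record
    { 0<m = 0<n ; 0<n = 0<m ; a-product = b-product ; b-product = a-product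
    ; outer = RatiosOf-swap outer ; inner = transverse-swap g inner ; side = Sum.map (Product.map Product.swap Product.swap) (Product.map Product.swap Product.swap) side }
    where
    open ChainB ch

  chainA-invert : ∀ {Q a b} → Generic Q → 0# < a → 0# < b → ChainA Q a b → ChainA Q (a ⁻¹) (b ⁻¹)
  chainA-invert {Q} {a} {b} g 0<a 0<b ch = record
    { a-product = product 0<a 0<a₁ 0<a₂ 0<a₃ a-product ; b-product = product 0<b 0<b₁ 0<b₂ 0<b₃ b-product
    ; ratios₁ = RatiosOf-invert (⁻¹-inverseʳ (pos≢0 0<a₁)) (⁻¹-inverseʳ (pos≢0 0<b₁)) ratios₁
    ; ratios₂ = RatiosOf-invert (⁻¹-inverseʳ (pos≢0 0<a₂)) (⁻¹-inverseʳ (pos≢0 0<b₂)) ratios₂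
    ; ratios₃ = RatiosOf-invert (⁻¹-inverseʳ (pos≢0 0<a₃)) (⁻¹-inverseʳ (pos≢0 0<b₃)) ratios₃
    ; side = go side }
    where
    open ChainA ch
    0<a₁ = proj₁ (RatiosOf-pos g ratios₁)
    0<a₂ = proj₁ (RatiosOf-pos g ratios₂)
    0<a₃ = proj₁ (RatiosOf-pos g ratios₃)
    0<b₁ = proj₂ (RatiosOf-pos g ratios₁)
    0<b₂ = proj₂ (RatiosOf-pos g ratios₂)
    0<b₃ = proj₂ (RatiosOf-pos g ratios₃)
    product : ∀ {x y z w} → 0# < w → 0# < x → 0# < y → 0# < z → x * y * z ≡ w → x ⁻¹ * y ⁻¹ * z ⁻¹ ≡ w ⁻¹
    product {x} {y} {z} hw hx hy hz refl = inverse-unique (trans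
      (ring 6 (λ x y z i j k → x ⊗ y ⊗ z ⊗ (i ⊗ j ⊗ k) ⊜ x ⊗ y ⊗ (i ⊗ j) ⊗ (z ⊗ k)) tt x y z (x ⁻¹) (y ⁻¹) (z ⁻¹))
      (trans (cong₂ _*_ (⁻¹-* (pos≢0 hx) (pos≢0 hy)) (⁻¹-inverseʳ (pos≢0 hz))) (R.*-identityˡ 1#)))
      (⁻¹-inverseʳ (pos≢0 hw))
    go : (Below a₁ b₁ × Below a₂ b₂ × Below a₃ b₃) ⊎ (Above a₁ b₁ × Above a₂ b₂ × Above a₃ b₃) →
         (Below (a₁ ⁻¹) (b₁ ⁻¹) × Below (a₂ ⁻¹) (b₂ ⁻¹) × Below (a₃ ⁻¹) (b₃ ⁻¹)) ⊎
         (Above (a₁ ⁻¹) (b₁ ⁻¹) × Above (a₂ ⁻¹) (b₂ ⁻¹) × Above (a₃ ⁻¹) (b₃ ⁻¹))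
    go (inj₁ (x , y , z)) = inj₂ (below-⁻¹ 0<a₁ 0<b₁ x , below-⁻¹ 0<a₂ 0<b₂ y , below-⁻¹ 0<a₃ 0<b₃ z)
    go (inj₂ (x , y , z)) = inj₁ (above-⁻¹ x , above-⁻¹ y , above-⁻¹ z)

  -- Inverting m and n corresponds to a half turn of the labels, which exchanges and reverses the
  -- transverse sides; together with a swap this just exchanges m′ and n′.
  transverse-invert : ∀ {Q m n} → 0# < m → 0# < n → Transverse Q m n → Transverse Q (m ⁻¹) (n ⁻¹)
  transverse-invert {Q} {m} {n} 0<m 0<n tr = record
    { 0<m′ = 0<n′ ; 0<n′ = 0<m′
    ; n′-def = *-cancelˡ (pos≢0 (*-pos 0<m 0<n)) (lin (cong₂ _+_
          (cong₂ _+_ (cong (λ t → (1# - t) * (m * m′)) e) (cong (λ t → (t - 1#) * n) e′))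
          (cong₂ _+_ (cong ((n - 1#) *_) m′-def) (cong (n *_) (sym n′-def))))
        (ring 6 (λ m i n j x y → m ⊗ n ⊗ (y ⊗ (:1 ⊖ j)) ⊕ ((:1 ⊖ :1) ⊗ (m ⊗ y) ⊕ (:1 ⊖ :1) ⊗ n ⊕ ((n ⊖ :1) ⊗ (n ⊗ x) ⊕ n ⊗ (x ⊗ (:1 ⊖ n)))) ⊜
          m ⊗ n ⊗ (:1 ⊖ i) ⊕ ((:1 ⊖ n ⊗ j) ⊗ (m ⊗ y) ⊕ (m ⊗ i ⊖ :1) ⊗ n ⊕ ((n ⊖ :1) ⊗ (m ⊗ y) ⊕ n ⊗ (:1 ⊖ m)))) tt m (m ⁻¹) n (n ⁻¹) n′ m′))
    ; m′-def = *-cancelˡ (pos≢0 (*-pos 0<m 0<n)) (lin (cong₂ _+_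
          (cong₂ _-_ (cong (_* (n * n′)) e′) (cong (_* (m * m′)) e)) (sym m′-def))
        (ring 6 (λ m i n j x y → m ⊗ n ⊗ (i ⊗ x) ⊕ (:1 ⊗ (n ⊗ x) ⊖ :1 ⊗ (m ⊗ y) ⊕ m ⊗ y) ⊜
          m ⊗ n ⊗ (j ⊗ y) ⊕ (m ⊗ i ⊗ (n ⊗ x) ⊖ n ⊗ j ⊗ (m ⊗ y) ⊕ n ⊗ x)) tt m (m ⁻¹) n (n ⁻¹) n′ m′))
    ; a-product = b-product ; b-product = a-product
    ; ratios₁ = RatiosOf-swap ratios₁ ; ratios₂ = RatiosOf-swap ratios₂ ; side = Sum.map (Product.map Product.swap Product.swap) (Product.map Product.swap Product.swap) side }
    where
    open Transverse tr
    e  = ⁻¹-inverseʳ (pos≢0 0<n)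
    e′ = ⁻¹-inverseʳ (pos≢0 0<m)

  chainB-invert : ∀ {Q a b} → Generic Q → 0# < a → 0# < b → ChainB Q a b → ChainB Q (a ⁻¹) (b ⁻¹)
  chainB-invert {Q} {a} {b} g 0<a 0<b ch = record
    { 0<m = ⁻¹-pos 0<m ; 0<n = ⁻¹-pos 0<n
    ; a-product = product 0<a 0<m 0<u a-product ; b-product = product 0<b 0<n 0<v b-product
    ; outer = RatiosOf-invert (⁻¹-inverseʳ (pos≢0 0<u)) (⁻¹-inverseʳ (pos≢0 0<v)) outer
    ; inner = transverse-invert 0<m 0<n inner
    ; side = go side }
    where
    open ChainB ch
    0<u = proj₁ (RatiosOf-pos g outer)
    0<v = proj₂ (RatiosOf-pos g outer)
    product : ∀ {x y w} → 0# < w → 0# < x → 0# < y → x * y ≡ w → x ⁻¹ * y ⁻¹ ≡ w ⁻¹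
    product hw hx hy refl = inverse-unique (⁻¹-* (pos≢0 hx) (pos≢0 hy)) (⁻¹-inverseʳ (pos≢0 hw))
    go : (Below m n × Below u v) ⊎ (Above m n × Above u v) →
         (Below (m ⁻¹) (n ⁻¹) × Below (u ⁻¹) (v ⁻¹)) ⊎ (Above (m ⁻¹) (n ⁻¹) × Above (u ⁻¹) (v ⁻¹))
    go (inj₁ (x , y)) = inj₂ (below-⁻¹ 0<m 0<n x , below-⁻¹ 0<u 0<v y)
    go (inj₂ (x , y)) = inj₁ (above-⁻¹ x , above-⁻¹ y)

  module _ {Q : Quad} (g : Generic Q) (Chain : Carrier → Carrier → Set) (swap : ∀ {a b} → Chain a b → Chain b a) where
    private
      Normalized : Set
      Normalized = ∃[ p ] ∃[ q ] ((p < q) × (q < 1#) × RatiosOf Q p q × Chain p q)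

      order : ∀ {a b} → Below a b → RatiosOf Q a b → Chain a b → Normalized
      order {a} {b} (a<1 , b<1) r ch with compare a b
      ... | tri< lt _ _ = a , b , lt , b<1 , r , ch
      ... | tri≈ _ e _ = ⊥-elim (RatiosOf-≢ g r e)
      ... | tri> _ _ gt = b , a , gt , a<1 , RatiosOf-swap r , swap ch

    -- Inversion brings a pair below 1, and a swap then puts it in ascending order.
    normalize : (∀ {a b} → 0# < a → 0# < b → Chain a b → Chain (a ⁻¹) (b ⁻¹)) →
      ∀ {a b} → RatiosOf Q a b → Chain a b → Normalized
    normalize invert r ch with RatiosOf-side g r | RatiosOf-pos g r
    ... | inj₁ h | _ = order h r ch
    ... | inj₂ h | 0<a , 0<b = order (above-⁻¹ h)
      (RatiosOf-invert (⁻¹-inverseʳ (pos≢0 0<a)) (⁻¹-inverseʳ (pos≢0 0<b)) r) (invert 0<a 0<b ch)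

  -- The equations of the families

  factor-bounds : ∀ {x y z w} → (0# < x) × (x < 1#) → (0# < y) × (y < 1#) → (0# < z) × (z < 1#) → x * y * z ≡ w →
    (w < x) × (w < y) × (w < z)
  factor-bounds {x} {y} {z} (0<x , x<1) (0<y , y<1) (0<z , z<1) e =
    product<1 (*-pos 0<y 0<z) 0<x (less 0<y y<1 0<z z<1) x<1 (trans (ring 3 (λ x y z → y ⊗ z ⊗ x ⊜ x ⊗ y ⊗ z) tt x y z) e) ,
    product<1 (*-pos 0<x 0<z) 0<y (less 0<x x<1 0<z z<1) y<1 (trans (ring 3 (λ x y z → x ⊗ z ⊗ y ⊜ x ⊗ y ⊗ z) tt x y z) e) ,
    product<1 (*-pos 0<x 0<y) 0<z (less 0<x x<1 0<y y<1) z<1 e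
    where
    less : ∀ {x y} → 0# < x → x < 1# → 0# < y → y < 1# → x * y < 1#
    less 0<x x<1 0<y y<1 = <-trans (product<1 0<x 0<y x<1 y<1 refl) y<1

  module _ {p q p′ q′ : Carrier} (S : Shape p q p′ q′) where
    open Shape S

    private
      Asc : Carrier → Carrier → Set
      Asc = Ascending p q p′ q′

      z : Carrier
      z = q + q′ - 1#

      pq′≡z : p * q′ ≡ z
      pq′≡z = lin (sym q+q′≡1+pq′) (ring 3 (λ p q q′ → p ⊗ q′ ⊕ (q ⊕ q′) ⊜ q ⊕ q′ ⊖ :1 ⊕ (:1 ⊕ p ⊗ q′)) tt p q q′)

      p′q≡z : p′ * q ≡ z
      p′q≡z = trans (sym pq′≡p′q) pq′≡z

      0<z : 0# < z
      0<z = pos-by (*-pos 0<p 0<q′) pq′≡z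

      asc-ratio : ∀ {a b} → Asc a b → a * q ≡ p * b
      asc-ratio (inj₁ (refl , refl)) = refl
      asc-ratio (inj₂ (refl , refl)) = sym pq′≡p′q

      asc-< : ∀ {a b} → Asc a b → a < b
      asc-< (inj₁ (refl , refl)) = p<q
      asc-< (inj₂ (refl , refl)) = p′<q′

      asc-pos : ∀ {a b} → Asc a b → (0# < a) × (0# < b)
      asc-pos (inj₁ (refl , refl)) = 0<p , 0<q
      asc-pos (inj₂ (refl , refl)) = 0<p′ , 0<q′

      asc-below : ∀ {a b} → Asc a b → Below a b
      asc-below (inj₁ (refl , refl)) = p<1 , q<1
      asc-below (inj₂ (refl , refl)) = p′<1 , q′<1

      -- A proper factor of (p , q) exceeds it in both entries, which leaves neither (p , q) nor (q
      -- , p).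
      restrict : ∀ {a b} → Asc a b ⊎ Asc b a → p < a → q < b → ((a ≡ p′) × (b ≡ q′)) ⊎ ((a ≡ q′) × (b ≡ p′))
      restrict (inj₁ (inj₁ (refl , _))) h _ = ⊥-elim (<-irrefl h)
      restrict (inj₁ (inj₂ e)) _ _ = inj₁ e
      restrict (inj₂ (inj₁ (refl , refl))) _ h = ⊥-elim (<-asym p<q h)
      restrict (inj₂ (inj₂ (e , e′))) _ _ = inj₂ (e′ , e)

      -- Since p < p′, q′ and q < q′, p′ all factors of (p , q) are (p′ , q′) or (q′ , p′); as p / q = p′ / q′ < 1,
      -- the former occurs exactly twice.
      count : ∀ {a₁ a₂ a₃ b₁ b₂ b₃} →
        ((a₁ ≡ p′) × (b₁ ≡ q′)) ⊎ ((a₁ ≡ q′) × (b₁ ≡ p′)) → ((a₂ ≡ p′) × (b₂ ≡ q′)) ⊎ ((a₂ ≡ q′) × (b₂ ≡ p′)) →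
        ((a₃ ≡ p′) × (b₃ ≡ q′)) ⊎ ((a₃ ≡ q′) × (b₃ ≡ p′)) → a₁ * a₂ * a₃ ≡ p → b₁ * b₂ * b₃ ≡ q → q ≡ q′ * q′ * p′
      count (inj₁ (refl , refl)) (inj₁ (refl , refl)) (inj₁ (refl , refl)) ea eb = ⊥-elim (<⇒≢
        (<-cert (*-pos (*-pos 0<p′ 0<q′) (<⇒pos (*-mono-< 0<p′ p′<q′ 0<p′ p′<q′)))
          (ring 2 (λ x y → x ⊗ y ⊗ (y ⊗ y ⊖ x ⊗ x) ⊜ x ⊗ (y ⊗ y ⊗ y) ⊖ x ⊗ x ⊗ x ⊗ y) tt p′ q′))
        (trans (cong (_* q′) ea) (trans pq′≡p′q (cong (p′ *_) (sym eb)))))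
      count (inj₁ (refl , refl)) (inj₁ (refl , refl)) (inj₂ (refl , refl)) ea eb = sym eb
      count (inj₁ (refl , refl)) (inj₂ (refl , refl)) (inj₁ (refl , refl)) ea eb =
        trans (sym eb) (ring 2 (λ x y → y ⊗ x ⊗ y ⊜ y ⊗ y ⊗ x) tt p′ q′)
      count (inj₂ (refl , refl)) (inj₁ (refl , refl)) (inj₁ (refl , refl)) ea eb =
        trans (sym eb) (ring 2 (λ x y → x ⊗ y ⊗ y ⊜ y ⊗ y ⊗ x) tt p′ q′)
      count (inj₁ (refl , refl)) (inj₂ (refl , refl)) (inj₂ (refl , refl)) ea eb =
        ⊥-elim (<-asym p<q (subst₂ _<_ eb ea (<-cert (*-pos (*-pos 0<p′ 0<q′) (<⇒pos p′<q′))
          (ring 2 (λ x y → x ⊗ y ⊗ (y ⊖ x) ⊜ x ⊗ y ⊗ y ⊖ y ⊗ x ⊗ x) tt p′ q′))))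
      count (inj₂ (refl , refl)) (inj₁ (refl , refl)) (inj₂ (refl , refl)) ea eb =
        ⊥-elim (<-asym p<q (subst₂ _<_ eb ea (<-cert (*-pos (*-pos 0<p′ 0<q′) (<⇒pos p′<q′))
          (ring 2 (λ x y → x ⊗ y ⊗ (y ⊖ x) ⊜ y ⊗ x ⊗ y ⊖ x ⊗ y ⊗ x) tt p′ q′))))
      count (inj₂ (refl , refl)) (inj₂ (refl , refl)) (inj₁ (refl , refl)) ea eb =
        ⊥-elim (<-asym p<q (subst₂ _<_ eb ea (<-cert (*-pos (*-pos 0<p′ 0<q′) (<⇒pos p′<q′))
          (ring 2 (λ x y → x ⊗ y ⊗ (y ⊖ x) ⊜ y ⊗ y ⊗ x ⊖ x ⊗ x ⊗ y) tt p′ q′))))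
      count (inj₂ (refl , refl)) (inj₂ (refl , refl)) (inj₂ (refl , refl)) ea eb =
        ⊥-elim (<-asym p<q (subst₂ _<_ eb ea (*-mono-< (*-pos 0<p′ 0<p′) (*-mono-< 0<p′ p′<q′ 0<p′ p′<q′) 0<p′ p′<q′)))

    module _ {Q : Quad} (g : Generic Q) (types : ∀ {a b} → RatiosOf Q a b → a < 1# → Asc a b ⊎ Asc b a) where

      chainA⇒equation : ChainA Q p q → q ≡ q′ * q′ * p′
      chainA⇒equation ch with ChainA.side ch
      ... | inj₂ (A₁ , A₂ , A₃) = ⊥-elim (<-asym p<1 (product₃>1 (proj₁ A₁) (proj₁ A₂) (proj₁ A₃) (ChainA.a-product ch)))
      ... | inj₁ (B₁ , B₂ , B₃) = count
          (restrict (types ratios₁ (proj₁ B₁)) (proj₁ boundsᵃ) (proj₁ boundsᵇ))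
          (restrict (types ratios₂ (proj₁ B₂)) (proj₁ (proj₂ boundsᵃ)) (proj₁ (proj₂ boundsᵇ)))
          (restrict (types ratios₃ (proj₁ B₃)) (proj₂ (proj₂ boundsᵃ)) (proj₂ (proj₂ boundsᵇ)))
          a-product b-product
        where
        open ChainA ch
        boundsᵃ : (p < a₁) × (p < a₂) × (p < a₃)
        boundsᵃ = factor-bounds (proj₁ (RatiosOf-pos g ratios₁) , proj₁ B₁) (proj₁ (RatiosOf-pos g ratios₂) , proj₁ B₂)
          (proj₁ (RatiosOf-pos g ratios₃) , proj₁ B₃) a-product
        boundsᵇ : (q < b₁) × (q < b₂) × (q < b₃)
        boundsᵇ = factor-bounds (proj₂ (RatiosOf-pos g ratios₁) , proj₂ B₁) (proj₂ (RatiosOf-pos g ratios₂) , proj₂ B₂)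
          (proj₂ (RatiosOf-pos g ratios₃) , proj₂ B₃) b-product

    -- Multiplied by q, the equation becomes x² = y²(x + y - 1), which is the polynomial of the
    -- family. The order x < y follows from q′p′ < 1.
    equation⇒famA : q ≡ q′ * q′ * p′ → FamA q q′
    equation⇒famA e = (pos⇒< (pos-by 0<z refl) , q′<1 , q<q′) ,
        lin (cong₂ _+_ (cong (q *_) (sym e)) (cong (q′ * q′ *_) (sym p′q≡z)))
          (ring 3 (λ x y p′ → famA-poly x y ⊕ (x ⊗ x ⊕ y ⊗ y ⊗ (p′ ⊗ x)) ⊜ :0 ⊕ (x ⊗ (y ⊗ y ⊗ p′) ⊕ y ⊗ y ⊗ (x ⊕ y ⊖ :1))) tt q q′ p′)
      where
      q<q′ : q < q′
      q<q′ = subst (_< q′) (sym e) (<-cert (*-pos 0<q′ (<⇒pos (<-trans (product<1 0<q′ 0<p′ q′<1 p′<1 refl) p′<1)))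
        (ring 2 (λ y p′ → y ⊗ (:1 ⊖ y ⊗ p′) ⊜ y ⊖ y ⊗ y ⊗ p′) tt q′ p′))

    famA⇒chainA : ∀ {Q} → RatiosOf Q p′ q′ → FamA q q′ → ChainA Q p q
    famA⇒chainA r (_ , e) = record
      { a-product = *-cancelˡ (pos≢0 0<q′) (lin (cong₂ _+_ (cong (p′ *_) (sym q-eq)) (sym pq′≡p′q))
          (ring 4 (λ p q p′ y → y ⊗ (p′ ⊗ p′ ⊗ y) ⊕ (p′ ⊗ q ⊕ p ⊗ y) ⊜ y ⊗ p ⊕ (p′ ⊗ (y ⊗ y ⊗ p′) ⊕ p′ ⊗ q)) tt p q p′ q′))
      ; b-product = sym q-eq ; ratios₁ = r ; ratios₂ = r ; ratios₃ = RatiosOf-swap r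
      ; side = inj₁ ((p′<1 , q′<1) , (p′<1 , q′<1) , (q′<1 , p′<1)) }
      where
      q-eq : q ≡ q′ * q′ * p′
      q-eq = *-cancelˡ (pos≢0 0<q) (lin (cong₂ _+_ (sym e) (cong (q′ * q′ *_) (sym p′q≡z)))
        (ring 3 (λ x y p′ → x ⊗ x ⊕ (famA-poly x y ⊕ y ⊗ y ⊗ (p′ ⊗ x)) ⊜ x ⊗ (y ⊗ y ⊗ p′) ⊕ (:0 ⊕ y ⊗ y ⊗ (x ⊕ y ⊖ :1))) tt q q′ p′))

    -- m = p / q′ and n = q / p′ are the ratios of the quadrangle that is cut twice, and d is a product b₁ b₂
    -- for the inverse of its other ratio.
    module _ {m n : Carrier} (mq′≡p : m * q′ ≡ p) (np′≡q : n * p′ ≡ q) where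
      private
        my²≡z : m * (q′ * q′) ≡ z
        my²≡z = trans (sym (R.*-assoc m q′ q′)) (trans (cong (_* q′) mq′≡p) pq′≡z)

        nz≡x² : n * z ≡ q * q
        nz≡x² = trans (cong (n *_) (sym p′q≡z)) (trans (sym (R.*-assoc n p′ q)) (cong (_* q) np′≡q))

      clear-denominators : ∀ {d} → d * (1# - m) ≡ 1# - n → d * ((q′ * q′ - z) * z) ≡ (z - q * q) * (q′ * q′)
      clear-denominators {d} e = lin
        (cong₂ _+_ (cong₂ _+_ (cong (q′ * q′ * z *_) e) (cong (d * z *_) my²≡z)) (cong (q′ * q′ *_) (sym nz≡x²)))
        (ring 6 (λ d m n z x y → d ⊗ ((y ⊗ y ⊖ z) ⊗ z) ⊕ (y ⊗ y ⊗ z ⊗ (:1 ⊖ n) ⊕ d ⊗ z ⊗ z ⊕ y ⊗ y ⊗ (n ⊗ z)) ⊜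
          (z ⊖ x ⊗ x) ⊗ (y ⊗ y) ⊕ (y ⊗ y ⊗ z ⊗ (d ⊗ (:1 ⊖ m)) ⊕ d ⊗ z ⊗ (m ⊗ (y ⊗ y)) ⊕ y ⊗ y ⊗ (x ⊗ x))) tt d m n z q q′)

      restore-denominators : ∀ {d} → d * ((q′ * q′ - z) * z) ≡ (z - q * q) * (q′ * q′) → d * (1# - m) ≡ 1# - n
      restore-denominators {d} e = *-cancelˡ (pos≢0 (*-pos (*-pos 0<q′ 0<q′) 0<z)) (lin
        (cong₂ _+_ (cong₂ _+_ e (cong (d * z *_) (sym my²≡z))) (cong (q′ * q′ *_) nz≡x²))
        (ring 6 (λ d m n z x y → y ⊗ y ⊗ z ⊗ (d ⊗ (:1 ⊖ m)) ⊕ ((z ⊖ x ⊗ x) ⊗ (y ⊗ y) ⊕ d ⊗ z ⊗ (m ⊗ (y ⊗ y)) ⊕ y ⊗ y ⊗ (x ⊗ x)) ⊜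
          y ⊗ y ⊗ z ⊗ (:1 ⊖ n) ⊕ (d ⊗ ((y ⊗ y ⊖ z) ⊗ z) ⊕ d ⊗ z ⊗ z ⊕ y ⊗ y ⊗ (n ⊗ z))) tt d m n z q q′))

      m<n : m < n
      m<n = pos⇒< (*-cancel-pos (*-pos 0<p′ 0<q′) (pos-by (<⇒pos (*-mono-< 0<p′ p′<q′ 0<p p<q))
        (lin (cong₂ _-_ (cong (p′ *_) mq′≡p) (cong (q′ *_) np′≡q))
          (ring 6 (λ m n p q x y → y ⊗ q ⊖ x ⊗ p ⊕ (x ⊗ p ⊖ y ⊗ q) ⊜ x ⊗ y ⊗ (n ⊖ m) ⊕ (x ⊗ (m ⊗ y) ⊖ y ⊗ (n ⊗ x))) tt m n p q p′ q′))))

    FamB : Set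
    FamB = FamB₁ q q′ ⊎ FamB₂ q q′

    private
      -- For d = x² the two sides differ by (1 - x)(x + y) times the polynomial of B₁, and this
      -- cofactor is positive.
      B₁-factor : ∀ {d} → d ≡ q * q → d * ((q′ * q′ - z) * z) ≡ (z - q * q) * (q′ * q′) →
        (q + 1#) * (q′ * q′) - (q + 1#) * q′ + q * (1# - q) ≡ 0#
      B₁-factor refl e = *-≡0 (pos≢0 (*-pos (<⇒pos q<1) (+-pos 0<q 0<q′))) (lin (sym e)
        (ring 2 (λ x y → let z = x ⊕ y ⊖ :1 in (:1 ⊖ x) ⊗ (x ⊕ y) ⊗ famB₁-poly x y ⊕ x ⊗ x ⊗ ((y ⊗ y ⊖ z) ⊗ z) ⊜
          :0 ⊕ (z ⊖ x ⊗ x) ⊗ (y ⊗ y)) tt q q′))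

      B₁-unfactor : (q + 1#) * (q′ * q′) - (q + 1#) * q′ + q * (1# - q) ≡ 0# →
        q * q * ((q′ * q′ - z) * z) ≡ (z - q * q) * (q′ * q′)
      B₁-unfactor e = lin (cong ((1# - q) * (q + q′) *_) (sym e))
        (ring 2 (λ x y → let z = x ⊕ y ⊖ :1 in x ⊗ x ⊗ ((y ⊗ y ⊖ z) ⊗ z) ⊕ (:1 ⊖ x) ⊗ (x ⊕ y) ⊗ famB₁-poly x y ⊜
          (z ⊖ x ⊗ x) ⊗ (y ⊗ y) ⊕ (:1 ⊖ x) ⊗ (x ⊕ y) ⊗ :0) tt q q′)

      -- For d = xy the cofactor is y.
      B₂-factor : ∀ {d} → d ≡ q * q′ → d * ((q′ * q′ - z) * z) ≡ (z - q * q) * (q′ * q′) →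
        q * q * q + (- (q′ * q′) + q′ - 2#) * (q * q) + (- (q′ * q′ * q′) + 2# * (q′ * q′) - q′ + 1#) * q + q′ * q′ - q′ ≡ 0#
      B₂-factor refl e = *-≡0 (pos≢0 0<q′) (lin (sym e)
        (ring 2 (λ x y → let z = x ⊕ y ⊖ :1 in y ⊗ famB₂-poly x y ⊕ x ⊗ y ⊗ ((y ⊗ y ⊖ z) ⊗ z) ⊜
          :0 ⊕ (z ⊖ x ⊗ x) ⊗ (y ⊗ y)) tt q q′))

      B₂-unfactor :
        q * q * q + (- (q′ * q′) + q′ - 2#) * (q * q) + (- (q′ * q′ * q′) + 2# * (q′ * q′) - q′ + 1#) * q + q′ * q′ - q′ ≡ 0# →
        q * q′ * ((q′ * q′ - z) * z) ≡ (z - q * q) * (q′ * q′)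
      B₂-unfactor e = lin (cong (q′ *_) (sym e))
        (ring 2 (λ x y → let z = x ⊕ y ⊖ :1 in x ⊗ y ⊗ ((y ⊗ y ⊖ z) ⊗ z) ⊕ y ⊗ famB₂-poly x y ⊜
          (z ⊖ x ⊗ x) ⊗ (y ⊗ y) ⊕ y ⊗ :0) tt q q′)

      -- For d = y² the difference of the two sides is y²(1 - y)²(x + y), which is positive.
      no-third-family : q′ * q′ * ((q′ * q′ - z) * z) ≡ (z - q * q) * (q′ * q′) → ⊥
      no-third-family e = pos≢0 (*-pos (*-pos 0<q′ 0<q′) (*-pos (*-pos (<⇒pos q′<1) (<⇒pos q′<1)) (+-pos 0<q 0<q′))) (lin e
        (ring 2 (λ x y → let z = x ⊕ y ⊖ :1 in y ⊗ y ⊗ ((:1 ⊖ y) ⊗ (:1 ⊖ y) ⊗ (x ⊕ y)) ⊕ (z ⊖ x ⊗ x) ⊗ (y ⊗ y) ⊜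
          :0 ⊕ y ⊗ y ⊗ ((y ⊗ y ⊖ z) ⊗ z)) tt q q′))

    module _ {Q : Quad} (g : Generic Q) (types : ∀ {a b} → RatiosOf Q a b → a < 1# → Asc a b ⊎ Asc b a) where

      chainB⇒equation : ChainB Q p q → FamB
      chainB⇒equation ch with ChainB.side ch
      ... | inj₂ (Am , Au) = ⊥-elim (<-asym p<1 (<-trans (proj₁ Au) (product>1 (proj₁ Am) (proj₁ Au) (ChainB.a-product ch))))
      ... | inj₁ ((m<1 , n<1) , (u<1 , v<1)) = outer-type (restrict (types outer u<1)
          (product<1 0<m (proj₁ (RatiosOf-pos g outer)) m<1 u<1 a-product)
          (product<1 0<n (proj₂ (RatiosOf-pos g outer)) n<1 v<1 b-product))
        where
        open ChainB ch
        open Transverse inner using (m′; n′; a₁; a₂; b₁; b₂; 0<m′; 0<n′; n′-def; m′-def; ratios₁; ratios₂)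
        module T = Transverse inner

        outer-type : ((u ≡ p′) × (v ≡ q′)) ⊎ ((u ≡ q′) × (v ≡ p′)) → FamB
        -- Here m = p/p′ equals n = q/q′, so m′ = n′ = 1, while two factors on the same side of 1
        -- cannot have product 1.
        outer-type (inj₁ (refl , refl)) = ⊥-elim (trapezoid T.side)
          where
          m≡n : m ≡ n
          m≡n = *-cancelˡ (pos≢0 (*-pos 0<p′ 0<q′)) (lin
            (cong₂ _+_ (cong₂ _+_ (cong (_* q′) a-product) pq′≡p′q) (cong (p′ *_) (sym b-product)))
            (ring 6 (λ m n p q x y → x ⊗ y ⊗ m ⊕ (p ⊗ y ⊕ x ⊗ q ⊕ x ⊗ (n ⊗ y)) ⊜ x ⊗ y ⊗ n ⊕ (m ⊗ x ⊗ y ⊕ p ⊗ y ⊕ x ⊗ q)) tt m n p q p′ q′))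
          n′≡1 : n′ ≡ 1#
          n′≡1 = *-cancelˡ (pos≢0 (<⇒pos n<1)) (trans (R.*-comm _ _) (trans n′-def (trans (cong (λ t → 1# - t) m≡n) (sym (R.*-identityʳ _)))))
          m′≡1 : m′ ≡ 1#
          m′≡1 = *-cancelˡ (pos≢0 0<m) (trans m′-def (cong₂ _*_ (sym m≡n) n′≡1))
          trapezoid : (Below a₁ b₁ × Below a₂ b₂) ⊎ (Above a₁ b₁ × Above a₂ b₂) → ⊥
          trapezoid (inj₁ (x , y)) = <⇒≢ (<-trans (product<1 (proj₁ (RatiosOf-pos g ratios₁)) (proj₁ (RatiosOf-pos g ratios₂)) (proj₁ x) (proj₁ y) T.a-product) (proj₁ y)) m′≡1
          trapezoid (inj₂ (x , y)) = >⇒≢ (<-trans (proj₁ y) (product>1 (proj₁ x) (proj₁ y) T.a-product)) m′≡1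
        outer-type (inj₂ (refl , refl)) = inner-type T.side
          where
          m<n₀ : m < n
          m<n₀ = m<n a-product b-product
          -- As m < n, the values n′ = (1 - m)/(1 - n) and m′ = nn′/m exceed 1. The transverse
          -- factors therefore lie above 1, and it is their inverses that can be classified.
          1<n′ : 1# < n′
          1<n′ = pos⇒< (*-cancel-pos (<⇒pos n<1) (pos-by (<⇒pos m<n₀) (lin (sym n′-def)
            (ring 3 (λ m n x → n ⊖ m ⊕ x ⊗ (:1 ⊖ n) ⊜ (:1 ⊖ n) ⊗ (x ⊖ :1) ⊕ (:1 ⊖ m)) tt m n n′))))
          1<m′ : 1# < m′
          1<m′ = <-trans 1<n′ (pos⇒< (*-cancel-pos 0<m (pos-by (*-pos (<⇒pos m<n₀) 0<n′) (lin (sym m′-def)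
            (ring 4 (λ m n x y → (n ⊖ m) ⊗ x ⊕ m ⊗ y ⊜ m ⊗ (y ⊖ x) ⊕ n ⊗ x) tt m n n′ m′)))))
          -- The order of x and y comes from q = np′ < p′ < q′.
          base : Base q q′
          base = pos⇒< 0<z , q′<1 , <-trans (product<1 0<n 0<p′ n<1 p′<1 b-product) p′<q′
          mixed : ∀ {c₁ c₂ d₁ d₂} → 0# < c₁ * c₂ → c₁ * q ≡ p * d₁ → d₂ * q ≡ p * c₂ → c₁ * c₂ * n ≡ d₁ * d₂ * m → ⊥
          mixed {c₁} {c₂} {d₁} {d₂} 0<cc e₁ e₂ e = >⇒≢ m<n₀ (*-cancelˡ (pos≢0 0<cc) (trans e (cong (_* m) (sym cc≡dd))))
            where
            cc≡dd : c₁ * c₂ ≡ d₁ * d₂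
            cc≡dd = *-cancelˡ (pos≢0 (*-pos 0<p 0<q)) (lin (cong₂ _+_ (cong (p * c₂ *_) e₁) (cong (p * d₁ *_) (sym e₂)))
              (ring 6 (λ p q c₁ c₂ d₁ d₂ → p ⊗ q ⊗ (c₁ ⊗ c₂) ⊕ (p ⊗ c₂ ⊗ (p ⊗ d₁) ⊕ p ⊗ d₁ ⊗ (d₂ ⊗ q)) ⊜
                p ⊗ q ⊗ (d₁ ⊗ d₂) ⊕ (p ⊗ c₂ ⊗ (c₁ ⊗ q) ⊕ p ⊗ d₁ ⊗ (p ⊗ c₂))) tt p q c₁ c₂ d₁ d₂))
          -- Since m < n, the equation c₁c₂n = d₁d₂m needs c₁c₂ < d₁d₂. One reversed pair gives
          -- equality and two give the opposite inequality, so both are unreversed and d₁d₂ is x²,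
          -- xy or y².
          combine : ∀ {c₁ c₂ d₁ d₂} → Asc c₁ d₁ ⊎ Asc d₁ c₁ → Asc c₂ d₂ ⊎ Asc d₂ c₂ →
            d₁ * d₂ * (1# - m) ≡ 1# - n → c₁ * c₂ * n ≡ d₁ * d₂ * m → FamB
          combine (inj₁ (inj₁ (_ , refl))) (inj₁ (inj₁ (_ , refl))) e _ =
            inj₁ (base , B₁-factor refl (clear-denominators a-product b-product e))
          combine (inj₁ (inj₁ (_ , refl))) (inj₁ (inj₂ (_ , refl))) e _ =
            inj₂ (base , B₂-factor refl (clear-denominators a-product b-product e))
          combine (inj₁ (inj₂ (_ , refl))) (inj₁ (inj₁ (_ , refl))) e _ =
            inj₂ (base , B₂-factor (R.*-comm q′ q) (clear-denominators a-product b-product e))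
          combine (inj₁ (inj₂ (_ , refl))) (inj₁ (inj₂ (_ , refl))) e _ =
            ⊥-elim (no-third-family (clear-denominators a-product b-product e))
          combine (inj₂ α) (inj₂ β) _ e = ⊥-elim (>⇒≢ (*-mono-< (*-pos 0<d₁ 0<d₂) (*-mono-< 0<d₁ (asc-< α) 0<d₂ (asc-< β)) 0<m m<n₀) e)
            where
            0<d₁ = proj₁ (asc-pos α)
            0<d₂ = proj₁ (asc-pos β)
          combine (inj₁ α) (inj₂ β) _ e = ⊥-elim (mixed (*-pos (proj₁ (asc-pos α)) (proj₂ (asc-pos β))) (asc-ratio α) (asc-ratio β) e)
          combine {c₁} {c₂} {d₁} {d₂} (inj₂ α) (inj₁ β) _ e = ⊥-elim (mixed (*-pos (proj₁ (asc-pos β)) (proj₂ (asc-pos α))) (asc-ratio β) (asc-ratio α)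
            (trans (cong (_* n) (R.*-comm c₂ c₁)) (trans e (cong (_* m) (R.*-comm d₁ d₂)))))
          inner-type : (Below a₁ b₁ × Below a₂ b₂) ⊎ (Above a₁ b₁ × Above a₂ b₂) → FamB
          inner-type (inj₁ (x , y)) = ⊥-elim (<-asym 1<m′ (<-trans
            (product<1 (proj₁ (RatiosOf-pos g ratios₁)) (proj₁ (RatiosOf-pos g ratios₂)) (proj₁ x) (proj₁ y) T.a-product) (proj₁ y)))
          inner-type (inj₂ (x , y)) = combine
              (types (RatiosOf-invert (⁻¹-inverseʳ a₁≢0) (⁻¹-inverseʳ b₁≢0) ratios₁) (⁻¹<1 (proj₁ x)))
              (types (RatiosOf-invert (⁻¹-inverseʳ a₂≢0) (⁻¹-inverseʳ b₂≢0) ratios₂) (⁻¹<1 (proj₁ y)))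
              (lin (cong₂ _+_ (cong (d *_) (sym n′-def)) (cong (_* (1# - n)) dn′))
                (ring 4 (λ d m n x → d ⊗ (:1 ⊖ m) ⊕ (d ⊗ (x ⊗ (:1 ⊖ n)) ⊕ :1 ⊗ (:1 ⊖ n)) ⊜ :1 ⊖ n ⊕ (d ⊗ (:1 ⊖ m) ⊕ x ⊗ d ⊗ (:1 ⊖ n))) tt d m n n′))
              (lin (cong₂ _+_ (cong₂ _+_ (cong (c * n *_) (sym dn′)) (cong (c * d *_) (sym m′-def))) (cong (d * m *_) cm′))
                (ring 6 (λ c d m n x y → c ⊗ n ⊕ (c ⊗ n ⊗ (x ⊗ d) ⊕ c ⊗ d ⊗ (m ⊗ y) ⊕ d ⊗ m ⊗ :1) ⊜
                  d ⊗ m ⊕ (c ⊗ n ⊗ :1 ⊕ c ⊗ d ⊗ (n ⊗ x) ⊕ d ⊗ m ⊗ (y ⊗ c))) tt c d m n n′ m′))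
            where
            a₁≢0 = pos≢0 (proj₁ (RatiosOf-pos g ratios₁))
            a₂≢0 = pos≢0 (proj₁ (RatiosOf-pos g ratios₂))
            b₁≢0 = pos≢0 (proj₂ (RatiosOf-pos g ratios₁))
            b₂≢0 = pos≢0 (proj₂ (RatiosOf-pos g ratios₂))
            c = a₁ ⁻¹ * a₂ ⁻¹
            d = b₁ ⁻¹ * b₂ ⁻¹
            cm′ : m′ * c ≡ 1#
            cm′ = subst (λ t → t * c ≡ 1#) T.a-product (⁻¹-* a₁≢0 a₂≢0)
            dn′ : n′ * d ≡ 1#
            dn′ = subst (λ t → t * d ≡ 1#) T.b-product (⁻¹-* b₁≢0 b₂≢0)

      -- The piece cut off first takes (q′ , p′) and leaves (p/q′ , q/p′). The inverses of the two
      -- given pairs serve for the second cut; the hypothesis is the equation `n′-def` without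
      -- denominators. What has to be recovered from it is that m and n are below 1.
      equation⇒chainB : ∀ {c₁ c₂ d₁ d₂} → Asc c₁ d₁ → Asc c₂ d₂ → RatiosOf Q c₁ d₁ → RatiosOf Q c₂ d₂ → RatiosOf Q q′ p′ →
        q < q′ → d₁ * d₂ * ((q′ * q′ - z) * z) ≡ (z - q * q) * (q′ * q′) → ChainB Q p q
      equation⇒chainB {c₁} {c₂} {d₁} {d₂} α β r₁ r₂ outer q<q′ e = record
        { 0<m = *-pos 0<p (⁻¹-pos 0<q′) ; 0<n = *-pos 0<q (⁻¹-pos 0<p′) ; a-product = mq′≡p ; b-product = np′≡q ; outer = outer
        ; inner = record
          { 0<m′ = *-pos (⁻¹-pos 0<c₁) (⁻¹-pos 0<c₂) ; 0<n′ = *-pos (⁻¹-pos 0<d₁) (⁻¹-pos 0<d₂)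
          ; n′-def = lin (cong₂ _+_ (cong (_* (1# - m)) dd) (cong (dd⁻¹ *_) (sym (restore-denominators mq′≡p np′≡q e))))
              (ring 4 (λ m n d i → i ⊗ (:1 ⊖ n) ⊕ (:1 ⊗ (:1 ⊖ m) ⊕ i ⊗ (d ⊗ (:1 ⊖ m))) ⊜
                :1 ⊖ m ⊕ (d ⊗ i ⊗ (:1 ⊖ m) ⊕ i ⊗ (:1 ⊖ n))) tt m n (d₁ * d₂) dd⁻¹)
          ; m′-def = lin (cong₂ _+_ (cong₂ _+_ (cong (m * cc⁻¹ *_) (sym dd)) (cong (cc⁻¹ * dd⁻¹ *_) (sym ccn≡ddm))) (cong (n * dd⁻¹ *_) cc))
              (ring 6 (λ m n c i d j → m ⊗ i ⊕ (m ⊗ i ⊗ (d ⊗ j) ⊕ i ⊗ j ⊗ (c ⊗ n) ⊕ n ⊗ j ⊗ :1) ⊜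
                n ⊗ j ⊕ (m ⊗ i ⊗ :1 ⊕ i ⊗ j ⊗ (d ⊗ m) ⊕ n ⊗ j ⊗ (c ⊗ i))) tt m n (c₁ * c₂) cc⁻¹ (d₁ * d₂) dd⁻¹)
          ; a-product = refl ; b-product = refl
          ; ratios₁ = RatiosOf-invert (⁻¹-inverseʳ (pos≢0 0<c₁)) (⁻¹-inverseʳ (pos≢0 0<d₁)) r₁
          ; ratios₂ = RatiosOf-invert (⁻¹-inverseʳ (pos≢0 0<c₂)) (⁻¹-inverseʳ (pos≢0 0<d₂)) r₂
          ; side = inj₂ (below-⁻¹ 0<c₁ 0<d₁ (asc-below α) , below-⁻¹ 0<c₂ 0<d₂ (asc-below β)) }
        ; side = inj₁ ((m<1 , n<1) , (q′<1 , p′<1)) }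
        where
        m = p * q′ ⁻¹
        n = q * p′ ⁻¹
        mq′≡p : m * q′ ≡ p
        mq′≡p = sym (quotient-* (pos≢0 0<q′))
        np′≡q : n * p′ ≡ q
        np′≡q = sym (quotient-* (pos≢0 0<p′))
        0<c₁ = proj₁ (asc-pos α)
        0<c₂ = proj₁ (asc-pos β)
        0<d₁ = proj₂ (asc-pos α)
        0<d₂ = proj₂ (asc-pos β)
        cc⁻¹ = c₁ ⁻¹ * c₂ ⁻¹
        dd⁻¹ = d₁ ⁻¹ * d₂ ⁻¹
        cc : c₁ * c₂ * cc⁻¹ ≡ 1#
        cc = ⁻¹-* (pos≢0 0<c₁) (pos≢0 0<c₂)
        dd : d₁ * d₂ * dd⁻¹ ≡ 1#
        dd = ⁻¹-* (pos≢0 0<d₁) (pos≢0 0<d₂)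
        -- Both c₁c₂/(d₁d₂) and m/n = pp′/(qq′) equal (p/q)², because every unreversed pair has the
        -- quotient p/q.
        ccn≡ddm : c₁ * c₂ * n ≡ d₁ * d₂ * m
        ccn≡ddm = *-cancelˡ (pos≢0 (*-pos (*-pos 0<p′ 0<q′) (*-pos 0<p 0<q))) (lin
          (cong₂ _+_ (cong₂ _+_ (cong₂ _+_ (cong₂ _+_
            (cong (c₁ * c₂ * q′ * p * q *_) np′≡q) (cong (q′ * p * (c₂ * q) *_) (asc-ratio α)))
            (cong (q′ * p * (p * d₁) *_) (asc-ratio β))) (cong (d₁ * d₂ * p * p *_) pq′≡p′q)) (cong (d₁ * d₂ * p′ * p * q *_) (sym mq′≡p)))
          (ring 10 (λ p q x y m n c₁ c₂ d₁ d₂ → x ⊗ y ⊗ (p ⊗ q) ⊗ (c₁ ⊗ c₂ ⊗ n) ⊕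
              (c₁ ⊗ c₂ ⊗ y ⊗ p ⊗ q ⊗ q ⊕ y ⊗ p ⊗ (c₂ ⊗ q) ⊗ (p ⊗ d₁) ⊕ y ⊗ p ⊗ (p ⊗ d₁) ⊗ (p ⊗ d₂)
                ⊕ d₁ ⊗ d₂ ⊗ p ⊗ p ⊗ (x ⊗ q) ⊕ d₁ ⊗ d₂ ⊗ x ⊗ p ⊗ q ⊗ (m ⊗ y)) ⊜
              x ⊗ y ⊗ (p ⊗ q) ⊗ (d₁ ⊗ d₂ ⊗ m) ⊕
              (c₁ ⊗ c₂ ⊗ y ⊗ p ⊗ q ⊗ (n ⊗ x) ⊕ y ⊗ p ⊗ (c₂ ⊗ q) ⊗ (c₁ ⊗ q) ⊕ y ⊗ p ⊗ (p ⊗ d₁) ⊗ (c₂ ⊗ q)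
                ⊕ d₁ ⊗ d₂ ⊗ p ⊗ p ⊗ (p ⊗ y) ⊕ d₁ ⊗ d₂ ⊗ x ⊗ p ⊗ q ⊗ p)) tt p q p′ q′ m n c₁ c₂ d₁ d₂))
        0<d = *-pos 0<d₁ 0<d₂
        0<y² = *-pos 0<q′ 0<q′
        x²<y² : q * q < q′ * q′
        x²<y² = *-mono-< 0<q q<q′ 0<q q<q′
        z<y² : z < q′ * q′
        -- If z ≥ y², then z > x² by x < y, and the equation would equate a number that is not
        -- positive with a positive one.
        z<y² with compare z (q′ * q′)
        ... | tri< h _ _ = h
        ... | tri≈ _ h _ = ⊥-elim (pos≢0 (*-pos (<⇒pos x²<y²) 0<y²)
          (lin (cong₂ _+_ (sym e) (cong ((d₁ * d₂ * z + q′ * q′) *_) (sym h)))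
            (ring 4 (λ x y z d → (y ⊗ y ⊖ x ⊗ x) ⊗ (y ⊗ y) ⊕ (d ⊗ ((y ⊗ y ⊖ z) ⊗ z) ⊕ (d ⊗ z ⊕ y ⊗ y) ⊗ z) ⊜
              :0 ⊕ ((z ⊖ x ⊗ x) ⊗ (y ⊗ y) ⊕ (d ⊗ z ⊕ y ⊗ y) ⊗ (y ⊗ y))) tt q q′ z (d₁ * d₂))))
        ... | tri> _ _ h = ⊥-elim (pos≢0 (+-pos (*-pos 0<d (*-pos (<⇒pos h) 0<z)) (*-pos (<⇒pos (<-trans x²<y² h)) 0<y²))
          (lin (sym e) (ring 4 (λ x y z d → d ⊗ ((z ⊖ y ⊗ y) ⊗ z) ⊕ (z ⊖ x ⊗ x) ⊗ (y ⊗ y) ⊕ d ⊗ ((y ⊗ y ⊖ z) ⊗ z) ⊜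
            :0 ⊕ (z ⊖ x ⊗ x) ⊗ (y ⊗ y)) tt q q′ z (d₁ * d₂))))
        x²<z : q * q < z
        x²<z = pos⇒< (*-cancel-pos 0<y² (pos-by (*-pos 0<d (*-pos (<⇒pos z<y²) 0<z)) (trans e (R.*-comm _ _))))
        m<1 : m < 1#
        m<1 = pos⇒< (*-cancel-pos 0<y² (pos-by (<⇒pos z<y²) (lin (cong₂ _+_ (cong (q′ *_) mq′≡p) pq′≡z)
          (ring 4 (λ y m p z → y ⊗ y ⊖ z ⊕ (y ⊗ p ⊕ z) ⊜ y ⊗ y ⊗ (:1 ⊖ m) ⊕ (y ⊗ (m ⊗ y) ⊕ p ⊗ y)) tt q′ m p z))))
        n<1 : n < 1#
        n<1 = pos⇒< (*-cancel-pos 0<z (pos-by (<⇒pos x²<z) (lin (cong₂ _+_ (cong (n *_) (sym p′q≡z)) (cong (q *_) np′≡q))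
          (ring 4 (λ x n p′ z → z ⊖ x ⊗ x ⊕ (n ⊗ (p′ ⊗ x) ⊕ x ⊗ x) ⊜ z ⊗ (:1 ⊖ n) ⊕ (n ⊗ z ⊕ x ⊗ (n ⊗ p′))) tt q n p′ z))))

      famB⇒chainB : RatiosOf Q p q → RatiosOf Q p′ q′ → FamB → ChainB Q p q
      famB⇒chainB r r′ (inj₁ ((_ , _ , q<q′) , e)) =
        equation⇒chainB (inj₁ (refl , refl)) (inj₁ (refl , refl)) r r (RatiosOf-swap r′) q<q′ (B₁-unfactor e)
      famB⇒chainB r r′ (inj₂ ((_ , _ , q<q′) , e)) =
        equation⇒chainB (inj₁ (refl , refl)) (inj₂ (refl , refl)) r r′ (RatiosOf-swap r′) q<q′ (B₂-unfactor e)

  -- From chains on labelled quadrangles to the two equivalences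

  at-label : ∀ (X : Point → Point → Point → Point → Set) Q k → X (V Q k) (V Q (suc k)) (V Q (suc (suc k))) (V Q (suc (suc (suc k)))) →
    Σ (Fin 4) λ j → X (relabelled Q j true 0F) (relabelled Q j true 1F) (relabelled Q j true 2F) (relabelled Q j true 3F)
  at-label X Q 0 h = 0F , h
  at-label X Q 1 h = 1F , h
  at-label X Q 2 h = 2F , h
  at-label X Q 3 h = 3F , h
  at-label X Q (suc (suc (suc (suc k)))) h = at-label X Q k h

  at-index : ∀ (X : Point → Point → Point → Point → Set) Q j → X (relabelled Q j true 0F) (relabelled Q j true 1F) (relabelled Q j true 2F) (relabelled Q j true 3F) →
    Σ ℕ λ k → X (V Q k) (V Q (suc k)) (V Q (suc (suc k))) (V Q (suc (suc (suc k))))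
  at-index X Q 0F h = 0 , h
  at-index X Q 1F h = 1 , h
  at-index X Q 2F h = 2 , h
  at-index X Q 3F h = 3 , h

  module _ {Q : Quad} (g : Generic Q) (Dissection : Point → Point → Point → Point → Set) (Chain : Carrier → Carrier → Set)
           (swap : ∀ {a b} → Chain a b → Chain b a) where
    private
      Dissected : Set
      Dissected = Σ ℕ λ k → Dissection (V Q k) (V Q (suc k)) (V Q (suc (suc k))) (V Q (suc (suc (suc k))))

      corners : ∀ W → Oriented W → Oriented (quad (W 0F) (W 1F) (W 2F) (W 3F))
      corners W (σ by h) = oriented σ (h 0) (h 1) (h 2) (h 3)

    -- Common to both types: only `analyse` knows how the cuts are arranged, and the symmetries of
    -- the chain do the rest.
    dissection⇒shape : (∀ {a b} → 0# < a → 0# < b → Chain a b → Chain (a ⁻¹) (b ⁻¹)) →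
      (∀ A B C D {a b} → Oriented (quad A B C D) → HasRatios (quad A B C D) a b → RatiosOf Q a b →
        Dissection A B C D → Chain a b) →
      Dissected →
      ∃[ k ] ∃[ β ] ∃[ p ] ∃[ q ] ∃[ p′ ] ∃[ q′ ] (HasShape (relabelled Q k β) p q p′ q′ × Chain p q)
    dissection⇒shape invert analyse (k , d) =
      k₀ , β , p , q , proj₁ shaped , proj₁ (proj₂ shaped) , proj₂ (proj₂ shaped) , ch₀
      where
      located : Σ (Fin 4) λ j → Dissection (relabelled Q j true 0F) (relabelled Q j true 1F) (relabelled Q j true 2F) (relabelled Q j true 3F)
      located = at-label Dissection Q k d
      j = proj₁ located
      W = relabelled Q j true
      o : Oriented W
      o = oriented-rl j true (orientation g)
      h : HasRatios W (turn W 2 * turn W 1 ⁻¹) (turn W 3 * turn W 0 ⁻¹)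
      h = ratios (quotient-* (turn≢0 o 1)) (quotient-* (turn≢0 o 0))
      ch : Chain (turn W 2 * turn W 1 ⁻¹) (turn W 3 * turn W 0 ⁻¹)
      ch = analyse (W 0F) (W 1F) (W 2F) (W 3F) (corners W o) (ratios (HasRatios.ratio₁ h) (HasRatios.ratio₂ h)) (labelled j true h) (proj₂ located)
      normal : ∃[ p ] ∃[ q ] ((p < q) × (q < 1#) × RatiosOf Q p q × Chain p q)
      normal = normalize g Chain swap invert (labelled j true h) ch
      p = proj₁ normal
      q = proj₁ (proj₂ normal)
      r : RatiosOf Q p q
      r = proj₁ (proj₂ (proj₂ (proj₂ (proj₂ normal))))
      ch₀ : Chain p q
      ch₀ = proj₂ (proj₂ (proj₂ (proj₂ (proj₂ normal))))
      open RatiosOf r renaming (start to k₀; forward to β; has to h₀)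
      shaped : ∃[ p′ ] ∃[ q′ ] HasShape (relabelled Q k₀ β) p q p′ q′
      shaped = ratios⇒shape (generic-rl k₀ β g) h₀ (proj₁ (proj₂ (proj₂ normal))) (proj₁ (proj₂ (proj₂ (proj₂ normal))))

    shape⇒dissection :
      (∀ A B C D {a b} → Oriented (quad A B C D) → HasRatios (quad A B C D) a b → Below a b → Chain a b → Dissection A B C D) →
      ∀ {p q p′ q′} k β → HasShape (relabelled Q k β) p q p′ q′ → Chain p q → Dissected
    shape⇒dissection construct {p} {q} k β hs = build k β (shape-ratios hs)
      where
      open Shape (HasShape.shape hs)
      forward : ∀ {a b} j → HasRatios (relabelled Q j true) a b → Below a b → Chain a b → Dissected
      forward j (ratios h₁ h₂) lt ch = at-index Dissection Q j (construct (relabelled Q j true 0F) (relabelled Q j true 1F) (relabelled Q j true 2F) (relabelled Q j true 3F) (corners (relabelled Q j true) (oriented-rl j true (orientation g)))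
        (ratios h₁ h₂) lt ch)
      build : ∀ k β → HasRatios (relabelled Q k β) p q → Chain p q → Dissected
      build k true  h ch = forward k h (p<1 , q<1) ch
      -- Dissections are stated for forward labellings only. Starting a backward labelling at its
      -- last vertex and reversing it makes it forward, and this exchanges the two ratios.
      build k false h ch = forward (relabel k false 3) (HasRatios-cong (rl-∘ Q k false 3F false) (swap-ratios h)) (q<1 , p<1) (swap ch)

  module _ {Q : Quad} (g : Generic Q) where

    private
      other-ratios : ∀ {p q p′ q′} k β → HasShape (relabelled Q k β) p q p′ q′ → RatiosOf Q p′ q′
      other-ratios k β hs = RatiosOf-rl {Q} k β (labelled 2F false (shape-ratios′ hs))

      base : ∀ {x y} → FamB₁ x y ⊎ FamB₂ x y → Base x y
      base (inj₁ (b , _)) = b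
      base (inj₂ (b , _)) = b

    selfAffinityA⇔ : SelfAffinityA Q ⇔ (∃[ x ] ∃[ y ] (AffineType Q x y × FamA x y))
    selfAffinityA⇔ = mk⇔ necessary sufficient
      where
      typed : (∃[ k ] ∃[ β ] ∃[ p ] ∃[ q ] ∃[ p′ ] ∃[ q′ ] (HasShape (relabelled Q k β) p q p′ q′ × ChainA Q p q)) →
        ∃[ x ] ∃[ y ] (AffineType Q x y × FamA x y)
      typed (k , β , p , q , p′ , q′ , hs , ch) = q , q′ ,
        shape⇒affineType {Q} {p} {q} {p′} {q′} k β (oriented-rl k β (orientation g)) hs ,
        equation⇒famA (HasShape.shape hs) (chainA⇒equation (HasShape.shape hs) g (classify k β g hs) ch)
      necessary : SelfAffinityA Q → ∃[ x ] ∃[ y ] (AffineType Q x y × FamA x y)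
      necessary sa = typed (dissection⇒shape g (DissectionA Q) (ChainA Q) chainA-swap (chainA-invert g)
        (dissectionA⇒chain g) sa)
      dissected : ∀ {x y} → FamA x y → (∃[ k ] ∃[ β ] ∃[ p ] ∃[ p′ ] HasShape (relabelled Q k β) p x p′ y) → SelfAffinityA Q
      dissected f (k , β , p , p′ , hs) = shape⇒dissection g (DissectionA Q) (ChainA Q) chainA-swap (chain⇒dissectionA g) k β hs
        (famA⇒chainA (HasShape.shape hs) (other-ratios k β hs) f)
      sufficient : ∃[ x ] ∃[ y ] (AffineType Q x y × FamA x y) → SelfAffinityA Q
      sufficient (x , y , t , f) = dissected f (affineType⇒shape {Q} {x} {y} t (proj₁ f))

    selfAffinityB⇔ : SelfAffinityB Q ⇔ (∃[ x ] ∃[ y ] (AffineType Q x y × (FamB₁ x y ⊎ FamB₂ x y)))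
    selfAffinityB⇔ = mk⇔ necessary sufficient
      where
      typed : (∃[ k ] ∃[ β ] ∃[ p ] ∃[ q ] ∃[ p′ ] ∃[ q′ ] (HasShape (relabelled Q k β) p q p′ q′ × ChainB Q p q)) →
        ∃[ x ] ∃[ y ] (AffineType Q x y × (FamB₁ x y ⊎ FamB₂ x y))
      typed (k , β , p , q , p′ , q′ , hs , ch) = q , q′ ,
        shape⇒affineType {Q} {p} {q} {p′} {q′} k β (oriented-rl k β (orientation g)) hs ,
        chainB⇒equation (HasShape.shape hs) g (classify k β g hs) ch
      necessary : SelfAffinityB Q → ∃[ x ] ∃[ y ] (AffineType Q x y × (FamB₁ x y ⊎ FamB₂ x y))
      necessary sa = typed (dissection⇒shape g (DissectionB Q) (ChainB Q) (chainB-swap g) (chainB-invert g)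
        (dissectionB⇒chain g) sa)
      dissected : ∀ {x y} → FamB₁ x y ⊎ FamB₂ x y → (∃[ k ] ∃[ β ] ∃[ p ] ∃[ p′ ] HasShape (relabelled Q k β) p x p′ y) → SelfAffinityB Q
      dissected f (k , β , p , p′ , hs) = shape⇒dissection g (DissectionB Q) (ChainB Q) (chainB-swap g)
        (λ A B C D o h _ ch → chain⇒dissectionB g A B C D o h ch) k β hs
        (famB⇒chainB (HasShape.shape hs) g (classify k β g hs) (labelled k β (shape-ratios hs)) (other-ratios k β hs) f)
      sufficient : ∃[ x ] ∃[ y ] (AffineType Q x y × (FamB₁ x y ⊎ FamB₂ x y)) → SelfAffinityB Q
      sufficient (x , y , t , f) = dissected f (affineType⇒shape {Q} {x} {y} t (base f))

theorem4 : (ℝ : RealField) → let open Geometry ℝ in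
    (∀ (Q : Quad) → ConvexQuad Q → NonTrapezoid Q →
    SelfAffinityA Q ⇔ (∃[ x ] ∃[ y ] (AffineType Q x y × FamA x y)))
    × (∀ (Q : Quad) → ConvexQuad Q → NonTrapezoid Q →
    SelfAffinityB Q ⇔ (∃[ x ] ∃[ y ] (AffineType Q x y × (FamB₁ x y ⊎ FamB₂ x y))))
theorem4 ℝ = (λ Q c n → selfAffinityA⇔ {Q} (nonTrapezoid⇒generic {Q} c n)) , (λ Q c n → selfAffinityB⇔ {Q} (nonTrapezoid⇒generic {Q} c n))
  where
  open Proof ℝ
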